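{- Let $n$ be an odd positive integer. Then $$259\,\tau(n)=\tfrac{1}{2^3\cdot3^2}\left[17\cdot691\,\sigma_3(n)+8\cdot691\,\sigma_5(n)+2\cdot691\,\sigma_7(n)-9\,\sigma_{11}(n)\right]-\tfrac{691\cdot2^2}{3^2}\sum_{m=1}^{n-1}\left[\sigma_3^{\dagger}(m)\sigma_7^{\dagger}(n-m)-\sigma_5^{\dagger}(m)\sigma_5^{\dagger}(n-m)\right].$$
   Context: Ramanujan's tau function $\tau(n)$ is defined by $q\prod_{r\ge1}(1-q^r)^{24}=\sum_{n=1}^{\infty}\tau(n)q^n$. For positive integers $r,n$, $\sigma_r(n):=\sum_{d\mid n,\,d>0}d^r$ and $\sigma_r^{\dagger}(n):=\sum_{d\mid n,\,d>0}(-1)^{d}d^r$. -}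

module Defs where

open import Data.Bool using (if_then_else_)
open import Data.Fin using (toℕ)
open import Data.Integer using (ℤ; +_; _+_; _*_; _-_; _^_; 0ℤ; 1ℤ; -1ℤ)
open import Data.Integer.Properties as ℤₚ using (+-*-semiring)
open import Data.List using (List; foldr; map; filter; upTo)
open import Data.Nat as ℕ using (ℕ; zero; suc; _∸_; _≤_; _<_; _≡ᵇ_; s≤s; s≤s⁻¹)
open import Data.Nat.Divisibility using (_∣?_)
open import Data.Nat.Properties as ℕₚ using ()
open import Data.Rational using (ℚ; _/_)
open import Relation.Binary.PropositionalEquality using (_≡_; refl; trans; cong; cong₂; module ≡-Reasoning)

open import Algebra.Properties.Semiring.Sum +-*-semiring using (sum-syntax; sum⁺-syntax; sum-cong-≗)

ι : ℤ → ℚ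
ι z = z / 1

divisors : ℕ → List ℕ
divisors n = filter (_∣? n) (map suc (upTo n))

sumℤ : List ℤ → ℤ
sumℤ = foldr _+_ 0ℤ

σ : ℕ → ℕ → ℤ
σ r n = sumℤ (map (λ d → (+ d) ^ r) (divisors n))

σ† : ℕ → ℕ → ℤ
σ† r n = sumℤ (map (λ d → -1ℤ ^ d * (+ d) ^ r) (divisors n))

-- The index i : Fin (n ∸ 1) stands for m = i + 1, so the sum is empty for n = 1.
Σ[1≤m<_] : ℕ → (ℕ → ℤ) → ℤ
Σ[1≤m< n ] f = ∑[ i < n ∸ 1 ] f (suc (toℕ i))

-- A formal power series in q, given by its coefficients.
Series : Set
Series = ℕ → ℤ

infixl 7 _⊛_
infixl 6 _⊖_
infixr 8 _^ₛ_

q^_ : ℕ → Series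
(q^ r) n = if n ≡ᵇ r then 1ℤ else 0ℤ

1ₛ : Series
1ₛ = q^ 0

_⊖_ : Series → Series → Series
(f ⊖ g) n = f n - g n

_⊛_ : Series → Series → Series
(f ⊛ g) n = ∑[ i ≤ n ] (f (toℕ i) * g (n ∸ toℕ i))

_^ₛ_ : Series → ℕ → Series
f ^ₛ zero  = 1ₛ
f ^ₛ suc k = f ⊛ (f ^ₛ k)

∏ : ℕ → (ℕ → Series) → Series
∏ zero    F = 1ₛ
∏ (suc N) F = ∏ N F ⊛ F (suc N)

-- The infinite product over r ≥ 1, read off the diagonal of the partial
-- products.  This is their coefficientwise limit whenever F r ≡ 1 (mod q^r);
-- see ∏∞-limit.
∏∞ : (ℕ → Series) → Series
∏∞ F n = ∏ n F n

τ-factor : ℕ → Series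
τ-factor r = (1ₛ ⊖ q^ r) ^ₛ 24

τ : ℕ → ℤ
τ = q^ 1 ⊛ ∏∞ τ-factor

_≡1mod-q^_ : Series → ℕ → Set
f ≡1mod-q^ r = ∀ i → i < r → f i ≡ 1ₛ i

⊛-cong-≤ : ∀ f {g h} n → (∀ i → i ≤ n → g i ≡ h i) → (f ⊛ g) n ≡ (f ⊛ h) n
⊛-cong-≤ f n eq = sum-cong-≗ {suc n} λ i →
  cong (f (toℕ i) *_) (eq (n ∸ toℕ i) (ℕₚ.m∸n≤m n (toℕ i)))

⊛-identityʳ : ∀ f n → (f ⊛ 1ₛ) n ≡ f n
⊛-identityʳ f zero    = trans (ℤₚ.+-identityʳ _) (ℤₚ.*-identityʳ (f 0))
⊛-identityʳ f (suc n) = begin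
  f 0 * 0ℤ + ((λ i → f (suc i)) ⊛ 1ₛ) n  ≡⟨ cong₂ _+_ (ℤₚ.*-zeroʳ (f 0)) (⊛-identityʳ (λ i → f (suc i)) n) ⟩
  0ℤ + f (suc n)                         ≡⟨ ℤₚ.+-identityˡ _ ⟩
  f (suc n)                              ∎
  where open ≡-Reasoning

⊛-≡1 : ∀ {f g r} → f ≡1mod-q^ r → g ≡1mod-q^ r → (f ⊛ g) ≡1mod-q^ r
⊛-≡1 {f} p p′ i i<r = trans
  (trans (⊛-cong-≤ f i (λ j j≤i → p′ j (ℕₚ.≤-<-trans j≤i i<r))) (⊛-identityʳ f i))
  (p i i<r)

^ₛ-≡1 : ∀ {f r} k → f ≡1mod-q^ r → (f ^ₛ k) ≡1mod-q^ r
^ₛ-≡1         zero    p i _ = refl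
^ₛ-≡1 {f} {r} (suc k) p     = ⊛-≡1 {f} {f ^ₛ k} {r} p (^ₛ-≡1 {f} {r} k p)

∏∞-limit : ∀ F → (∀ r → F r ≡1mod-q^ r) → ∀ n N → n ≤ N → ∏ N F n ≡ ∏∞ F n
∏∞-limit F F≡1 n N n≤N = go (ℕₚ.≤⇒≤′ n≤N)
  where
  go : ∀ {N} → n ℕ.≤′ N → ∏ N F n ≡ ∏∞ F n
  go (ℕ.≤′-reflexive refl) = refl
  go {suc N} (ℕ.≤′-step p) = trans
    (⊛-cong-≤ (∏ N F) n (λ i i≤n → F≡1 (suc N) i (s≤s (ℕₚ.≤-trans i≤n (ℕₚ.≤′⇒≤ p)))))
    (trans (⊛-identityʳ (∏ N F) n) (go p))

τ-factor≡1 : ∀ r → τ-factor r ≡1mod-q^ r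
τ-factor≡1 r = ^ₛ-≡1 {1ₛ ⊖ q^ r} {r} 24 (λ i i<r → trans (cong (λ z → 1ₛ i - z) (q^-< i r i<r)) (ℤₚ.+-identityʳ (1ₛ i)))
  where
  q^-< : ∀ i r → i < r → (q^ r) i ≡ 0ℤ
  q^-< zero    (suc r) _   = refl
  q^-< (suc i) (suc r) i<r = q^-< i r (s≤s⁻¹ i<r)

{-# OPTIONS --safe #-}
module Submission where

-- Write σ†ᵣ for the generating series of the divisor sums with sign (-1)ᵈ.  Summing over the
-- solutions of a x + b y = n, Euclid's step (a, b, x, y) ↦ (a - b, b, x, x + y) yields, for
-- each even function of a ± b, a convolution identity for these divisor sums (Liouville).
-- The cases of low degree express the Eisenstein series of weight 6, 8, 10 and 12 with signs
-- as polynomials in a series e of weight 2 and Q = 1 + 16 σ†₃ of weight 4, and they compute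
-- the logarithmic derivatives of Q and of U = e² - Q.  Comparing logarithmic derivatives,
-- Q² U is 64 times the product q ∏ (1 - qʳ)²⁴, whereas Q U² has only even exponents.  The
-- theorem is then the odd part of the weight 12 identity
--   18 R₁₂ = 2 (691 (Q R₈ - 8 R₆²) + 4662 Q² U + 144 Q U²).

open import Algebra.Bundles using (CommutativeRing)
import Algebra.Solver.Ring as RingSolver
open import Algebra.Solver.Ring.AlmostCommutativeRing using (fromCommutativeRing; _-Raw-AlmostCommutative⟶_; -raw-almostCommutative⟶)
import Data.Integer as ℤ
open import Data.Integer using (ℤ; +_; -[1+_]; 0ℤ; 1ℤ; -1ℤ)
import Data.Integer.Properties as ℤₚ
import Data.Maybe as Maybe
open import Data.Product using (_×_; _,_; proj₁; proj₂)
open import Data.Vec.N-ary using (N-ary; Eq; curryⁿ; curryⁿ-cong)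
open import Level using (0ℓ)
import Relation.Binary.PropositionalEquality as ≡
open import Relation.Binary.PropositionalEquality using (_≡_; refl)
import Relation.Binary.Reflection as Reflection
open import Relation.Nullary.Decidable using (dec⇒maybe)

-- Behind the formal identities stands level 2 modularity: classically e = 2 E₂(q²) - E₂(q), and
-- with Δ = η²⁴ one has Q = η(q)¹⁶ / η(q²)⁸ and U = 64 η(q²)¹⁶ / η(q)⁸, whence Q² U = 64 Δ(q) and Q
-- U² = 4096 Δ(q²). Neither modularity nor product expansions of Q and U are available here. Finite
-- dimension of spaces of forms is replaced by explicit convolution identities, and product
-- expansions by the fact that a power series is determined by its logarithmic derivative and its
-- leading coefficient.
--
-- The shape of the theorem is forced as follows. The signed Eisenstein series are Q times
-- polynomials in e and Q; in weight 12, R₁₂ = 16 e⁴ Q + 486 e² Q² + 189 Q³. Substituting e² = U + Q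
-- gives 9 R₁₂ = 9 · 691 Q³ + 4662 Q² U + 144 Q U². The two convolutions are combined so as to
-- produce the cube: Q R₈ - 8 R₆² = 9 Q³. The constant 259 is 4662 / 18. Oddness of n enters twice:
-- it removes Q U², and it turns σ†ᵣ(n) into -σᵣ(n).

module SyntacticSolver (R : CommutativeRing 0ℓ 0ℓ)
  (const : CommutativeRing.rawRing ℤₚ.+-*-commutativeRing -Raw-AlmostCommutative⟶ fromCommutativeRing R) where

  open CommutativeRing R using (_≈_; reflexive)
  open RingSolver (CommutativeRing.rawRing ℤₚ.+-*-commutativeRing) (fromCommutativeRing R) const
    (λ a b → Maybe.map (λ p → reflexive (≡.cong (_-Raw-AlmostCommutative⟶_.⟦_⟧ const) p)) (dec⇒maybe (a ℤₚ.≟ b)))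
    public
  open Reflection (CommutativeRing.setoid R) var ⟦_⟧ ⟦_⟧↓ correct using (close)

  -- The normal forms are compared as syntax: comparing their values, as solve does, makes
  -- the type checker unfold the ring operations.
  solve! : ∀ n (f : N-ary n (Polynomial n) (Polynomial n × Polynomial n)) →
    normalise (proj₁ (close n f)) ≡ normalise (proj₂ (close n f)) →
    Eq n _≈_ (curryⁿ ⟦ proj₁ (close n f) ⟧) (curryⁿ ⟦ proj₂ (close n f) ⟧)
  solve! n f eq = curryⁿ-cong _≈_ ⟦ proj₁ (close n f) ⟧ ⟦ proj₂ (close n f) ⟧
    λ ρ → prove ρ (proj₁ (close n f)) (proj₂ (close n f)) (reflexive (≡.cong (λ p → ⟦ p ⟧N ρ) eq))

module ℤ-Solver = SyntacticSolver ℤₚ.+-*-commutativeRing (-raw-almostCommutative⟶ (fromCommutativeRing ℤₚ.+-*-commutativeRing))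

-- Relations between Eisenstein series in an abstract ring with a derivation

module EisensteinRing (R : CommutativeRing 0ℓ 0ℓ)
  (const : CommutativeRing.rawRing ℤₚ.+-*-commutativeRing -Raw-AlmostCommutative⟶ fromCommutativeRing R) where

  open CommutativeRing R renaming (Carrier to A; refl to ≈-refl)
  open _-Raw-AlmostCommutative⟶_ const using () renaming (⟦_⟧ to ⟨_⟩)
  open SyntacticSolver R const using (solve!; _:=_; _:+_; _:*_; _:-_; :-_; con)

  -- a ≈ b follows from an identity a = b + k₁ (l₁ - r₁) + k₂ (l₂ - r₂) + … with all lᵢ ≈ rᵢ.
  drop : ∀ {a b k l r} → l ≈ r → a ≈ b → a + k * (l + - r) ≈ b
  drop {a} {b} {k} {l} {r} l≈r a≈b = trans (+-cong a≈b (*-congˡ (+-congʳ l≈r)))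
    (solve! 3 (λ b k r → b :+ k :* (r :+ :- r) := b) refl b k r)

  module Derivation (∂ : A → A) (∂-cong : ∀ {x y} → x ≈ y → ∂ x ≈ ∂ y)
    (∂-+ : ∀ x y → ∂ (x + y) ≈ ∂ x + ∂ y) (∂-* : ∀ x y → ∂ (x * y) ≈ ∂ x * y + x * ∂ y)
    (∂-const : ∀ c → ∂ ⟨ c ⟩ ≈ ⟨ 0ℤ ⟩) where

    ∂-scale : ∀ c x → ∂ (⟨ c ⟩ * x) ≈ ⟨ c ⟩ * ∂ x
    ∂-scale c x = trans (∂-* ⟨ c ⟩ x) (trans (+-congʳ (*-congʳ (∂-const c)))
      (solve! 3 (λ c x y → con 0ℤ :* x :+ c :* y := c :* y) refl ⟨ c ⟩ x (∂ x)))

    ∂-affine : ∀ a c x → ∂ (⟨ a ⟩ + ⟨ c ⟩ * x) ≈ ⟨ c ⟩ * ∂ x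
    ∂-affine a c x = trans (∂-+ ⟨ a ⟩ (⟨ c ⟩ * x)) (trans (+-cong (∂-const a) (∂-scale c x))
      (solve! 1 (λ y → con 0ℤ :+ y := y) refl (⟨ c ⟩ * ∂ x)))

    ∂-affine′ : ∀ a c x → ∂ (⟨ c ⟩ * x + ⟨ a ⟩) ≈ ⟨ c ⟩ * ∂ x
    ∂-affine′ a c x = trans (∂-cong (+-comm (⟨ c ⟩ * x) ⟨ a ⟩)) (∂-affine a c x)

    ∂-- : ∀ x → ∂ (- x) ≈ - ∂ x
    ∂-- x = trans (∂-cong (solve! 1 (λ x → :- x := con -1ℤ :* x) refl x))
      (trans (∂-scale -1ℤ x) (solve! 1 (λ y → con -1ℤ :* y := :- y) refl (∂ x)))

    -- S stands for Σ σ₁(n) qⁿ and tᵣ for Σ σ†ᵣ(n) qⁿ.  The Rₖ are multiples of the Eisenstein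
    -- series of weight k for Γ₀(2) that vanish at the cusp 0; their constant terms are, up
    -- to sign, the numerators of (2ᵏ - 1) ζ(1 - k) / 2.  In weight 2, e is modular and P is not.
    module Eisenstein (S t₁ t₃ t₅ t₇ t₉ t₁₁ : A) where

      e P Q R₆ R₈ R₁₀ R₁₂ U : A
      e = ⟨ + 1 ⟩ + ⟨ + 12 ⟩ * (S + - t₁)
      P = ⟨ + 1 ⟩ + ⟨ -[1+ 7 ] ⟩ * t₁
      Q = ⟨ + 1 ⟩ + ⟨ + 16 ⟩ * t₃
      R₆ = ⟨ + 1 ⟩ + ⟨ -[1+ 7 ] ⟩ * t₅
      R₈ = ⟨ + 17 ⟩ + ⟨ + 32 ⟩ * t₇
      R₁₀ = ⟨ + 31 ⟩ + ⟨ -[1+ 7 ] ⟩ * t₉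
      R₁₂ = ⟨ + 691 ⟩ + ⟨ + 16 ⟩ * t₁₁
      U = e * e + - Q

      -- The hypothesis has the exact shape to which `quad-series` and `lin-series` unfold in
      -- `odd-identity₂`, with its trailing zeros and the derivative of zero, so that the identity
      -- of series can be passed in as it stands. The solver treats ∂ 0 as a variable z. The same
      -- holds for the identities of higher weight.
      R₆-identity :
        ⟨ + 48 ⟩ * (t₁ * t₃) + (⟨ + 48 ⟩ * (t₃ * t₁) + (⟨ -[1+ 47 ] ⟩ * (t₃ * S) + (⟨ -[1+ 47 ] ⟩ * (S * t₃)
          + ⟨ + 0 ⟩))) ≈ ∂ (⟨ + 0 ⟩) + (⟨ + 6 ⟩ * S + (⟨ -[1+ 5 ] ⟩ * t₁ + (⟨ + 8 ⟩ * t₃ + (⟨ + 4 ⟩ * t₅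
          + ⟨ + 0 ⟩)))) →
        R₆ ≈ e * Q
      R₆-identity H0 = trans
        (solve! 5 (λ S t₁ t₃ t₅ z → (con (+ 1) :+ con (-[1+ 7 ]) :* t₅)
          := (con (+ 1) :+ con (+ 12) :* (S :+ :- t₁)) :* (con (+ 1) :+ con (+ 16) :* t₃) :+ con (+ 2) :* (z
            :+ :- (con (+ 0))) :+ con (+ 2) :* (con (+ 48) :* (t₁ :* t₃) :+ (con (+ 48) :* (t₃ :* t₁)
            :+ (con (-[1+ 47 ]) :* (t₃ :* S) :+ (con (-[1+ 47 ]) :* (S :* t₃) :+ con (+ 0)))) :+ :- (z
            :+ (con (+ 6) :* S :+ (con (-[1+ 5 ]) :* t₁ :+ (con (+ 8) :* t₃ :+ (con (+ 4) :* t₅ :+ con (+ 0))))))))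
            refl S t₁ t₃ t₅ (∂ ⟨ 0ℤ ⟩))
        (drop H0 (drop (∂-const 0ℤ) ≈-refl))

      R₈-identity :
        ⟨ + 48 ⟩ * (t₁ * t₅) + (⟨ + 288 ⟩ * (t₃ * t₃) + (⟨ + 48 ⟩ * (t₅ * t₁) + (⟨ -[1+ 47 ] ⟩ * (t₅ * S)
          + (⟨ -[1+ 47 ] ⟩ * (S * t₅) + ⟨ + 0 ⟩)))) ≈ ∂ (⟨ + 0 ⟩) + (⟨ -[1+ 11 ] ⟩ * S + (⟨ + 12 ⟩ * t₁
          + (⟨ -[1+ 35 ] ⟩ * t₃ + (⟨ + 8 ⟩ * t₅ + (⟨ + 4 ⟩ * t₇ + ⟨ + 0 ⟩))))) →
        R₈ ≈ ⟨ + 8 ⟩ * (e * R₆) + ⟨ + 9 ⟩ * (Q * Q)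
      R₈-identity H0 = trans
        (solve! 6 (λ S t₁ t₃ t₅ t₇ z → (con (+ 17) :+ con (+ 32) :* t₇)
          := con (+ 8) :* ((con (+ 1) :+ con (+ 12) :* (S :+ :- t₁)) :* (con (+ 1) :+ con (-[1+ 7 ]) :* t₅))
            :+ con (+ 9) :* ((con (+ 1) :+ con (+ 16) :* t₃) :* (con (+ 1) :+ con (+ 16) :* t₃))
            :+ con (-[1+ 7 ]) :* (z :+ :- (con (+ 0))) :+ con (-[1+ 7 ]) :* (con (+ 48) :* (t₁ :* t₅)
            :+ (con (+ 288) :* (t₃ :* t₃) :+ (con (+ 48) :* (t₅ :* t₁) :+ (con (-[1+ 47 ]) :* (t₅ :* S)
            :+ (con (-[1+ 47 ]) :* (S :* t₅) :+ con (+ 0))))) :+ :- (z :+ (con (-[1+ 11 ]) :* S :+ (con (+ 12) :* t₁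
            :+ (con (-[1+ 35 ]) :* t₃ :+ (con (+ 8) :* t₅ :+ (con (+ 4) :* t₇ :+ con (+ 0)))))))))
            refl S t₁ t₃ t₅ t₇ (∂ ⟨ 0ℤ ⟩))
        (drop H0 (drop (∂-const 0ℤ) ≈-refl))

      R₁₀-identity :
        ⟨ + 48 ⟩ * (t₁ * t₇) + (⟨ + 720 ⟩ * (t₃ * t₅) + (⟨ + 720 ⟩ * (t₅ * t₃) + (⟨ + 48 ⟩ * (t₇ * t₁)
          + (⟨ -[1+ 47 ] ⟩ * (t₇ * S) + (⟨ -[1+ 47 ] ⟩ * (S * t₇) + ⟨ + 0 ⟩))))) ≈ ∂ (⟨ + 0 ⟩) + (⟨ + 51 ⟩ * S
          + (⟨ -[1+ 50 ] ⟩ * t₁ + (⟨ + 180 ⟩ * t₃ + (⟨ -[1+ 89 ] ⟩ * t₅ + (⟨ + 8 ⟩ * t₇ + (⟨ + 4 ⟩ * t₉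
          + ⟨ + 0 ⟩)))))) →
        ⟨ + 2 ⟩ * R₁₀ ≈ e * R₈ + ⟨ + 45 ⟩ * (Q * R₆)
      R₁₀-identity H0 = trans
        (solve! 7 (λ S t₁ t₃ t₅ t₇ t₉ z → con (+ 2) :* (con (+ 31) :+ con (-[1+ 7 ]) :* t₉)
          := (con (+ 1) :+ con (+ 12) :* (S :+ :- t₁)) :* (con (+ 17) :+ con (+ 32) :* t₇)
            :+ con (+ 45) :* ((con (+ 1) :+ con (+ 16) :* t₃) :* (con (+ 1) :+ con (-[1+ 7 ]) :* t₅))
            :+ con (+ 4) :* (z :+ :- (con (+ 0))) :+ con (+ 4) :* (con (+ 48) :* (t₁ :* t₇)
            :+ (con (+ 720) :* (t₃ :* t₅) :+ (con (+ 720) :* (t₅ :* t₃) :+ (con (+ 48) :* (t₇ :* t₁)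
            :+ (con (-[1+ 47 ]) :* (t₇ :* S) :+ (con (-[1+ 47 ]) :* (S :* t₇) :+ con (+ 0)))))) :+ :- (z
            :+ (con (+ 51) :* S :+ (con (-[1+ 50 ]) :* t₁ :+ (con (+ 180) :* t₃ :+ (con (-[1+ 89 ]) :* t₅
            :+ (con (+ 8) :* t₇ :+ (con (+ 4) :* t₉ :+ con (+ 0)))))))))) refl S t₁ t₃ t₅ t₇ t₉ (∂ ⟨ 0ℤ ⟩))
        (drop H0 (drop (∂-const 0ℤ) ≈-refl))

      R₁₂-identity :
        ⟨ + 48 ⟩ * (t₁ * t₉) + (⟨ + 1344 ⟩ * (t₃ * t₇) + (⟨ + 3360 ⟩ * (t₅ * t₅) + (⟨ + 1344 ⟩ * (t₇ * t₃)
          + (⟨ + 48 ⟩ * (t₉ * t₁) + (⟨ -[1+ 47 ] ⟩ * (t₉ * S) + (⟨ -[1+ 47 ] ⟩ * (S * t₉) + ⟨ + 0 ⟩)))))) ≈ ∂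
          (⟨ + 0 ⟩) + (⟨ -[1+ 371 ] ⟩ * S + (⟨ + 372 ⟩ * t₁ + (⟨ -[1+ 1427 ] ⟩ * t₃ + (⟨ + 840 ⟩ * t₅
          + (⟨ -[1+ 167 ] ⟩ * t₇ + (⟨ + 8 ⟩ * t₉ + (⟨ + 4 ⟩ * t₁₁ + ⟨ + 0 ⟩))))))) →
        R₁₂ ≈ ⟨ + 4 ⟩ * (e * R₁₀) + ⟨ + 21 ⟩ * (Q * R₈) + ⟨ + 210 ⟩ * (R₆ * R₆)
      R₁₂-identity H0 = trans
        (solve! 8 (λ S t₁ t₃ t₅ t₇ t₉ t₁₁ z → (con (+ 691) :+ con (+ 16) :* t₁₁)
          := con (+ 4) :* ((con (+ 1) :+ con (+ 12) :* (S :+ :- t₁)) :* (con (+ 31) :+ con (-[1+ 7 ]) :* t₉))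
            :+ con (+ 21) :* ((con (+ 1) :+ con (+ 16) :* t₃) :* (con (+ 17) :+ con (+ 32) :* t₇))
            :+ con (+ 210) :* ((con (+ 1) :+ con (-[1+ 7 ]) :* t₅) :* (con (+ 1) :+ con (-[1+ 7 ]) :* t₅))
            :+ con (-[1+ 3 ]) :* (z :+ :- (con (+ 0))) :+ con (-[1+ 3 ]) :* (con (+ 48) :* (t₁ :* t₉)
            :+ (con (+ 1344) :* (t₃ :* t₇) :+ (con (+ 3360) :* (t₅ :* t₅) :+ (con (+ 1344) :* (t₇ :* t₃)
            :+ (con (+ 48) :* (t₉ :* t₁) :+ (con (-[1+ 47 ]) :* (t₉ :* S) :+ (con (-[1+ 47 ]) :* (S :* t₉)
            :+ con (+ 0))))))) :+ :- (z :+ (con (-[1+ 371 ]) :* S :+ (con (+ 372) :* t₁ :+ (con (-[1+ 1427 ]) :* t₃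
            :+ (con (+ 840) :* t₅ :+ (con (-[1+ 167 ]) :* t₇ :+ (con (+ 8) :* t₉ :+ (con (+ 4) :* t₁₁
            :+ con (+ 0))))))))))) refl S t₁ t₃ t₅ t₇ t₉ t₁₁ (∂ ⟨ 0ℤ ⟩))
        (drop H0 (drop (∂-const 0ℤ) ≈-refl))

      -- With `∂e-identity` this is the level 2 analogue of Ramanujan's differential equations. The
      -- first hypothesis supplies ∂ t₃ together with a term t₅, which the second one, the relation
      -- behind R₆ = e Q, eliminates.
      ∂Q-identity :
        ⟨ -[1+ 7 ] ⟩ * (t₁ * t₃) + (⟨ -[1+ 7 ] ⟩ * (t₃ * t₁) + ⟨ + 0 ⟩) ≈ ∂ (⟨ + 2 ⟩ * t₃ + ⟨ + 0 ⟩)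
          + (⟨ -[1+ 1 ] ⟩ * t₃ + (⟨ -[1+ 0 ] ⟩ * t₅ + (⟨ + 1 ⟩ * t₁ + ⟨ + 0 ⟩))) →
        ⟨ + 48 ⟩ * (t₁ * t₃) + (⟨ + 48 ⟩ * (t₃ * t₁) + (⟨ -[1+ 47 ] ⟩ * (t₃ * S) + (⟨ -[1+ 47 ] ⟩ * (S * t₃)
          + ⟨ + 0 ⟩))) ≈ ∂ (⟨ + 0 ⟩) + (⟨ + 6 ⟩ * S + (⟨ -[1+ 5 ] ⟩ * t₁ + (⟨ + 8 ⟩ * t₃ + (⟨ + 4 ⟩ * t₅
          + ⟨ + 0 ⟩)))) →
        ∂ Q ≈ Q * (P + - e)
      ∂Q-identity H0 H1 = trans
        (solve! 8 (λ S t₁ t₃ t₅ z zQ z₃ d₃ → zQ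
          := (con (+ 1) :+ con (+ 16) :* t₃) :* ((con (+ 1) :+ con (-[1+ 7 ]) :* t₁) :+ :- (con (+ 1)
            :+ con (+ 12) :* (S :+ :- t₁))) :+ con (+ 1) :* (zQ :+ :- (con (+ 16) :* d₃)) :+ con (-[1+ 7 ]) :* (z₃
            :+ :- (con (+ 2) :* d₃)) :+ con (-[1+ 1 ]) :* (z :+ :- (con (+ 0)))
            :+ con (-[1+ 7 ]) :* (con (-[1+ 7 ]) :* (t₁ :* t₃) :+ (con (-[1+ 7 ]) :* (t₃ :* t₁) :+ con (+ 0))
            :+ :- (z₃ :+ (con (-[1+ 1 ]) :* t₃ :+ (con (-[1+ 0 ]) :* t₅ :+ (con (+ 1) :* t₁ :+ con (+ 0))))))
            :+ con (-[1+ 1 ]) :* (con (+ 48) :* (t₁ :* t₃) :+ (con (+ 48) :* (t₃ :* t₁)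
            :+ (con (-[1+ 47 ]) :* (t₃ :* S) :+ (con (-[1+ 47 ]) :* (S :* t₃) :+ con (+ 0)))) :+ :- (z
            :+ (con (+ 6) :* S :+ (con (-[1+ 5 ]) :* t₁ :+ (con (+ 8) :* t₃ :+ (con (+ 4) :* t₅ :+ con (+ 0))))))))
            refl S t₁ t₃ t₅ (∂ ⟨ 0ℤ ⟩) (∂ Q) (∂ (⟨ + 2 ⟩ * t₃ + ⟨ 0ℤ ⟩)) (∂ t₃))
        (drop H1 (drop H0 (drop (∂-const 0ℤ) (drop (∂-affine′ 0ℤ (+ 2) t₃)
          (drop (∂-affine (+ 1) (+ 16) t₃) ≈-refl)))))

      -- The first hypothesis contains 2 ∂ t₁ and the second 24 ∂ S, so the second minus twelve
      -- times the first contains 24 ∂ (S - t₁), which is 2 ∂ e.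
      ∂e-identity :
        ⟨ -[1+ 3 ] ⟩ * (t₁ * t₁) + ⟨ + 0 ⟩ ≈ ∂ (⟨ + 2 ⟩ * t₁ + ⟨ + 0 ⟩) + (⟨ -[1+ 0 ] ⟩ * t₁ + (⟨ -[1+ 0 ] ⟩ * t₃
          + ⟨ + 0 ⟩)) →
        ⟨ + 48 ⟩ * (t₁ * t₁) + (⟨ -[1+ 47 ] ⟩ * (t₁ * S) + (⟨ -[1+ 47 ] ⟩ * (S * t₁) + ⟨ + 0 ⟩)) ≈ ∂ (⟨ + 24 ⟩ * S
          + ⟨ + 0 ⟩) + (⟨ -[1+ 11 ] ⟩ * S + (⟨ + 8 ⟩ * t₁ + (⟨ + 4 ⟩ * t₃ + ⟨ + 0 ⟩))) →
        ⟨ + 2 ⟩ * ∂ e ≈ P * e + - Q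
      ∂e-identity H0 H1 = trans
        (solve! 10 (λ S t₁ t₃ zₑ z₁ zS d₁ dS d d₁′ → con (+ 2) :* zₑ
          := (con (+ 1) :+ con (-[1+ 7 ]) :* t₁) :* (con (+ 1) :+ con (+ 12) :* (S :+ :- t₁)) :+ :- (con (+ 1)
            :+ con (+ 16) :* t₃) :+ con (+ 2) :* (zₑ :+ :- (con (+ 12) :* d)) :+ con (+ 24) :* (d :+ :- (dS :+ d₁′))
            :+ con (+ 24) :* (d₁′ :+ :- (:- d₁)) :+ con (+ 12) :* (z₁ :+ :- (con (+ 2) :* d₁))
            :+ con (-[1+ 0 ]) :* (zS :+ :- (con (+ 24) :* dS)) :+ con (+ 12) :* (con (-[1+ 3 ]) :* (t₁ :* t₁)
            :+ con (+ 0) :+ :- (z₁ :+ (con (-[1+ 0 ]) :* t₁ :+ (con (-[1+ 0 ]) :* t₃ :+ con (+ 0)))))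
            :+ con (-[1+ 0 ]) :* (con (+ 48) :* (t₁ :* t₁) :+ (con (-[1+ 47 ]) :* (t₁ :* S)
            :+ (con (-[1+ 47 ]) :* (S :* t₁) :+ con (+ 0))) :+ :- (zS :+ (con (-[1+ 11 ]) :* S :+ (con (+ 8) :* t₁
            :+ (con (+ 4) :* t₃ :+ con (+ 0))))))) refl S t₁ t₃ (∂ e) (∂ (⟨ + 2 ⟩ * t₁ + ⟨ 0ℤ ⟩)) (∂ (⟨ + 24 ⟩ * S
            + ⟨ 0ℤ ⟩)) (∂ t₁) (∂ S) (∂ (S + - t₁)) (∂ (- t₁)))
        (drop H1 (drop H0 (drop (∂-affine′ 0ℤ (+ 24) S) (drop (∂-affine′ 0ℤ (+ 2) t₁) (drop (∂-- t₁)
          (drop (∂-+ S (- t₁)) (drop (∂-affine (+ 1) (+ 12) (S + - t₁)) ≈-refl)))))))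

      -- In 2 e ∂ e - ∂ Q = e (P e - Q) - Q (P - e) the terms e Q cancel, and P (e² - Q) remains.
      ∂U-identity : ⟨ + 2 ⟩ * ∂ e ≈ P * e + - Q → ∂ Q ≈ Q * (P + - e) → ∂ U ≈ U * P
      ∂U-identity ∂e ∂Q = trans
        (solve! 8 (λ e P Q zU zee zQ′ zQ zₑ → zU
          := (e :* e :+ :- Q) :* P :+ con (+ 1) :* (zU :+ :- (zee :+ zQ′)) :+ con (+ 1) :* (zee :+ :- (zₑ :* e
            :+ e :* zₑ)) :+ con (+ 1) :* (zQ′ :+ :- (:- zQ)) :+ e :* (con (+ 2) :* zₑ :+ :- (P :* e :+ :- Q))
            :+ con (-[1+ 0 ]) :* (zQ :+ :- (Q :* (P :+ :- e)))) refl e P Q (∂ U) (∂ (e * e)) (∂ (- Q)) (∂ Q) (∂ e))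
        (drop ∂Q (drop ∂e (drop (∂-- Q) (drop (∂-* e e) (drop (∂-+ (e * e) (- Q)) ≈-refl)))))

      -- The variables R₁₂, R₁₀, R₈, R₆ are eliminated in this order, and each multiplier in the
      -- solver call is what the variable has collected as its coefficient by then. The last one
      -- contains R₆ + e Q because R₆² - (e Q)² factors.
      weight-12-identity : R₆ ≈ e * Q → R₈ ≈ ⟨ + 8 ⟩ * (e * R₆) + ⟨ + 9 ⟩ * (Q * Q) → ⟨ + 2 ⟩ * R₁₀ ≈ e * R₈
        + ⟨ + 45 ⟩ * (Q * R₆) →
        R₁₂ ≈ ⟨ + 4 ⟩ * (e * R₁₀) + ⟨ + 21 ⟩ * (Q * R₈) + ⟨ + 210 ⟩ * (R₆ * R₆) →
        ⟨ + 18 ⟩ * R₁₂ ≈ ⟨ + 2 ⟩ * (⟨ + 691 ⟩ * (Q * R₈ + ⟨ -[1+ 7 ] ⟩ * (R₆ * R₆)) + ⟨ + 4662 ⟩ * (Q * Q * U)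
          + ⟨ + 144 ⟩ * (Q * U * U))
      weight-12-identity h₆ h₈ h₁₀ h₁₂ = trans
        (solve! 6 (λ e Q R₆ R₈ R₁₀ R₁₂ → con (+ 18) :* R₁₂
          := con (+ 2) :* (con (+ 691) :* (Q :* R₈ :+ con (-[1+ 7 ]) :* (R₆ :* R₆))
            :+ con (+ 4662) :* (Q :* Q :* (e :* e :+ :- Q)) :+ con (+ 144) :* (Q :* (e :* e :+ :- Q) :* (e :* e
            :+ :- Q))) :+ con (+ 18) :* (R₁₂ :+ :- (con (+ 4) :* (e :* R₁₀) :+ con (+ 21) :* (Q :* R₈)
            :+ con (+ 210) :* (R₆ :* R₆))) :+ (con (+ 36) :* e) :* (con (+ 2) :* R₁₀ :+ :- (e :* R₈
            :+ con (+ 45) :* (Q :* R₆))) :+ (con (+ 36) :* (e :* e) :+ con (-[1+ 1003 ]) :* Q) :* (R₈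
            :+ :- (con (+ 8) :* (e :* R₆) :+ con (+ 9) :* (Q :* Q))) :+ (con (+ 288) :* (e :* e :* e)
            :+ con (-[1+ 6411 ]) :* (e :* Q) :+ con (+ 14836) :* (R₆ :+ e :* Q)) :* (R₆ :+ :- (e :* Q)))
            refl e Q R₆ R₈ R₁₀ R₁₂)
        (drop h₆ (drop h₈ (drop h₁₀ (drop h₁₂ ≈-refl))))

      -- The left side is the logarithmic derivative of Q² U; the right side is E₂, the logarithmic
      -- derivative of Δ.
      weight-2-identity : (P + - e) + (P + - e) + P ≈ ⟨ + 1 ⟩ + ⟨ -[1+ 23 ] ⟩ * S
      weight-2-identity = solve! 2 (λ S t₁ → let e = con (+ 1) :+ con (+ 12) :* (S :+ :- t₁); P = con (+ 1) :+ con (-[1+ 7 ]) :* t₁ in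
        (P :+ :- e) :+ (P :+ :- e) :+ P := con (+ 1) :+ con (-[1+ 23 ]) :* S) refl S t₁

      -- `coeff` models a coefficient of positive index: it is linear and kills the constants.
      module Coefficient (coeff : A → ℤ) (coeff-cong : ∀ {x y} → x ≈ y → coeff x ≡ coeff y)
        (coeff-+ : ∀ x y → coeff (x + y) ≡ coeff x ℤ.+ coeff y) (coeff-⟨⟩ : ∀ c → coeff ⟨ c ⟩ ≡ 0ℤ)
        (coeff-* : ∀ c x → coeff (⟨ c ⟩ * x) ≡ coeff x ℤ.* c) where

        private
          infixr 6 _⊹_
          _⊹_ : ∀ {x y i j} → coeff x ≡ i → coeff y ≡ j → coeff (x + y) ≡ i ℤ.+ j
          p ⊹ q = ≡.trans (coeff-+ _ _) (≡.cong₂ ℤ._+_ p q)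

          infixr 7 _·_
          _·_ : ∀ c {x i} → coeff x ≡ i → coeff (⟨ c ⟩ * x) ≡ i ℤ.* c
          c · p = ≡.trans (coeff-* c _) (≡.cong (ℤ._* c) p)

        -- Expanding Q R₈ - 8 R₆² gives 9 + 272 t₃ + 128 t₅ + 32 t₇ + 512 (t₃ t₇ - t₅ t₅). After
        -- doubling and cancelling 32, the linear terms keep 17, 8 and 2, the products keep 32, and
        -- 2 · 4662 · 64 / 32 = 18648 stays with t.
        weight-12-coefficient : ∀ {t} → R₆ ≈ e * Q → R₈ ≈ ⟨ + 8 ⟩ * (e * R₆) + ⟨ + 9 ⟩ * (Q * Q) → ⟨ + 2 ⟩ * R₁₀
          ≈ e * R₈ + ⟨ + 45 ⟩ * (Q * R₆) →
          R₁₂ ≈ ⟨ + 4 ⟩ * (e * R₁₀) + ⟨ + 21 ⟩ * (Q * R₈) + ⟨ + 210 ⟩ * (R₆ * R₆) →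
          coeff (Q * Q * U) ≡ t ℤ.* + 64 → coeff (Q * U * U) ≡ 0ℤ →
          coeff t₁₁ ℤ.* + 9
            ≡ (coeff t₃ ℤ.* + 17 ℤ.+ coeff t₅ ℤ.* + 8 ℤ.+ coeff t₇ ℤ.* + 2 ℤ.+ (coeff (t₃ * t₇) ℤ.- coeff (t₅ * t₅)) ℤ.* + 32) ℤ.* + 691
            ℤ.+ t ℤ.* + 18648
        weight-12-coefficient {t} h₆ h₈ h₁₀ h₁₂ QQU QUU = ℤₚ.*-cancelʳ-≡ _ _ (+ 32) (≡.trans
          (Z.solve! 1 (λ a →
            (a Z.:* Z.con (+ 9)) Z.:* Z.con (+ 32) Z.:= (Z.con 0ℤ Z.:+ a Z.:* Z.con (+ 16)) Z.:* Z.con (+ 18)) ≡.refl (coeff t₁₁))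
          (≡.trans (≡.sym (+ 18 · (coeff-⟨⟩ (+ 691) ⊹ + 16 · ≡.refl)))
          (≡.trans (coeff-cong (weight-12-identity h₆ h₈ h₁₀ h₁₂))
          (≡.trans (coeff-cong (solve! 5 (λ t₃ t₅ t₇ X Y →
              con (+ 2) :* (con (+ 691) :* ((con (+ 1) :+ con (+ 16) :* t₃) :* (con (+ 17) :+ con (+ 32) :* t₇)
                :+ con -[1+ 7 ] :* ((con (+ 1) :+ con -[1+ 7 ] :* t₅) :* (con (+ 1) :+ con -[1+ 7 ] :* t₅)))
                :+ con (+ 4662) :* X :+ con (+ 144) :* Y)
              := con (+ 2) :* (con (+ 691) :* (con (+ 9) :+ (con (+ 272) :* t₃ :+ (con (+ 128) :* t₅
                :+ (con (+ 32) :* t₇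
                :+ (con (+ 512) :* (t₃ :* t₇) :+ con -[1+ 511 ] :* (t₅ :* t₅))))))
                :+ (con (+ 4662) :* X :+ con (+ 144) :* Y))) refl t₃ t₅ t₇ (Q * Q * U) (Q * U * U)))
          (≡.trans (+ 2 · (+ 691 · (coeff-⟨⟩ (+ 9) ⊹ + 272 · ≡.refl ⊹ + 128 · ≡.refl ⊹ + 32 · ≡.refl ⊹ + 512 · ≡.refl ⊹ -[1+ 511 ] · ≡.refl)
            ⊹ + 4662 · QQU ⊹ + 144 · QUU))
          (Z.solve! 6 (λ a b c d f t →
              ((Z.con 0ℤ Z.:+ (a Z.:* Z.con (+ 272) Z.:+ (b Z.:* Z.con (+ 128) Z.:+ (c Z.:* Z.con (+ 32)
                Z.:+ (d Z.:* Z.con (+ 512) Z.:+ f Z.:* Z.con -[1+ 511 ]))))) Z.:* Z.con (+ 691)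
                Z.:+ (t Z.:* Z.con (+ 64) Z.:* Z.con (+ 4662) Z.:+ Z.con 0ℤ Z.:* Z.con (+ 144))) Z.:* Z.con (+ 2)
              Z.:= ((a Z.:* Z.con (+ 17) Z.:+ b Z.:* Z.con (+ 8) Z.:+ c Z.:* Z.con (+ 2)
                Z.:+ (d Z.:- f) Z.:* Z.con (+ 32)) Z.:* Z.con (+ 691) Z.:+ t Z.:* Z.con (+ 18648)) Z.:* Z.con (+ 32)) ≡.refl
            (coeff t₃) (coeff t₅) (coeff t₇) (coeff (t₃ * t₇)) (coeff (t₅ * t₅)) t))))))
          where module Z = ℤ-Solver

open import Data.Integer using (+_; _+_; _*_; _-_)
open import Data.Nat using (ℕ; suc; _∸_) renaming (_*_ to _*ℕ_; _^_ to _^ℕ_)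
open import Data.Nat.Divisibility using (_∣_)
open import Data.Fin using (toℕ)
open import Data.Rational using (_/_) renaming (_*_ to _*ℚ_; _-_ to _-ℚ_)
open import Relation.Binary.PropositionalEquality using (_≡_)
open import Relation.Nullary using (¬_)
open import Defs

open import Algebra.Construct.Pointwise using (isAbelianGroup)
open import Data.Empty using (⊥-elim)
open import Data.Fin.Properties using (toℕ≤pred[n])
open import Data.Integer using (-_; _^_)
open import Data.Integer.Properties
open import Data.List using (List; []; _∷_; map; filter; applyUpTo)
open import Data.List.Properties using (map-upTo; filter-accept; filter-reject)
open import Data.Nat as ℕ using (zero; _≤_; _<_; z≤n; s≤s)
open import Data.Nat.Divisibility using (divides; _∣?_; _∣0; ∣-refl; ∣m⇒∣m*n; ∣m∣n⇒∣m+n)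
open import Data.Nat.Induction using (<-rec)
import Data.Nat.Properties as ℕₚ
import Data.Nat.Solver as ℕSolver
open import Data.Rational using (toℚᵘ) renaming (-_ to -ℚ_)
import Data.Rational.Properties as ℚₚ
import Data.Rational.Unnormalised as ℚᵘ
open import Data.Rational.Unnormalised using (mkℚᵘ; *≡*) renaming (_≃_ to _≃ᵘ_)
import Data.Rational.Unnormalised.Properties as ℚᵘₚ
open import Data.Sum using (_⊎_; inj₁; inj₂; [_,_]′)
open import Data.Unit using (⊤; tt)
open import Function using (_∘_)
open import Relation.Binary.PropositionalEquality using (_≢_; sym; trans; cong; cong₂; subst; module ≡-Reasoning)
open import Relation.Nullary using (yes; no)
open import Algebra.Properties.Semiring.Sum +-*-semiring using (sum-syntax; sum-cong-≗; ∑-distrib-+; *-distribˡ-sum; sum-replicate-zero)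
open ℤ-Solver using (solve!; _:=_; _:+_; _:*_; _:-_; :-_; _:^_; con)

-- The ring of formal power series

infix 4 _≈_
infixl 6 _⊕_
infix 8 ⊝_

_≈_ : Series → Series → Set
f ≈ g = ∀ n → f n ≡ g n

0ₛ : Series
0ₛ _ = 0ℤ

_⊕_ : Series → Series → Series
(f ⊕ g) n = f n + g n

⊝_ : Series → Series
(⊝ f) n = - f n

constₛ : ℤ → Series
constₛ c zero    = c
constₛ c (suc _) = 0ℤ

tail : Series → Series
tail f n = f (suc n)

scale : ℤ → Series → Series
scale c f n = c * f n

1ₛ≈const : 1ₛ ≈ constₛ 1ℤ
1ₛ≈const zero    = refl
1ₛ≈const (suc _) = refl

⊛-cong : ∀ {f f′ g g′} → f ≈ f′ → g ≈ g′ → f ⊛ g ≈ f′ ⊛ g′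
⊛-cong p q n = sum-cong-≗ {suc n} λ i → cong₂ _*_ (p (toℕ i)) (q (n ∸ toℕ i))

⊛-zeroˡ : ∀ f → 0ₛ ⊛ f ≈ 0ₛ
⊛-zeroˡ f zero    = +-identityʳ _
⊛-zeroˡ f (suc n) = trans (+-identityˡ _) (⊛-zeroˡ f n)

const-⊛ : ∀ c f → constₛ c ⊛ f ≈ scale c f
const-⊛ c f zero    = +-identityʳ _
const-⊛ c f (suc n) = trans (cong (_+_ (c * f (suc n))) (⊛-zeroˡ f n)) (+-identityʳ _)

⊛-distribʳ : ∀ h f g → (f ⊕ g) ⊛ h ≈ f ⊛ h ⊕ g ⊛ h
⊛-distribʳ h f g n = trans
  (sum-cong-≗ {suc n} λ i → *-distribʳ-+ (h (n ∸ toℕ i)) (f (toℕ i)) (g (toℕ i)))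
  (∑-distrib-+ {suc n} (λ i → f (toℕ i) * h (n ∸ toℕ i)) (λ i → g (toℕ i) * h (n ∸ toℕ i)))

⊛-suc : ∀ f g n → (f ⊛ g) (suc n) ≡ (f ⊛ tail g) n + f (suc n) * g 0
⊛-suc f g zero    = solve! 4 (λ a b c d → a :* b :+ (c :* d :+ con 0ℤ) := a :* b :+ con 0ℤ :+ c :* d)
                      refl (f 0) (g 1) (f 1) (g 0)
⊛-suc f g (suc n) = begin
  f 0 * g (2 ℕ.+ n)
    + (tail f ⊛ g) (suc n)                            ≡⟨ cong (_+_ (f 0 * g (2 ℕ.+ n))) (⊛-suc (tail f) g n) ⟩
  f 0 * g (2 ℕ.+ n) + ((tail f ⊛ tail g) n + f (2 ℕ.+ n) * g 0)       ≡⟨ +-assoc (f 0 * g (2 ℕ.+ n)) _ _ ⟨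
  f 0 * g (2 ℕ.+ n) + (tail f ⊛ tail g) n + f (2 ℕ.+ n) * g 0         ∎
  where open ≡-Reasoning

⊛-comm : ∀ f g → f ⊛ g ≈ g ⊛ f
⊛-comm f g zero    = cong (_+ 0ℤ) (*-comm (f 0) (g 0))
⊛-comm f g (suc n) = begin
  f 0 * g (suc n) + (tail f ⊛ g) n  ≡⟨ cong₂ _+_ (*-comm (f 0) _) (⊛-comm (tail f) g n) ⟩
  g (suc n) * f 0 + (g ⊛ tail f) n  ≡⟨ +-comm (g (suc n) * f 0) _ ⟩
  (g ⊛ tail f) n + g (suc n) * f 0  ≡⟨ ⊛-suc g f n ⟨
  (g ⊛ f) (suc n)                   ∎
  where open ≡-Reasoning

⊛-distribˡ : ∀ h f g → h ⊛ (f ⊕ g) ≈ h ⊛ f ⊕ h ⊛ g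
⊛-distribˡ h f g n = begin
  (h ⊛ (f ⊕ g)) n        ≡⟨ ⊛-comm h (f ⊕ g) n ⟩
  ((f ⊕ g) ⊛ h) n        ≡⟨ ⊛-distribʳ h f g n ⟩
  (f ⊛ h) n + (g ⊛ h) n  ≡⟨ cong₂ _+_ (⊛-comm f h n) (⊛-comm g h n) ⟩
  (h ⊛ f) n + (h ⊛ g) n  ∎
  where open ≡-Reasoning

scale-⊛ : ∀ c f g → scale c f ⊛ g ≈ scale c (f ⊛ g)
scale-⊛ c f g n = trans
  (sum-cong-≗ {suc n} λ i → *-assoc c (f (toℕ i)) (g (n ∸ toℕ i)))
  (sym (*-distribˡ-sum {suc n} c λ i → f (toℕ i) * g (n ∸ toℕ i)))

⊛-assoc : ∀ f g h → (f ⊛ g) ⊛ h ≈ f ⊛ (g ⊛ h)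
⊛-assoc f g h zero    = solve! 3 (λ a b c → (a :* b :+ con 0ℤ) :* c :+ con 0ℤ := a :* (b :* c :+ con 0ℤ) :+ con 0ℤ)
                          refl (f 0) (g 0) (h 0)
⊛-assoc f g h (suc n) = begin
  (f 0 * g 0 + 0ℤ) * h (suc n) + (tail (f ⊛ g) ⊛ h) n
    -- By definition, `tail (f ⊛ g)` is `scale (f 0) (tail g) ⊕ tail f ⊛ g`; the induction then
    -- applies to `tail f`.
    ≡⟨ cong (_+_ ((f 0 * g 0 + 0ℤ) * h (suc n))) (⊛-distribʳ h (scale (f 0) (tail g)) (tail f ⊛ g) n) ⟩
  (f 0 * g 0 + 0ℤ) * h (suc n) + ((scale (f 0) (tail g) ⊛ h) n + ((tail f ⊛ g) ⊛ h) n)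
    ≡⟨ cong (_+_ ((f 0 * g 0 + 0ℤ) * h (suc n))) (cong₂ _+_ (scale-⊛ (f 0) (tail g) h n) (⊛-assoc (tail f) g h n)) ⟩
  (f 0 * g 0 + 0ℤ) * h (suc n) + (f 0 * (tail g ⊛ h) n + (tail f ⊛ (g ⊛ h)) n)
    ≡⟨ solve! 5 (λ a b c d e → (a :* b :+ con 0ℤ) :* c :+ (a :* d :+ e) := a :* (b :* c :+ d) :+ e)
         refl (f 0) (g 0) (h (suc n)) ((tail g ⊛ h) n) ((tail f ⊛ (g ⊛ h)) n) ⟩
  f 0 * (g 0 * h (suc n) + (tail g ⊛ h) n) + (tail f ⊛ (g ⊛ h)) n
    ∎
  where open ≡-Reasoning

Series-commutativeRing : CommutativeRing 0ℓ 0ℓ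
Series-commutativeRing = record
  { Carrier = Series
  ; _≈_ = _≈_
  ; _+_ = _⊕_
  ; _*_ = _⊛_
  ; -_  = ⊝_
  ; 0#  = 0ₛ
  ; 1#  = 1ₛ
  ; isCommutativeRing = record
    { isRing = record
      { +-isAbelianGroup = isAbelianGroup ℕ +-0-isAbelianGroup
      ; *-cong           = λ {f} {f′} {g} {g′} → ⊛-cong {f} {f′} {g} {g′}
      ; *-assoc          = ⊛-assoc
      ; *-identity       = (λ f n → trans (⊛-comm 1ₛ f n) (⊛-identityʳ f n)) , ⊛-identityʳ
      ; distrib          = ⊛-distribˡ , ⊛-distribʳ
      }
    ; *-comm = ⊛-comm
    }
  }

const-homomorphism : CommutativeRing.rawRing +-*-commutativeRing
                     -Raw-AlmostCommutative⟶ fromCommutativeRing Series-commutativeRing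
const-homomorphism = record
  { ⟦_⟧    = constₛ
  ; +-homo = λ { _ _ zero → refl ; _ _ (suc _) → refl }
  ; *-homo = λ { a b zero → sym (const-⊛ a (constₛ b) 0)
               ; a b (suc n) → sym (trans (const-⊛ a (constₛ b) (suc n)) (*-zeroʳ a)) }
  ; -‿homo = λ { _ zero → refl ; _ (suc _) → refl }
  ; 0-homo = λ { zero → refl ; (suc _) → refl }
  ; 1-homo = λ { zero → refl ; (suc _) → refl }
  }

module Series-Solver = SyntacticSolver Series-commutativeRing const-homomorphism

-- Finite sums over 1 ≤ a ≤ N

Σ₁ : ℕ → (ℕ → ℤ) → ℤ
Σ₁ zero    f = 0ℤ
Σ₁ (suc N) f = f 1 + Σ₁ N (f ∘ suc)

Σ₁-cong-≤ : ∀ N {f g : ℕ → ℤ} → (∀ a → a < N → f (suc a) ≡ g (suc a)) → Σ₁ N f ≡ Σ₁ N g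
Σ₁-cong-≤ zero    eq = refl
Σ₁-cong-≤ (suc N) eq = cong₂ _+_ (eq 0 (s≤s z≤n)) (Σ₁-cong-≤ N λ a a<N → eq (suc a) (s≤s a<N))

Σ₁-cong : ∀ N {f g : ℕ → ℤ} → (∀ a → f (suc a) ≡ g (suc a)) → Σ₁ N f ≡ Σ₁ N g
Σ₁-cong N eq = Σ₁-cong-≤ N λ a _ → eq a

Σ₁-+ : ∀ N f g → Σ₁ N (λ a → f a + g a) ≡ Σ₁ N f + Σ₁ N g
Σ₁-+ zero    f g = refl
Σ₁-+ (suc N) f g = trans (cong (_+_ (f 1 + g 1)) (Σ₁-+ N (f ∘ suc) (g ∘ suc)))
  (solve! 4 (λ a b c d → a :+ b :+ (c :+ d) := a :+ c :+ (b :+ d)) refl (f 1) (g 1) _ _)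

Σ₁-* : ∀ N c f → Σ₁ N (λ a → c * f a) ≡ c * Σ₁ N f
Σ₁-* zero    c f = sym (*-zeroʳ c)
Σ₁-* (suc N) c f = trans (cong (_+_ (c * f 1)) (Σ₁-* N c (f ∘ suc))) (sym (*-distribˡ-+ c (f 1) _))

Σ₁-zero : ∀ N {f} → (∀ a → f (suc a) ≡ 0ℤ) → Σ₁ N f ≡ 0ℤ
Σ₁-zero zero    eq = refl
Σ₁-zero (suc N) eq = cong₂ _+_ (eq 0) (Σ₁-zero N (eq ∘ suc))

Σ₁-swap : ∀ M N (f : ℕ → ℕ → ℤ) → Σ₁ M (λ a → Σ₁ N (f a)) ≡ Σ₁ N (λ b → Σ₁ M (λ a → f a b))
Σ₁-swap zero    N f = sym (Σ₁-zero N λ _ → refl)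
Σ₁-swap (suc M) N f = trans (cong (_+_ (Σ₁ N (f 1))) (Σ₁-swap M N (f ∘ suc)))
  (sym (Σ₁-+ N (f 1) λ b → Σ₁ M (λ a → f (suc a) b)))

Σ₁-split : ∀ M N f → Σ₁ (M ℕ.+ N) f ≡ Σ₁ M f + Σ₁ N (λ a → f (M ℕ.+ a))
Σ₁-split zero    N f = sym (+-identityˡ _)
Σ₁-split (suc M) N f = trans (cong (_+_ (f 1)) (Σ₁-split M N (f ∘ suc))) (sym (+-assoc (f 1) _ _))

Σ₁-last : ∀ N f → Σ₁ (suc N) f ≡ Σ₁ N f + f (suc N)
Σ₁-last zero    f = +-comm (f 1) 0ℤ
Σ₁-last (suc N) f = trans (cong (_+_ (f 1)) (Σ₁-last N (f ∘ suc))) (sym (+-assoc (f 1) _ _))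

Σ₁-truncate : ∀ {M N} f → M ≤ N → (∀ a → M < a → f a ≡ 0ℤ) → Σ₁ N f ≡ Σ₁ M f
Σ₁-truncate {M} f M≤N f≡0 with ℕₚ.m≤n⇒∃[o]m+o≡n M≤N
... | k , refl = begin
  Σ₁ (M ℕ.+ k) f                        ≡⟨ Σ₁-split M k f ⟩
  Σ₁ M f + Σ₁ k (λ a → f (M ℕ.+ a))     ≡⟨ cong (_+_ (Σ₁ M f)) (Σ₁-zero k λ a
    → f≡0 (M ℕ.+ suc a) (ℕₚ.m<m+n M (s≤s z≤n))) ⟩
  Σ₁ M f + 0ℤ                           ≡⟨ +-identityʳ _ ⟩
  Σ₁ M f                                ∎
  where open ≡-Reasoning

Σ₁-reverse : ∀ N f → Σ₁ N (λ a → f (suc N ∸ a)) ≡ Σ₁ N f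
Σ₁-reverse zero    f = refl
Σ₁-reverse (suc N) f = begin
  f (suc N) + Σ₁ N (λ a → f (suc N ∸ a))  ≡⟨ cong (_+_ (f (suc N))) (Σ₁-reverse N f) ⟩
  f (suc N) + Σ₁ N f                      ≡⟨ +-comm (f (suc N)) _ ⟩
  Σ₁ N f + f (suc N)                      ≡⟨ Σ₁-last N f ⟨
  Σ₁ (suc N) f                            ∎
  where open ≡-Reasoning

-- A pair a < d is given by a and the gap c = d - a.
Σ₁-triangle : ∀ N (F : ℕ → ℕ → ℤ) →
  Σ₁ N (λ d → Σ₁ (d ∸ 1) (λ a → F a d)) ≡ Σ₁ N (λ a → Σ₁ (N ∸ a) (λ c → F a (a ℕ.+ c)))
Σ₁-triangle zero    F = refl
Σ₁-triangle (suc N) F = begin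
  0ℤ + Σ₁ N (λ d → Σ₁ d (λ a → F a (suc d)))
    ≡⟨ trans (+-identityˡ _) (Σ₁-cong N λ _ → refl) ⟩
  Σ₁ N (λ d → F 1 (suc d) + Σ₁ (d ∸ 1) (λ a → F (suc a) (suc d)))
    ≡⟨ Σ₁-+ N (λ d → F 1 (suc d)) _ ⟩
  Σ₁ N (λ d → F 1 (suc d)) + Σ₁ N (λ d → Σ₁ (d ∸ 1) (λ a → F (suc a) (suc d)))
    ≡⟨ cong (_+_ (Σ₁ N (λ d → F 1 (suc d)))) (Σ₁-triangle N λ a d → F (suc a) (suc d)) ⟩
  Σ₁ N (λ c → F 1 (suc c)) + Σ₁ N (λ a → Σ₁ (N ∸ a) (λ c → F (suc a) (suc a ℕ.+ c)))
    ∎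
  where open ≡-Reasoning

Σ₁-square : ∀ N (F : ℕ → ℕ → ℤ) → (∀ a b → F a b ≡ F b a) →
  Σ₁ N (λ a → Σ₁ N (F a)) ≡ + 2 * Σ₁ N (λ d → Σ₁ (d ∸ 1) (λ a → F a d)) + Σ₁ N (λ a → F a a)
Σ₁-square zero    F F-sym = refl
Σ₁-square (suc N) F F-sym = begin
  Σ₁ (suc N) (λ a → Σ₁ (suc N) (F a))
    ≡⟨ Σ₁-last N (λ a → Σ₁ (suc N) (F a)) ⟩
  Σ₁ N (λ a → Σ₁ (suc N) (F a)) + Σ₁ (suc N) (F (suc N))
    ≡⟨ cong₂ _+_ (trans (Σ₁-cong N λ a → Σ₁-last N (F (suc a))) (Σ₁-+ N (λ a → Σ₁ N (F a)) (λ a → F a (suc N))))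
                 (trans (Σ₁-last N (F (suc N))) (cong (_+ F (suc N) (suc N)) (Σ₁-cong N λ a
                   → F-sym (suc N) (suc a)))) ⟩
  Σ₁ N (λ a → Σ₁ N (F a)) + E + (E + F (suc N) (suc N))
    ≡⟨ cong (λ z → z + E + (E + F (suc N) (suc N))) (Σ₁-square N F F-sym) ⟩
  + 2 * T + Δ + E + (E + F (suc N) (suc N))
    ≡⟨ solve! 4 (λ t d e f → con (+ 2) :* t :+ d :+ e :+ (e :+ f) := con (+ 2) :* (t :+ e) :+ (d :+ f))
      refl T Δ E (F (suc N) (suc N)) ⟩
  + 2 * (T + E) + (Δ + F (suc N) (suc N))
    ≡⟨ cong₂ (λ x y → + 2 * x + y) (Σ₁-last N (λ d → Σ₁ (d ∸ 1) (λ a → F a d))) (Σ₁-last N (λ a → F a a)) ⟨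
  + 2 * Σ₁ (suc N) (λ d → Σ₁ (d ∸ 1) (λ a → F a d)) + Σ₁ (suc N) (λ a → F a a)
    ∎
  where
  open ≡-Reasoning
  E = Σ₁ N (λ a → F a (suc N))
  T = Σ₁ N (λ d → Σ₁ (d ∸ 1) (λ a → F a d))
  Δ = Σ₁ N (λ a → F a a)

Σ₁-triangle-≤ : ∀ N (F : ℕ → ℕ → ℤ) → (∀ a b → N < b → F a b ≡ 0ℤ) →
  Σ₁ N (λ d → Σ₁ (d ∸ 1) (λ a → F a d)) ≡ Σ₁ N (λ a → Σ₁ N (λ c → F a (a ℕ.+ c)))
Σ₁-triangle-≤ N F F≡0 = trans (Σ₁-triangle N F) (Σ₁-cong N λ a → sym
  (Σ₁-truncate (λ c → F (suc a) (suc a ℕ.+ c)) (ℕₚ.m∸n≤m N (suc a))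
    λ c N∸a<c → F≡0 (suc a) (suc a ℕ.+ c) (ℕₚ.≤-<-trans (ℕₚ.m≤n+m∸n N (suc a)) (ℕₚ.+-monoʳ-< (suc a) N∸a<c))))

-- The two triangles beside the diagonal have equal sums. In the gap parametrisation the gap may run
-- up to N, since `F` vanishes outside the square.
Σ₁-symmetric : ∀ N (F : ℕ → ℕ → ℤ) → (∀ a b → F a b ≡ F b a) → (∀ a b → N < b → F a b ≡ 0ℤ) →
  Σ₁ N (λ a → Σ₁ N (F a)) ≡ + 2 * Σ₁ N (λ a → Σ₁ N (λ c → F a (a ℕ.+ c))) + Σ₁ N (λ a → F a a)
Σ₁-symmetric N F F-sym F≡0 = trans (Σ₁-square N F F-sym)
  (cong (λ z → + 2 * z + Σ₁ N (λ a → F a a)) (Σ₁-triangle-≤ N F F≡0))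

Σ₁-antidiagonal : ∀ N (φ : ℕ → ℕ → ℤ) → (∀ a c → N < a ℕ.+ c → φ a c ≡ 0ℤ) →
  Σ₁ N (λ a → Σ₁ N (φ a)) ≡ Σ₁ N (λ d → Σ₁ (d ∸ 1) (λ a → φ a (d ∸ a)))
Σ₁-antidiagonal N φ φ≡0 = sym (trans
  (Σ₁-triangle-≤ N (λ a d → φ a (d ∸ a)) λ a d N<d → φ≡0 a (d ∸ a) (ℕₚ.<-≤-trans N<d (ℕₚ.m≤n+m∸n d a)))
  (Σ₁-cong N λ a → Σ₁-cong N λ c → cong (φ (suc a)) (ℕₚ.m+n∸m≡n (suc a) (suc c))))

-- Sums over factorisations of n and over solutions of a x + b y = n

q^-diagonal : ∀ n → (q^ n) n ≡ 1ℤ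
q^-diagonal zero    = refl
q^-diagonal (suc n) = q^-diagonal n

q^-≢ : ∀ m n → m ≢ n → (q^ m) n ≡ 0ℤ
q^-≢ zero    zero    0≢0 = ⊥-elim (0≢0 refl)
q^-≢ zero    (suc n) _   = refl
q^-≢ (suc m) zero    _   = refl
q^-≢ (suc m) (suc n) m≢n = q^-≢ m n (m≢n ∘ cong suc)

q^-> : ∀ {m n} → n < m → (q^ m) n ≡ 0ℤ
q^-> {m} {n} n<m = q^-≢ m n (ℕₚ.>⇒≢ n<m)

1ₛ-⊛ : ∀ f → 1ₛ ⊛ f ≈ f
1ₛ-⊛ f n = trans (⊛-comm 1ₛ f n) (⊛-identityʳ f n)

q^-⊛ : ∀ i j → q^ i ⊛ q^ j ≈ q^ (i ℕ.+ j)
q^-⊛ zero    j n       = 1ₛ-⊛ (q^ j) n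
q^-⊛ (suc i) j zero    = trans (+-identityʳ _) (*-zeroˡ ((q^ j) 0))
q^-⊛ (suc i) j (suc n) = trans (cong₂ _+_ (*-zeroˡ ((q^ j) (suc n))) (q^-⊛ i j n)) (+-identityˡ _)

-- The factor `(q^ m) n` serves as the indicator of m = n, so this sum runs over the factorisations
-- n = d x, and `quad-sum` over the positive solutions of a x + b y = n. With fixed rectangular
-- ranges all reorderings become plain exchanges of sums. The cofactor x is an argument of `φ`
-- because it appears in Liouville's identity.
div-sum : (ℕ → ℕ → ℤ) → Series
div-sum φ n = Σ₁ n λ d → Σ₁ n λ x → φ d x * (q^ (d ℕ.* x)) n

𝒟 : (ℕ → ℤ) → Series
𝒟 p = div-sum λ d _ → p d

quad-sum : (ℕ → ℕ → ℤ) → Series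
quad-sum h n = Σ₁ n λ a → Σ₁ n λ b → Σ₁ n λ x → Σ₁ n λ y → h a b * (q^ (a ℕ.* x ℕ.+ b ℕ.* y)) n

Σ₁-pick : ∀ N f x₀ → x₀ < N → (∀ x → x ≢ x₀ → f (suc x) ≡ 0ℤ) → Σ₁ N f ≡ f (suc x₀)
Σ₁-pick (suc N) f zero     _         f≡0 =
  trans (cong (_+_ (f 1)) (Σ₁-zero N λ x → f≡0 (suc x) λ ())) (+-identityʳ _)
Σ₁-pick (suc N) f (suc x₀) (s≤s x₀<N) f≡0 =
  trans (cong₂ _+_ (f≡0 0 λ ()) (Σ₁-pick N (f ∘ suc) x₀ x₀<N λ x x≢x₀
    → f≡0 (suc x) (x≢x₀ ∘ ℕₚ.suc-injective))) (+-identityˡ _)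

divisor-indicator : ∀ n d c → suc d ∣ suc n → Σ₁ (suc n) (λ x → c * (q^ (suc d ℕ.* x)) (suc n)) ≡ c
divisor-indicator n d c (divides (suc x₀) 1+n≡x₀*d) = begin
  Σ₁ (suc n) (λ x → c * (q^ (suc d ℕ.* x)) (suc n))
    ≡⟨ Σ₁-pick (suc n) (λ x → c * (q^ (suc d ℕ.* x)) (suc n)) x₀ x₀<1+n (λ x x≢x₀ → trans
      (cong (c *_) (q^-≢ (suc d ℕ.* suc x) (suc n)
         λ eq → x≢x₀ (ℕₚ.suc-injective (ℕₚ.*-cancelˡ-≡ (suc x) (suc x₀) (suc d) (trans eq n≡d*x₀))))) (*-zeroʳ c)) ⟩
  c * (q^ (suc d ℕ.* suc x₀)) (suc n)
    ≡⟨ cong (λ m → c * (q^ m) (suc n)) n≡d*x₀ ⟨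
  c * (q^ suc n) (suc n)
    ≡⟨ trans (cong (c *_) (q^-diagonal (suc n))) (*-identityʳ c) ⟩
  c ∎
  where
  open ≡-Reasoning
  n≡d*x₀ : suc n ≡ suc d ℕ.* suc x₀
  n≡d*x₀ = trans 1+n≡x₀*d (ℕₚ.*-comm (suc x₀) (suc d))
  x₀<1+n : x₀ < suc n
  x₀<1+n = subst (x₀ <_) (sym 1+n≡x₀*d) (ℕₚ.m≤m*n (suc x₀) (suc d))

nondivisor-indicator : ∀ n d c → ¬ (d ∣ n) → Σ₁ n (λ x → c * (q^ (d ℕ.* x)) n) ≡ 0ℤ
nondivisor-indicator n d c d∤n = Σ₁-zero n λ x → trans
  (cong (c *_) (q^-≢ (d ℕ.* suc x) n λ eq → d∤n (divides (suc x) (trans (sym eq) (ℕₚ.*-comm d (suc x))))))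
  (*-zeroʳ c)

sum-divisors : ∀ p n → sumℤ (map p (divisors n)) ≡ 𝒟 p n
sum-divisors p zero    = refl
sum-divisors p (suc n) = begin
  sumℤ (map p (divisors (suc n)))  ≡⟨ cong (sumℤ ∘ map p ∘ filter (_∣? suc n)) (map-upTo suc (suc n)) ⟩
  sumℤ (map p (filter (_∣? suc n) (applyUpTo suc (suc n))))  ≡⟨ go (suc n) (λ i → i) ⟩
  Σ₁ (suc n) (λ a → indicator (suc (a ∸ 1)))  ≡⟨ Σ₁-cong (suc n) {λ a → indicator (suc (a ∸ 1))} {indicator} (λ _ → refl) ⟩
  𝒟 p (suc n)  ∎
  where
  open ≡-Reasoning
  indicator : ℕ → ℤ
  indicator d = Σ₁ (suc n) λ x → p d * (q^ (d ℕ.* x)) (suc n)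
  -- The index function `g` is general because each step of `applyUpTo` replaces it by `g ∘ suc`.
  go : ∀ k (g : ℕ → ℕ) → sumℤ (map p (filter (_∣? suc n) (applyUpTo (λ i → suc (g i)) k)))
                         ≡ Σ₁ k (λ a → indicator (suc (g (a ∸ 1))))
  go zero    g = refl
  go (suc k) g with suc (g 0) ∣? suc n
  ... | yes d∣n = begin
    sumℤ (map p (filter (_∣? suc n) (suc (g 0) ∷ ds)))
      ≡⟨ cong (sumℤ ∘ map p) (filter-accept (_∣? suc n) {xs = ds} d∣n) ⟩
    p (suc (g 0)) + sumℤ (map p (filter (_∣? suc n) ds))
      ≡⟨ cong₂ _+_ (sym (divisor-indicator n (g 0) (p (suc (g 0))) d∣n)) rest ⟩
    indicator (suc (g 0)) + Σ₁ k (λ a → indicator (suc (g a)))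
      ∎
    where
    ds = applyUpTo (λ i → suc (g (suc i))) k
    rest = trans (go k (g ∘ suc)) (Σ₁-cong k {g = λ a → indicator (suc (g a))} λ _ → refl)
  ... | no d∤n = begin
    sumℤ (map p (filter (_∣? suc n) (suc (g 0) ∷ ds)))
      ≡⟨ cong (sumℤ ∘ map p) (filter-reject (_∣? suc n) {xs = ds} d∤n) ⟩
    sumℤ (map p (filter (_∣? suc n) ds))
      ≡⟨ +-identityˡ _ ⟨
    0ℤ + sumℤ (map p (filter (_∣? suc n) ds))
      ≡⟨ cong₂ _+_ (sym (nondivisor-indicator (suc n) (suc (g 0)) (p (suc (g 0))) d∤n)) rest ⟩
    indicator (suc (g 0)) + Σ₁ k (λ a → indicator (suc (g a)))
      ∎
    where
    ds = applyUpTo (λ i → suc (g (suc i))) k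
    rest = trans (go k (g ∘ suc)) (Σ₁-cong k {g = λ a → indicator (suc (g a))} λ _ → refl)

-- Divisors and cofactors of n do not exceed n. A common range makes all coefficients up to N
-- coefficients of one finite sum of monomials.
div-sum-bound : ∀ φ {n N} → n ≤ N → div-sum φ n ≡ Σ₁ N λ d → Σ₁ N λ x → φ d x * (q^ (d ℕ.* x)) n
div-sum-bound φ {n} {N} n≤N = begin
  Σ₁ n (λ d → Σ₁ n (λ x → φ d x * (q^ (d ℕ.* x)) n))
    ≡⟨ Σ₁-truncate (λ d → Σ₁ n (λ x → φ d x * (q^ (d ℕ.* x)) n)) n≤N (λ d n<d → Σ₁-zero n λ x →
         vanish (φ d (suc x)) (ℕₚ.≤-trans n<d (ℕₚ.m≤m*n d (suc x)))) ⟨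
  Σ₁ N (λ d → Σ₁ n (λ x → φ d x * (q^ (d ℕ.* x)) n))
    ≡⟨ Σ₁-cong N (λ d → Σ₁-truncate (λ x → φ (suc d) x * (q^ (suc d ℕ.* x)) n) n≤N λ x n<x →
         vanish (φ (suc d) x) (ℕₚ.≤-trans n<x (ℕₚ.m≤n*m x (suc d)))) ⟨
  Σ₁ N (λ d → Σ₁ N (λ x → φ d x * (q^ (d ℕ.* x)) n))
    ∎
  where
  open ≡-Reasoning
  vanish : ∀ c {m} → n < m → c * (q^ m) n ≡ 0ℤ
  vanish c n<m = trans (cong (c *_) (q^-> n<m)) (*-zeroʳ c)

Σ₁-⊛ : ∀ N (F : ℕ → Series) g n → ((λ m → Σ₁ N (λ a → F a m)) ⊛ g) n ≡ Σ₁ N (λ a → (F a ⊛ g) n)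
Σ₁-⊛ zero    F g n = ⊛-zeroˡ g n
Σ₁-⊛ (suc N) F g n = trans (⊛-distribʳ g (F 1) (λ m → Σ₁ N (λ a → F (suc a) m)) n)
  (cong (_+_ ((F 1 ⊛ g) n)) (Σ₁-⊛ N (F ∘ suc) g n))

⊛-Σ₁ : ∀ N (F : ℕ → Series) g n → (g ⊛ (λ m → Σ₁ N (λ a → F a m))) n ≡ Σ₁ N (λ a → (g ⊛ F a) n)
⊛-Σ₁ N F g n = trans (⊛-comm g (λ m → Σ₁ N (λ a → F a m)) n)
  (trans (Σ₁-⊛ N F g n) (Σ₁-cong N λ a → ⊛-comm (F (suc a)) g n))

⊛-scale : ∀ c f g → g ⊛ scale c f ≈ scale c (g ⊛ f)
⊛-scale c f g n = trans (⊛-comm g (scale c f) n) (trans (scale-⊛ c f g n) (cong (c *_) (⊛-comm f g n)))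

-- The coefficient of qⁿ depends only on coefficients up to n, so each factor may be replaced by a
-- finite sum of monomials and the product expanded termwise. The factors are commuted because
-- `⊛-cong-≤` changes the right one only.
quad-sum-⊛ : ∀ p r → 𝒟 p ⊛ 𝒟 r ≈ quad-sum (λ a b → p a * r b)
quad-sum-⊛ p r n = begin
  (𝒟 p ⊛ 𝒟 r) n
    ≡⟨ ⊛-cong-≤ (𝒟 p) n (λ i i≤n → div-sum-bound (λ d _ → r d) i≤n) ⟩
  (𝒟 p ⊛ R) n
    ≡⟨ ⊛-comm (𝒟 p) R n ⟩
  (R ⊛ 𝒟 p) n
    ≡⟨ ⊛-cong-≤ R n (λ i i≤n → div-sum-bound (λ d _ → p d) i≤n) ⟩
  (R ⊛ P) n
    ≡⟨ ⊛-comm R P n ⟩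
  (P ⊛ R) n
    ≡⟨ Σ₁-⊛ n (λ a m → Σ₁ n λ x → scale (p a) (q^ (a ℕ.* x)) m) R n ⟩
  Σ₁ n (λ a → ((λ m → Σ₁ n λ x → scale (p a) (q^ (a ℕ.* x)) m) ⊛ R) n)
    ≡⟨ Σ₁-cong n (λ a → Σ₁-⊛ n (λ x m → scale (p (suc a)) (q^ (suc a ℕ.* x)) m) R n) ⟩
  Σ₁ n (λ a → Σ₁ n λ x → (scale (p a) (q^ (a ℕ.* x)) ⊛ R) n)
    ≡⟨ Σ₁-cong n (λ a → Σ₁-cong n λ x → ⊛-Σ₁ n (λ b m → Σ₁ n λ y
      → scale (r b) (q^ (b ℕ.* y)) m) (scale (p (suc a)) (q^ (suc a ℕ.* suc x))) n) ⟩
  Σ₁ n (λ a → Σ₁ n λ x → Σ₁ n λ b → (scale (p a) (q^ (a ℕ.* x)) ⊛ (λ m → Σ₁ n λ y → scale (r b) (q^ (b ℕ.* y)) m)) n)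
    ≡⟨ Σ₁-cong n (λ a → Σ₁-cong n λ x → Σ₁-cong n λ b → trans
         (⊛-Σ₁ n (λ y m → scale (r (suc b)) (q^ (suc b ℕ.* y)) m) (scale (p (suc a)) (q^ (suc a ℕ.* suc x))) n)
         (Σ₁-cong n λ y → monomials (suc a) (suc x) (suc b) (suc y))) ⟩
  Σ₁ n (λ a → Σ₁ n λ x → Σ₁ n λ b → Σ₁ n λ y → p a * r b * (q^ (a ℕ.* x ℕ.+ b ℕ.* y)) n)
    ≡⟨ Σ₁-cong n (λ a → Σ₁-swap n n λ x b → Σ₁ n λ y → p (suc a) * r b * (q^ (suc a ℕ.* x ℕ.+ b ℕ.* y)) n) ⟩
  quad-sum (λ a b → p a * r b) n
    ∎
  where
  open ≡-Reasoning
  P R : Series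
  P m = Σ₁ n λ a → Σ₁ n λ x → scale (p a) (q^ (a ℕ.* x)) m
  R m = Σ₁ n λ b → Σ₁ n λ y → scale (r b) (q^ (b ℕ.* y)) m
  monomials : ∀ a x b y → (scale (p a) (q^ (a ℕ.* x)) ⊛ scale (r b) (q^ (b ℕ.* y))) n
                          ≡ p a * r b * (q^ (a ℕ.* x ℕ.+ b ℕ.* y)) n
  monomials a x b y = begin
    (scale (p a) (q^ (a ℕ.* x)) ⊛ scale (r b) (q^ (b ℕ.* y))) n
      ≡⟨ scale-⊛ (p a) (q^ (a ℕ.* x)) (scale (r b) (q^ (b ℕ.* y))) n ⟩
    p a * (q^ (a ℕ.* x) ⊛ scale (r b) (q^ (b ℕ.* y))) n
      ≡⟨ cong (p a *_) (⊛-scale (r b) (q^ (b ℕ.* y)) (q^ (a ℕ.* x)) n) ⟩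
    p a * (r b * (q^ (a ℕ.* x) ⊛ q^ (b ℕ.* y)) n)
      ≡⟨ *-assoc (p a) (r b) _ ⟨
    p a * r b * (q^ (a ℕ.* x) ⊛ q^ (b ℕ.* y)) n
      ≡⟨ cong (p a * r b *_) (q^-⊛ (a ℕ.* x) (b ℕ.* y) n) ⟩
    p a * r b * (q^ (a ℕ.* x ℕ.+ b ℕ.* y)) n
      ∎

-- Liouville's identity

Σ₁-const : ∀ N c → Σ₁ N (λ _ → c) ≡ + N * c
Σ₁-const zero    c = sym (*-zeroˡ c)
Σ₁-const (suc N) c = trans (cong (_+_ c) (Σ₁-const N c)) (sym (suc-* (+ N) c))

Σ₁-block-swap : ∀ N (H : ℕ → ℕ → ℕ → ℕ → ℤ) →
  Σ₁ N (λ a → Σ₁ N λ b → Σ₁ N λ x → Σ₁ N λ y → H a b x y) ≡ Σ₁ N (λ x → Σ₁ N λ y → Σ₁ N λ a → Σ₁ N λ b → H a b x y)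
Σ₁-block-swap N H = begin
  Σ₁ N (λ a → Σ₁ N λ b → Σ₁ N λ x → Σ₁ N λ y → H a b x y)
    ≡⟨ Σ₁-cong N (λ a → Σ₁-swap N N λ b x → Σ₁ N λ y → H (suc a) b x y) ⟩
  Σ₁ N (λ a → Σ₁ N λ x → Σ₁ N λ b → Σ₁ N λ y → H a b x y)
    ≡⟨ Σ₁-swap N N (λ a x → Σ₁ N λ b → Σ₁ N λ y → H a b x y) ⟩
  Σ₁ N (λ x → Σ₁ N λ a → Σ₁ N λ b → Σ₁ N λ y → H a b x y)
    ≡⟨ Σ₁-cong N (λ x → Σ₁-cong N λ a → Σ₁-swap N N λ b y → H (suc a) b (suc x) y) ⟩
  Σ₁ N (λ x → Σ₁ N λ a → Σ₁ N λ y → Σ₁ N λ b → H a b x y)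
    ≡⟨ Σ₁-cong N (λ x → Σ₁-swap N N λ a y → Σ₁ N λ b → H a b (suc x) y) ⟩
  Σ₁ N (λ x → Σ₁ N λ y → Σ₁ N λ a → Σ₁ N λ b → H a b x y)
    ∎
  where open ≡-Reasoning

module Liouville (j : ℕ → ℕ → ℤ) (j-sym : ∀ a b → j a b ≡ j b a) (j-shift : ∀ a b → j (a ℕ.+ b) b
  ≡ j (a ℕ.+ b) a) where

  -- This is the weight `j` carried along the step from (a + b, b) to (a, b). By `j-shift` it is
  -- symmetric, so the sums weighted by `j` and by `k` both split into two equal triangles and a
  -- diagonal.
  k : ℕ → ℕ → ℤ
  k a b = j (a ℕ.+ b) b

  k-sym : ∀ a b → k a b ≡ k b a
  k-sym a b = trans (j-shift a b) (cong (λ m → j m a) (ℕₚ.+-comm a b))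

  module _ (n : ℕ) where
    open ≡-Reasoning

    δ : ℕ → ℤ
    δ m = (q^ m) n

    vanish : ∀ c {m} → n < m → c * δ m ≡ 0ℤ
    vanish c n<m = trans (cong (c *_) (q^-> n<m)) (*-zeroʳ c)

    F G : ℕ → ℕ → ℤ
    F a b = Σ₁ n λ x → Σ₁ n λ y → j a b * δ (a ℕ.* x ℕ.+ b ℕ.* y)
    G x y = Σ₁ n λ a → Σ₁ n λ b → k a b * δ (a ℕ.* x ℕ.+ b ℕ.* y)

    F-sym : ∀ a b → F a b ≡ F b a
    F-sym a b = trans (Σ₁-swap n n λ x y → j a b * δ (a ℕ.* x ℕ.+ b ℕ.* y))
      (Σ₁-cong n λ x → Σ₁-cong n λ y → cong₂ (λ c m → c * δ m) (j-sym a b) (ℕₚ.+-comm (a ℕ.* suc y) (b ℕ.* suc x)))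

    G-sym : ∀ x y → G x y ≡ G y x
    G-sym x y = trans (Σ₁-swap n n λ a b → k a b * δ (a ℕ.* x ℕ.+ b ℕ.* y))
      (Σ₁-cong n λ a → Σ₁-cong n λ b → cong₂ (λ c m
        → c * δ m) (k-sym (suc b) (suc a)) (ℕₚ.+-comm (suc b ℕ.* x) (suc a ℕ.* y)))

    F-vanish : ∀ a b → n < b → F a b ≡ 0ℤ
    F-vanish a b n<b = Σ₁-zero n λ x → Σ₁-zero n λ y → vanish (j a b)
      (ℕₚ.≤-trans n<b (ℕₚ.≤-trans (ℕₚ.m≤m*n b (suc y)) (ℕₚ.m≤n+m _ (a ℕ.* suc x))))

    G-vanish : ∀ x y → n < y → G x y ≡ 0ℤ
    G-vanish x y n<y = Σ₁-zero n λ a → Σ₁-zero n λ b → vanish (k (suc a) (suc b))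
      (ℕₚ.≤-trans n<y (ℕₚ.≤-trans (ℕₚ.m≤n*m y (suc b)) (ℕₚ.m≤n+m _ (suc a ℕ.* x))))

    -- Put b = a + c. Then a x + (a + c) y = c y + a (y + x) is an equation with coefficients c, a
    -- and unknowns y < y + x, and by symmetry the weight `j a (a + c)` is `k c a`.
    F-shift≡G-shift : Σ₁ n (λ a → Σ₁ n λ c → F a (a ℕ.+ c)) ≡ Σ₁ n (λ x → Σ₁ n λ z → G x (x ℕ.+ z))
    F-shift≡G-shift = begin
      Σ₁ n (λ a → Σ₁ n λ c → Σ₁ n λ x → Σ₁ n λ y → j a (a ℕ.+ c) * δ (a ℕ.* x ℕ.+ (a ℕ.+ c) ℕ.* y))
        ≡⟨ Σ₁-swap n n (λ a c → F a (a ℕ.+ c)) ⟩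
      Σ₁ n (λ c → Σ₁ n λ a → Σ₁ n λ x → Σ₁ n λ y → j a (a ℕ.+ c) * δ (a ℕ.* x ℕ.+ (a ℕ.+ c) ℕ.* y))
        ≡⟨ Σ₁-cong n (λ c → Σ₁-cong n λ a → Σ₁-swap n n λ x y
          → j (suc a) (suc a ℕ.+ suc c) * δ (suc a ℕ.* x ℕ.+ (suc a ℕ.+ suc c) ℕ.* y)) ⟩
      Σ₁ n (λ c → Σ₁ n λ a → Σ₁ n λ y → Σ₁ n λ x → j a (a ℕ.+ c) * δ (a ℕ.* x ℕ.+ (a ℕ.+ c) ℕ.* y))
        ≡⟨ Σ₁-cong n (λ c → Σ₁-cong n λ a → Σ₁-cong n λ y → Σ₁-cong n λ x → cong₂ (λ c m → c * δ m)
             (trans (j-sym (suc a) (suc a ℕ.+ suc c)) (cong (λ m → j m (suc a)) (ℕₚ.+-comm (suc a) (suc c))))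
             (exponent (suc a) (suc c) (suc x) (suc y))) ⟩
      Σ₁ n (λ c → Σ₁ n λ a → Σ₁ n λ y → Σ₁ n λ x → k c a * δ (c ℕ.* y ℕ.+ a ℕ.* (y ℕ.+ x)))
        ≡⟨ Σ₁-block-swap n (λ c a y x → k c a * δ (c ℕ.* y ℕ.+ a ℕ.* (y ℕ.+ x))) ⟩
      Σ₁ n (λ y → Σ₁ n λ x → Σ₁ n λ c → Σ₁ n λ a → k c a * δ (c ℕ.* y ℕ.+ a ℕ.* (y ℕ.+ x)))
        ∎
      where
      exponent : ∀ a c x y → a ℕ.* x ℕ.+ (a ℕ.+ c) ℕ.* y ≡ c ℕ.* y ℕ.+ a ℕ.* (y ℕ.+ x)
      exponent = N.solve 4 (λ a c x y → a N.:* x N.:+ (a N.:+ c) N.:* y N.:= c N.:* y N.:+ a N.:* (y N.:+ x)) refl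
        where module N = ℕSolver.+-*-Solver

    -- For a = b the equation is a (x + y) = n, and z = x + y splits into two positive parts in z -
    -- 1 ways.
    F-diagonal : Σ₁ n (λ a → F a a) ≡ div-sum (λ d x → + (x ∸ 1) * j d d) n
    F-diagonal = Σ₁-cong n λ a → begin
      Σ₁ n (λ x → Σ₁ n λ y → j (suc a) (suc a) * δ (suc a ℕ.* x ℕ.+ suc a ℕ.* y))
        ≡⟨ Σ₁-antidiagonal n (λ x y → j (suc a) (suc a) * δ (suc a ℕ.* x ℕ.+ suc a ℕ.* y))
             (λ x y n<x+y → vanish (j (suc a) (suc a)) (ℕₚ.<-≤-trans n<x+y
               (ℕₚ.≤-trans (ℕₚ.m≤n*m (x ℕ.+ y) (suc a)) (ℕₚ.≤-reflexive (ℕₚ.*-distribˡ-+ (suc a) x y))))) ⟩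
      Σ₁ n (λ z → Σ₁ (z ∸ 1) λ x → j (suc a) (suc a) * δ (suc a ℕ.* x ℕ.+ suc a ℕ.* (z ∸ x)))
        ≡⟨ Σ₁-cong n (λ z → trans
             (Σ₁-cong-≤ z λ x x<z → cong (λ m → j (suc a) (suc a) * δ m) (trans
               (sym (ℕₚ.*-distribˡ-+ (suc a) (suc x) (z ∸ x)))
               (cong (λ m → suc a ℕ.* suc m) (ℕₚ.m+[n∸m]≡n (ℕₚ.<⇒≤ x<z)))))
             (trans (Σ₁-const z (j (suc a) (suc a) * δ (suc a ℕ.* suc z)))
               (sym (*-assoc (+ z) (j (suc a) (suc a)) (δ (suc a ℕ.* suc z)))))) ⟩
      Σ₁ n (λ z → + (z ∸ 1) * j (suc a) (suc a) * δ (suc a ℕ.* z))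
        ∎

    -- For x = y the equation is (a + b) x = n. With d = a + b, `j-shift` turns the weight into
    -- `j d a`, and a runs over 1 ≤ a < d.
    G-diagonal : Σ₁ n (λ x → G x x) ≡ div-sum (λ d x → Σ₁ (d ∸ 1) (j d)) n
    G-diagonal = trans (Σ₁-cong n step) (Σ₁-swap n n λ x d → Σ₁ (d ∸ 1) (j d) * δ (d ℕ.* x))
      where
      step : ∀ x → G (suc x) (suc x) ≡ Σ₁ n (λ d → Σ₁ (d ∸ 1) (j d) * δ (d ℕ.* suc x))
      step x = begin
        Σ₁ n (λ a → Σ₁ n λ b → k a b * δ (a ℕ.* suc x ℕ.+ b ℕ.* suc x))
          ≡⟨ Σ₁-antidiagonal n (λ a b → k a b * δ (a ℕ.* suc x ℕ.+ b ℕ.* suc x))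
               (λ a b n<a+b → vanish (k a b) (ℕₚ.<-≤-trans n<a+b
                 (ℕₚ.≤-trans (ℕₚ.m≤m*n (a ℕ.+ b) (suc x)) (ℕₚ.≤-reflexive (ℕₚ.*-distribʳ-+ (suc x) a b))))) ⟩
        Σ₁ n (λ d → Σ₁ (d ∸ 1) λ a → k a (d ∸ a) * δ (a ℕ.* suc x ℕ.+ (d ∸ a) ℕ.* suc x))
          ≡⟨ Σ₁-cong n (λ d → trans
               (Σ₁-cong-≤ d λ a a<d → trans
                 (cong₂ (λ c m → c * δ m)
                   (trans (j-shift (suc a) (d ∸ a)) (cong (λ m → j (suc m) (suc a)) (ℕₚ.m+[n∸m]≡n (ℕₚ.<⇒≤ a<d))))
                   (trans (sym (ℕₚ.*-distribʳ-+ (suc x) (suc a) (d ∸ a)))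
                     (cong (λ m → suc m ℕ.* suc x) (ℕₚ.m+[n∸m]≡n (ℕₚ.<⇒≤ a<d)))))
                 (*-comm (j (suc d) (suc a)) (δ (suc d ℕ.* suc x))))
               (trans (Σ₁-* d (δ (suc d ℕ.* suc x)) (j (suc d))) (*-comm (δ (suc d ℕ.* suc x)) (Σ₁ d (j (suc d)))))) ⟩
        Σ₁ n (λ d → Σ₁ (d ∸ 1) (j d) * δ (d ℕ.* suc x))
          ∎

    -- Euclid's step (a, b, x, y) ↦ (a − b, b, x, x + y) preserves a x + b y and maps the
    -- solutions with b < a onto those with x < y.
    Liouville-identity : quad-sum j n - quad-sum k n ≡ div-sum (λ d x → + (x ∸ 1) * j d d) n - div-sum (λ d _
      → Σ₁ (d ∸ 1) (j d)) n
    Liouville-identity = begin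
      quad-sum j n - quad-sum k n
        ≡⟨ cong₂ _-_ (Σ₁-symmetric n F F-sym F-vanish)
             (trans (Σ₁-block-swap n λ a b x y → k a b * δ (a ℕ.* x ℕ.+ b ℕ.* y)) (Σ₁-symmetric n G G-sym G-vanish)) ⟩
      (+ 2 * A + Σ₁ n (λ a → F a a)) - (+ 2 * B + Σ₁ n (λ x → G x x))
        ≡⟨ cong (λ z → (+ 2 * z + Σ₁ n (λ a → F a a)) - (+ 2 * B + Σ₁ n (λ x → G x x))) F-shift≡G-shift ⟩
      (+ 2 * B + Σ₁ n (λ a → F a a)) - (+ 2 * B + Σ₁ n (λ x → G x x))
        ≡⟨ solve! 3 (λ b f g → (b :+ f) :- (b :+ g) := f :- g) refl (+ 2 * B) (Σ₁ n (λ a → F a a)) (Σ₁ n (λ x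
          → G x x)) ⟩
      Σ₁ n (λ a → F a a) - Σ₁ n (λ x → G x x)
        ≡⟨ cong₂ _-_ F-diagonal G-diagonal ⟩
      div-sum (λ d x → + (x ∸ 1) * j d d) n - div-sum (λ d _ → Σ₁ (d ∸ 1) (j d)) n
        ∎
      where
      A = Σ₁ n (λ a → Σ₁ n λ c → F a (a ℕ.+ c))
      B = Σ₁ n (λ x → Σ₁ n λ z → G x (x ℕ.+ z))

-- Liouville's identity for kernels built from an even function

s : ℕ → ℤ
s d = -1ℤ ^ d

s-+ : ∀ a b → s (a ℕ.+ b) ≡ s a * s b
s-+ = ^-distribˡ-+-* -1ℤ

s² : ∀ a → s a * s a ≡ 1ℤ
s² zero    = refl
s² (suc a) = trans (solve! 1 (λ x → con -1ℤ :* x :* (con -1ℤ :* x) := x :* x) refl (s a)) (s² a)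

∸-cast : ∀ d a → a ≤ d → + (d ∸ a) ≡ + d - + a
∸-cast d a a≤d = trans (sym (⊖-≥ a≤d)) (sym (m-n≡m⊖n d a))

s-∸ : ∀ d a → a ≤ d → s (d ∸ a) ≡ s d * s a
s-∸ d a a≤d = begin
  s (d ∸ a)                ≡⟨ *-identityʳ _ ⟨
  s (d ∸ a) * 1ℤ           ≡⟨ cong (s (d ∸ a) *_) (s² a) ⟨
  s (d ∸ a) * (s a * s a)  ≡⟨ *-assoc (s (d ∸ a)) (s a) (s a) ⟨
  s (d ∸ a) * s a * s a    ≡⟨ cong (_* s a) (s-+ (d ∸ a) a) ⟨
  s (d ∸ a ℕ.+ a) * s a    ≡⟨ cong (λ m → s m * s a) (ℕₚ.m∸n+n≡m a≤d) ⟩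
  s d * s a                ∎
  where open ≡-Reasoning

shift-arg : ∀ a b → + (a ℕ.+ b) - + b ≡ + a
shift-arg a b = trans (cong (_- + b) (pos-+ a b)) (solve! 2 (λ x y → x :+ y :- y := x) refl (+ a) (+ b))

Σ₁-linear : ∀ N c f g e → (∀ a → e (suc a) ≡ c * f (suc a) + g (suc a)) → Σ₁ N e ≡ c * Σ₁ N f + Σ₁ N g
Σ₁-linear N c f g e eq = trans (Σ₁-cong N eq) (trans (Σ₁-+ N (λ a → c * f a) g) (cong (_+ Σ₁ N g) (Σ₁-* N c f)))

quad-sum-linear : ∀ c h h′ n → quad-sum (λ a b → c * h a b + h′ a b) n ≡ c * quad-sum h n + quad-sum h′ n
quad-sum-linear c h h′ n =
  Σ₁-linear n c (λ a → Σ₁ n λ b → Σ₁ n λ x → Σ₁ n λ y → h a b * δ a b x y) _ _ λ a →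
  Σ₁-linear n c (λ b → Σ₁ n λ x → Σ₁ n λ y → h (suc a) b * δ (suc a) b x y) _ _ λ b →
  Σ₁-linear n c (λ x → Σ₁ n λ y → h (suc a) (suc b) * δ (suc a) (suc b) x y) _ _ λ x →
  Σ₁-linear n c (λ y → h (suc a) (suc b) * δ (suc a) (suc b) (suc x) y) (λ y
    → h′ (suc a) (suc b) * δ (suc a) (suc b) (suc x) y) _ λ y →
  solve! 4 (λ c h h′ d → (c :* h :+ h′) :* d := c :* (h :* d) :+ h′ :* d)
    refl c (h (suc a) (suc b)) (h′ (suc a) (suc b)) _
  where
  δ : ℕ → ℕ → ℕ → ℕ → ℤ
  δ a b x y = (q^ (a ℕ.* x ℕ.+ b ℕ.* y)) n

div-sum-linear : ∀ c φ φ′ n → div-sum (λ d x → c * φ d x + φ′ d x) n ≡ c * div-sum φ n + div-sum φ′ n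
div-sum-linear c φ φ′ n =
  Σ₁-linear n c (λ d → Σ₁ n λ x → φ d x * (q^ (d ℕ.* x)) n) _ _ λ d →
  Σ₁-linear n c (λ x → φ (suc d) x * (q^ (suc d ℕ.* x)) n) (λ x → φ′ (suc d) x * (q^ (suc d ℕ.* x)) n) _ λ x →
  solve! 4 (λ c h h′ d → (c :* h :+ h′) :* d := c :* (h :* d) :+ h′ :* d)
    refl c (φ (suc d) (suc x)) (φ′ (suc d) (suc x)) _

quad-sum-cong : ∀ {h h′} → (∀ a b → h (suc a) (suc b) ≡ h′ (suc a) (suc b)) → quad-sum h ≈ quad-sum h′
quad-sum-cong eq n = Σ₁-cong n λ a → Σ₁-cong n λ b → Σ₁-cong n λ x → Σ₁-cong n λ y →
  cong (_* (q^ (suc a ℕ.* suc x ℕ.+ suc b ℕ.* suc y)) n) (eq a b)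

div-sum-cong : ∀ {φ φ′} → (∀ d x → φ (suc d) (suc x) ≡ φ′ (suc d) (suc x)) → div-sum φ ≈ div-sum φ′
div-sum-cong eq n = Σ₁-cong n λ d → Σ₁-cong n λ x → cong (_* (q^ (suc d ℕ.* suc x)) n) (eq d x)

Liouville : ∀ j → (∀ a b → j a b ≡ j b a) → (∀ a b → j (a ℕ.+ b) b ≡ j (a ℕ.+ b) a) →
  quad-sum (λ a b → j a b - j (a ℕ.+ b) b) ≈ div-sum (λ d x → (+ x - 1ℤ) * j d d - Σ₁ (d ∸ 1) (j d))
Liouville j j-sym j-shift n = begin
  quad-sum (λ a b → j a b - j (a ℕ.+ b) b) n
    ≡⟨ quad-sum-cong {λ a b → j a b - j (a ℕ.+ b) b} {λ a b → -1ℤ * j (a ℕ.+ b) b + j a b} (λ a b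
      → difference (j (suc a) (suc b)) (j (suc a ℕ.+ suc b) (suc b))) n ⟩
  quad-sum (λ a b → -1ℤ * j (a ℕ.+ b) b + j a b) n
    ≡⟨ quad-sum-linear -1ℤ (λ a b → j (a ℕ.+ b) b) j n ⟩
  -1ℤ * quad-sum (λ a b → j (a ℕ.+ b) b) n + quad-sum j n
    ≡⟨ difference (quad-sum j n) _ ⟨
  quad-sum j n - quad-sum (λ a b → j (a ℕ.+ b) b) n
    ≡⟨ Liouville-identity n ⟩
  div-sum (λ d x → + (x ∸ 1) * j d d) n - div-sum (λ d _ → Σ₁ (d ∸ 1) (j d)) n
    ≡⟨ difference (div-sum (λ d x → + (x ∸ 1) * j d d) n) _ ⟩
  -1ℤ * div-sum (λ d _ → Σ₁ (d ∸ 1) (j d)) n + div-sum (λ d x → + (x ∸ 1) * j d d) n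
    ≡⟨ div-sum-linear -1ℤ (λ d _ → Σ₁ (d ∸ 1) (j d)) (λ d x → + (x ∸ 1) * j d d) n ⟨
  div-sum (λ d x → -1ℤ * Σ₁ (d ∸ 1) (j d) + + (x ∸ 1) * j d d) n
    ≡⟨ div-sum-cong {λ d x → -1ℤ * Σ₁ (d ∸ 1) (j d) + + (x ∸ 1) * j d d} {λ d x → (+ x - 1ℤ) * j d d
      - Σ₁ (d ∸ 1) (j d)} (λ d x → trans (cong (λ m → -1ℤ * Σ₁ d (j (suc d))
      + m * j (suc d) (suc d)) (∸-cast (suc x) 1 (s≤s z≤n)))
         (sym (difference _ (Σ₁ d (j (suc d)))))) n ⟩
  div-sum (λ d x → (+ x - 1ℤ) * j d d - Σ₁ (d ∸ 1) (j d)) n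
    ∎
  where
  open ≡-Reasoning
  open Liouville j j-sym j-shift
  difference : ∀ x y → x - y ≡ -1ℤ * y + x
  difference = solve! 2 (λ x y → x :- y := con -1ℤ :* y :+ x) refl

Σ₁-flip : ∀ d {f g : ℕ → ℤ} → (∀ a → a < d → f (suc a) ≡ g (d ∸ a)) → Σ₁ d f ≡ Σ₁ d g
Σ₁-flip d {f} {g} eq = trans (Σ₁-cong-≤ d {g = λ a → g (suc d ∸ a)} eq) (Σ₁-reverse d g)

alternating-sum : (ℤ → ℤ) → ℕ → ℤ
alternating-sum f d = Σ₁ (d ∸ 1) λ a → s a * f (+ a)

module _ (E : ℤ → ℤ) (E-even : ∀ x → E (- x) ≡ E x) where

  open ≡-Reasoning

  E-flip : ∀ a b → E (+ a - + b) ≡ E (+ b - + a)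
  E-flip a b = trans (cong E (solve! 2 (λ x y → x :- y := :- (y :- x)) refl (+ a) (+ b))) (E-even _)

  -- j and i are made symmetric under the group generated by (u, v) ↦ (v, u) and
  -- (u, v) ↦ (u, u - v), as Liouville demands.  In i, the products of a signed and an
  -- unsigned factor that survive in the difference i a b - i (a + b) b have the unsigned
  -- factor to the first power.
  private
    j : ℕ → ℕ → ℤ
    j u v = s u * s v * E (+ u - + v) + s v * E (+ v) + s u * E (+ u)

    j-sym : ∀ a b → j a b ≡ j b a
    j-sym a b = trans
      (cong (λ e → s a * s b * e + s b * E (+ b) + s a * E (+ a)) (E-flip a b))
      (solve! 5 (λ s t e p q → s :* t :* e :+ t :* q :+ s :* p := t :* s :* e :+ s :* p :+ t :* q) refl
        (s a) (s b) (E (+ b - + a)) (E (+ a)) (E (+ b)))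

    j-+ : ∀ a b → j (a ℕ.+ b) b ≡ s a * E (+ a) + s b * E (+ b) + s a * s b * E (+ a + + b)
    j-+ a b = begin
      j (a ℕ.+ b) b
        ≡⟨ cong₂ (λ t e → t * s b * E e + s b * E (+ b) + t * E (+ (a ℕ.+ b))) (s-+ a b) (shift-arg a b) ⟩
      s a * s b * s b * E (+ a) + s b * E (+ b) + s a * s b * E (+ (a ℕ.+ b))
        ≡⟨ cong (λ t → t * E (+ a) + s b * E (+ b) + s a * s b * E (+ (a ℕ.+ b)))
             (trans (*-assoc (s a) (s b) (s b)) (trans (cong (s a *_) (s² b)) (*-identityʳ (s a)))) ⟩
      s a * E (+ a) + s b * E (+ b) + s a * s b * E (+ (a ℕ.+ b))
        ∎

    j-shift : ∀ a b → j (a ℕ.+ b) b ≡ j (a ℕ.+ b) a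
    j-shift a b = begin
      j (a ℕ.+ b) b
        ≡⟨ j-+ a b ⟩
      s a * E (+ a) + s b * E (+ b) + s a * s b * E (+ a + + b)
        ≡⟨ cong₂ _+_ (+-comm (s a * E (+ a)) _) (cong₂ _*_ (*-comm (s a) (s b)) (cong E (+-comm (+ a) (+ b)))) ⟩
      s b * E (+ b) + s a * E (+ a) + s b * s a * E (+ b + + a)
        ≡⟨ j-+ b a ⟨
      j (b ℕ.+ a) a
        ≡⟨ cong (λ m → j m a) (ℕₚ.+-comm b a) ⟩
      j (a ℕ.+ b) a
        ∎

  even-kernel even-divisor-kernel : ℕ → ℕ → ℤ
  even-kernel = λ a b → s a * s b * (E (+ a - + b) - E (+ a + + b))
  even-divisor-kernel = λ d x → (+ x - 1ℤ) * (E 0ℤ + + 2 * (s d * E (+ d))) - (+ 2 * alternating-sum E d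
    + (+ d - 1ℤ) * (s d * E (+ d)))

  -- This is the source of derivatives of signed series: on the diagonal `j` is E(0) + 2 (-1)ᵈ E(d),
  -- so for E(t) = t²ᵐ with m > 0 the cofactor x multiplies 2 (-1)ᵈ d²ᵐ. As d x = n, this is the
  -- derivative of twice the series with exponent 2m - 1.
  even-identity : quad-sum even-kernel ≈ div-sum even-divisor-kernel
  even-identity n = begin
    quad-sum even-kernel n
      ≡⟨ quad-sum-cong {even-kernel} {λ a b → j a b - j (a ℕ.+ b) b} (λ a b → sym (difference (suc a) (suc b))) n ⟩
    quad-sum (λ a b → j a b - j (a ℕ.+ b) b) n
      ≡⟨ Liouville j j-sym j-shift n ⟩
    div-sum (λ d x → (+ x - 1ℤ) * j d d - Σ₁ (d ∸ 1) (j d)) n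
      ≡⟨ div-sum-cong {λ d x → (+ x - 1ℤ) * j d d - Σ₁ (d ∸ 1) (j d)} {even-divisor-kernel} (λ d x → cong₂ (λ y z
        → (+ suc x - 1ℤ) * y - z) (diagonal (suc d)) (row d)) n ⟩
    div-sum even-divisor-kernel n
      ∎
    where
    difference : ∀ a b → j a b - j (a ℕ.+ b) b ≡ s a * s b * (E (+ a - + b) - E (+ a + + b))
    difference a b = trans (cong (_-_ (j a b)) (j-+ a b))
      (solve! 6 (λ s t e f p q → s :* t :* e :+ t :* q :+ s :* p :- (s :* p :+ t :* q :+ s :* t :* f) := s :* t :* (e
        :- f)) refl
        (s a) (s b) (E (+ a - + b)) (E (+ a + + b)) (E (+ a)) (E (+ b)))

    diagonal : ∀ d → j d d ≡ E 0ℤ + + 2 * (s d * E (+ d))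
    diagonal d = trans
      (cong₂ (λ t e → t * E e + s d * E (+ d) + s d * E (+ d)) (s² d) (+-inverseʳ (+ d)))
      (solve! 2 (λ e f → con 1ℤ :* e :+ f :+ f := e :+ con (+ 2) :* f) refl (E 0ℤ) (s d * E (+ d)))

    row : ∀ d → Σ₁ d (j (suc d)) ≡ + 2 * alternating-sum E (suc d) + (+ suc d - 1ℤ) * (s (suc d) * E (+ suc d))
    row d = begin
      Σ₁ d (λ a → s D * s a * E (+ D - + a) + s a * E (+ a) + s D * E (+ D))
        ≡⟨ Σ₁-+ d (λ a → s D * s a * E (+ D - + a) + s a * E (+ a)) (λ _ → s D * E (+ D)) ⟩
      Σ₁ d (λ a → s D * s a * E (+ D - + a) + s a * E (+ a)) + Σ₁ d (λ _ → s D * E (+ D))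
        ≡⟨ cong₂ _+_ (Σ₁-+ d (λ a → s D * s a * E (+ D - + a)) (λ a → s a * E (+ a))) (Σ₁-const d (s D * E (+ D))) ⟩
      Σ₁ d (λ a → s D * s a * E (+ D - + a)) + alternating-sum E D + + d * (s D * E (+ D))
        ≡⟨ cong₂ (λ y z → y + alternating-sum E D + z * (s D * E (+ D)))
             (Σ₁-flip d λ a a<d → sym (cong₂ _*_ (s-∸ D (suc a) (s≤s (ℕₚ.<⇒≤ a<d)))
               (cong E (∸-cast D (suc a) (s≤s (ℕₚ.<⇒≤ a<d))))))
             (∸-cast D 1 (s≤s z≤n)) ⟩
      alternating-sum E D + alternating-sum E D + (+ D - 1ℤ) * (s D * E (+ D))
        ≡⟨ solve! 2 (λ y z → y :+ y :+ z := con (+ 2) :* y :+ z) refl (alternating-sum E D) _ ⟩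
      + 2 * alternating-sum E D + (+ D - 1ℤ) * (s D * E (+ D))
        ∎
      where D = suc d

  private
    i : ℕ → ℕ → ℤ
    i u v = s u * s v * (+ u * + v) * E (+ u - + v) + s v * (+ u * (+ u - + v)) * E (+ v) + s u * (+ v * (+ v
      - + u)) * E (+ u)

    i-sym : ∀ a b → i a b ≡ i b a
    i-sym a b = trans
      (cong (λ e → s a * s b * (+ a * + b) * e + s b * (+ a * (+ a - + b)) * E (+ b) + s a * (+ b * (+ b
        - + a)) * E (+ a)) (E-flip a b))
      (solve! 7 (λ s t x y e p q → s :* t :* (x :* y) :* e :+ t :* (x :* (x :- y)) :* q :+ s :* (y :* (y :- x)) :* p
                               := t :* s :* (y :* x) :* e :+ s :* (y :* (y :- x)) :* p :+ t :* (x :* (x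
                                 :- y)) :* q) refl
        (s a) (s b) (+ a) (+ b) (E (+ b - + a)) (E (+ a)) (E (+ b)))

    i-+ : ∀ a b → i (a ℕ.+ b) b ≡ s a * ((+ a + + b) * + b) * E (+ a) + s b * ((+ a + + b) * + a) * E (+ b)
      - s a * s b * (+ a * + b) * E (+ a + + b)
    i-+ a b = begin
      i (a ℕ.+ b) b
        ≡⟨ cong₂ (λ t e → t * s b * ((+ a + + b) * + b) * E e + s b * ((+ a + + b) * (+ a + + b - + b)) * E (+ b)
                          + t * (+ b * (+ b - (+ a + + b))) * E (+ a + + b)) (s-+ a b) (shift-arg a b) ⟩
      s a * s b * s b * ((+ a + + b) * + b) * E (+ a) + s b * ((+ a + + b) * (+ a + + b - + b)) * E (+ b)
        + s a * s b * (+ b * (+ b - (+ a + + b))) * E (+ a + + b)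
        ≡⟨ cong (λ t → t * ((+ a + + b) * + b) * E (+ a) + s b * ((+ a + + b) * (+ a + + b - + b)) * E (+ b)
                       + s a * s b * (+ b * (+ b - (+ a + + b))) * E (+ a + + b))
             (trans (*-assoc (s a) (s b) (s b)) (trans (cong (s a *_) (s² b)) (*-identityʳ (s a)))) ⟩
      s a * ((+ a + + b) * + b) * E (+ a) + s b * ((+ a + + b) * (+ a + + b - + b)) * E (+ b)
        + s a * s b * (+ b * (+ b - (+ a + + b))) * E (+ a + + b)
        ≡⟨ solve! 7 (λ s t x y e p q → s :* ((x :+ y) :* y) :* p :+ t :* ((x :+ y) :* (x :+ y :- y)) :* q
          :+ s :* t :* (y :* (y :- (x :+ y))) :* e
                                   := s :* ((x :+ y) :* y) :* p :+ t :* ((x :+ y) :* x) :* q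
                                     :- s :* t :* (x :* y) :* e) refl
             (s a) (s b) (+ a) (+ b) (E (+ a + + b)) (E (+ a)) (E (+ b)) ⟩
      s a * ((+ a + + b) * + b) * E (+ a) + s b * ((+ a + + b) * + a) * E (+ b) - s a * s b * (+ a * + b) * E (+ a
        + + b)
        ∎

    i-shift : ∀ a b → i (a ℕ.+ b) b ≡ i (a ℕ.+ b) a
    i-shift a b = begin
      i (a ℕ.+ b) b
        ≡⟨ i-+ a b ⟩
      s a * ((+ a + + b) * + b) * E (+ a) + s b * ((+ a + + b) * + a) * E (+ b) - s a * s b * (+ a * + b) * E (+ a
        + + b)
        ≡⟨ cong (λ m → s a * ((+ a + + b) * + b) * E (+ a) + s b * ((+ a + + b) * + a) * E (+ b)
          - s a * s b * (+ a * + b) * E m) (+-comm (+ a) (+ b)) ⟩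
      s a * ((+ a + + b) * + b) * E (+ a) + s b * ((+ a + + b) * + a) * E (+ b) - s a * s b * (+ a * + b) * E (+ b
        + + a)
        ≡⟨ solve! 7 (λ s t x y e p q → s :* ((x :+ y) :* y) :* p :+ t :* ((x :+ y) :* x) :* q
          :- s :* t :* (x :* y) :* e
                                   := t :* ((y :+ x) :* x) :* q :+ s :* ((y :+ x) :* y) :* p
                                     :- t :* s :* (y :* x) :* e) refl
             (s a) (s b) (+ a) (+ b) (E (+ b + + a)) (E (+ a)) (E (+ b)) ⟩
      s b * ((+ b + + a) * + a) * E (+ b) + s a * ((+ b + + a) * + b) * E (+ a) - s b * s a * (+ b * + a) * E (+ b
        + + a)
        ≡⟨ i-+ b a ⟨
      i (b ℕ.+ a) a
        ≡⟨ cong (λ m → i m a) (ℕₚ.+-comm b a) ⟩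
      i (a ℕ.+ b) a
        ∎

  odd-kernel odd-divisor-kernel : ℕ → ℕ → ℤ
  odd-kernel = λ a b → s a * s b * (+ a * + b) * (E (+ a - + b) + E (+ a + + b)) - + 2 * (+ a * + b) * (s a * E (+ a)
    + s b * E (+ b))
  odd-divisor-kernel = λ d x → (+ x - 1ℤ) * (+ d * + d * E 0ℤ)
        - (+ 2 * + d * (+ d * alternating-sum E d - alternating-sum (λ t → t * E t) d) + s d * E (+ d) * Σ₁ (d ∸ 1)
          (λ a → + a * (+ a - + d)))

  -- On the diagonal `i` is d² E(0). For E(t) = t²ᵐ with m > 0 it vanishes, the cofactor x
  -- disappears, and the relation is free of derivatives; for E = 1 it supplies the derivative of
  -- the unsigned series S. The price is the products of a signed and an unsigned factor.
  odd-identity : quad-sum odd-kernel ≈ div-sum odd-divisor-kernel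
  odd-identity n = begin
    quad-sum odd-kernel n
      ≡⟨ quad-sum-cong {odd-kernel} {λ a b → i a b - i (a ℕ.+ b) b} (λ a b → sym (difference (suc a) (suc b))) n ⟩
    quad-sum (λ a b → i a b - i (a ℕ.+ b) b) n
      ≡⟨ Liouville i i-sym i-shift n ⟩
    div-sum (λ d x → (+ x - 1ℤ) * i d d - Σ₁ (d ∸ 1) (i d)) n
      ≡⟨ div-sum-cong {λ d x → (+ x - 1ℤ) * i d d - Σ₁ (d ∸ 1) (i d)} {odd-divisor-kernel} (λ d x → cong₂ (λ y z
        → (+ suc x - 1ℤ) * y - z) (diagonal (suc d)) (row d)) n ⟩
    div-sum odd-divisor-kernel n
      ∎
    where
    difference : ∀ a b → i a b - i (a ℕ.+ b) b
      ≡ s a * s b * (+ a * + b) * (E (+ a - + b) + E (+ a + + b)) - + 2 * (+ a * + b) * (s a * E (+ a)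
        + s b * E (+ b))
    difference a b = trans (cong (_-_ (i a b)) (i-+ a b))
      (solve! 8 (λ s t x y e f p q →
           s :* t :* (x :* y) :* e :+ t :* (x :* (x :- y)) :* q :+ s :* (y :* (y :- x)) :* p
             :- (s :* ((x :+ y) :* y) :* p :+ t :* ((x :+ y) :* x) :* q :- s :* t :* (x :* y) :* f)
           := s :* t :* (x :* y) :* (e :+ f) :- con (+ 2) :* (x :* y) :* (s :* p :+ t :* q)) refl
        (s a) (s b) (+ a) (+ b) (E (+ a - + b)) (E (+ a + + b)) (E (+ a)) (E (+ b)))

    diagonal : ∀ d → i d d ≡ + d * + d * E 0ℤ
    diagonal d = trans
      (cong₂ (λ t e → t * (+ d * + d) * E e + s d * (+ d * e) * E (+ d)
        + s d * (+ d * e) * E (+ d)) (s² d) (+-inverseʳ (+ d)))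
      (solve! 4 (λ s x e f → con 1ℤ :* (x :* x) :* e :+ s :* (x :* con 0ℤ) :* f :+ s :* (x :* con 0ℤ) :* f
        := x :* x :* e) refl
        (s d) (+ d) (E 0ℤ) (E (+ d)))

    row : ∀ d → Σ₁ d (i (suc d))
      ≡ + 2 * + suc d * (+ suc d * alternating-sum E (suc d) - alternating-sum (λ t → t * E t) (suc d))
        + s (suc d) * E (+ suc d) * Σ₁ d (λ a → + a * (+ a - + suc d))
    row d = begin
      Σ₁ d (λ a → s D * s a * (+ D * + a) * E (+ D - + a) + s a * (+ D * (+ D - + a)) * E (+ a) + s D * (+ a * (+ a
        - + D)) * E (+ D))
        ≡⟨ Σ₁-+ d (λ a → s D * s a * (+ D * + a) * E (+ D - + a) + s a * (+ D * (+ D - + a)) * E (+ a)) (λ a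
          → s D * (+ a * (+ a - + D)) * E (+ D)) ⟩
      Σ₁ d (λ a → s D * s a * (+ D * + a) * E (+ D - + a) + g a) + Σ₁ d (λ a → s D * (+ a * (+ a - + D)) * E (+ D))
        ≡⟨ cong₂ _+_ (Σ₁-+ d (λ a → s D * s a * (+ D * + a) * E (+ D - + a)) g)
             (trans (Σ₁-cong d λ a → swap (s D) (+ suc a * (+ suc a - + D)) (E (+ D))) (Σ₁-* d (s D * E (+ D)) λ a
               → + a * (+ a - + D))) ⟩
      Σ₁ d (λ a → s D * s a * (+ D * + a) * E (+ D - + a)) + Σ₁ d g + T
        -- The substitution a ↦ D - a carries the first summand to `g`, because `s (D ∸ a)` is
        -- `s D * s a`.
        ≡⟨ cong (λ z → z + Σ₁ d g + T) (Σ₁-flip d flip) ⟩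
      Σ₁ d g + Σ₁ d g + T
        ≡⟨ cong (λ z → z + z + T) g-sum ⟩
      + D * + D * A₀ + - (+ D) * A₁ + (+ D * + D * A₀ + - (+ D) * A₁) + T
        ≡⟨ solve! 4 (λ x p q t → x :* x :* p :+ :- x :* q :+ (x :* x :* p :+ :- x :* q) :+ t
          := con (+ 2) :* x :* (x :* p :- q) :+ t) refl (+ D) A₀ A₁ T ⟩
      + 2 * + D * (+ D * A₀ - A₁) + T
        ∎
      where
      D = suc d
      A₀ = alternating-sum E D
      A₁ = alternating-sum (λ t → t * E t) D
      T = s D * E (+ D) * Σ₁ d (λ a → + a * (+ a - + D))
      g : ℕ → ℤ
      g a = s a * (+ D * (+ D - + a)) * E (+ a)
      swap : ∀ x y z → x * y * z ≡ x * z * y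
      swap = solve! 3 (λ x y z → x :* y :* z := x :* z :* y) refl
      flip : ∀ a → a < d → s D * s (suc a) * (+ D * + suc a) * E (+ D - + suc a) ≡ g (d ∸ a)
      flip a a<d = begin
        s D * s (suc a) * (+ D * + suc a) * E (+ D - + suc a)
          ≡⟨ cong (λ z → s D * s (suc a) * (+ D * z) * E (+ D - + suc a)) (solve! 2 (λ x y → y := x :- (x :- y))
            refl (+ D) (+ suc a)) ⟩
        s D * s (suc a) * (+ D * (+ D - (+ D - + suc a))) * E (+ D - + suc a)
          ≡⟨ cong₂ (λ t z → t * (+ D * (+ D - z)) * E z) (s-∸ D (suc a) a≤d) (∸-cast D (suc a) a≤d) ⟨
        g (d ∸ a)
          ∎
        where a≤d = s≤s (ℕₚ.<⇒≤ a<d)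
      g-sum : Σ₁ d g ≡ + D * + D * A₀ + - (+ D) * A₁
      g-sum = begin
        Σ₁ d g
          ≡⟨ Σ₁-cong d (λ a → solve! 4 (λ t x y e → t :* (x :* (x :- y)) :* e := x :* x :* (t :* e)
            :+ :- x :* (t :* (y :* e))) refl
               (s (suc a)) (+ D) (+ suc a) (E (+ suc a))) ⟩
        Σ₁ d (λ a → + D * + D * (s a * E (+ a)) + - (+ D) * (s a * (+ a * E (+ a))))
          ≡⟨ Σ₁-+ d (λ a → + D * + D * (s a * E (+ a))) (λ a → - (+ D) * (s a * (+ a * E (+ a)))) ⟩
        Σ₁ d (λ a → + D * + D * (s a * E (+ a))) + Σ₁ d (λ a → - (+ D) * (s a * (+ a * E (+ a))))
          ≡⟨ cong₂ _+_ (Σ₁-* d (+ D * + D) λ a → s a * E (+ a)) (Σ₁-* d (- (+ D)) λ a → s a * (+ a * E (+ a))) ⟩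
        + D * + D * A₀ + - (+ D) * A₁
          ∎

-- From polynomial identities between kernels to identities between series

∂ : Series → Series
∂ f n = + n * f n

θ : ℕ → ℕ → ℤ
θ r d = s d * (+ d) ^ r

-- One list has two readings, as a function of a and b (or of d) and as a combination of series. A
-- polynomial identity between kernels, checked pointwise by the solver, thereby becomes an identity
-- between series.
QuadForm LinForm : Set
QuadForm = List (ℤ × (ℕ → ℤ) × (ℕ → ℤ))
LinForm  = List (ℤ × (ℕ → ℤ))

-- Coefficients stand to the right of products: in c * x with a literal c, conversion
-- checking would unfold ℕ multiplication c times.
quad-value : QuadForm → ℕ → ℕ → ℤ
quad-value []                 a b = 0ℤ
quad-value ((c , p , r) ∷ ts) a b = (p a * r b) * c + quad-value ts a b

quad-series : QuadForm → Series
quad-series []                 = constₛ 0ℤ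
quad-series ((c , p , r) ∷ ts) = constₛ c ⊛ (𝒟 p ⊛ 𝒟 r) ⊕ quad-series ts

lin-value : LinForm → ℕ → ℤ
lin-value []             d = 0ℤ
lin-value ((c , p) ∷ ts) d = p d * c + lin-value ts d

lin-series : LinForm → Series
lin-series []             = constₛ 0ℤ
lin-series ((c , p) ∷ ts) = constₛ c ⊛ 𝒟 p ⊕ lin-series ts

quad-sum-zero : ∀ n → quad-sum (λ _ _ → 0ℤ) n ≡ 0ℤ
quad-sum-zero n = Σ₁-zero n λ a → Σ₁-zero n λ b → Σ₁-zero n λ x → Σ₁-zero n λ y → *-zeroˡ
  ((q^ (suc a ℕ.* suc x ℕ.+ suc b ℕ.* suc y)) n)

div-sum-zero : ∀ n → div-sum (λ _ _ → 0ℤ) n ≡ 0ℤ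
div-sum-zero n = Σ₁-zero n λ d → Σ₁-zero n λ x → *-zeroˡ ((q^ (suc d ℕ.* suc x)) n)

const-0 : 0ₛ ≈ constₛ 0ℤ
const-0 zero    = refl
const-0 (suc _) = refl

quad-sum-value : ∀ ts → quad-sum (quad-value ts) ≈ quad-series ts
quad-sum-value []                 n = trans (quad-sum-zero n) (const-0 n)
quad-sum-value ((c , p , r) ∷ ts) n = begin
  quad-sum (λ a b → (p a * r b) * c + quad-value ts a b) n
    ≡⟨ quad-sum-cong {λ a b → (p a * r b) * c + quad-value ts a b} {λ a b → c * (p a * r b) + quad-value ts a b}
         (λ a b → cong (_+ quad-value ts (suc a) (suc b)) (*-comm (p (suc a) * r (suc b)) c)) n ⟩
  quad-sum (λ a b → c * (p a * r b) + quad-value ts a b) n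
    ≡⟨ quad-sum-linear c (λ a b → p a * r b) (quad-value ts) n ⟩
  c * quad-sum (λ a b → p a * r b) n + quad-sum (quad-value ts) n
    ≡⟨ cong₂ _+_ (trans (cong (c *_) (sym (quad-sum-⊛ p r n))) (sym
      (const-⊛ c (𝒟 p ⊛ 𝒟 r) n))) (quad-sum-value ts n) ⟩
  quad-series ((c , p , r) ∷ ts) n
    ∎
  where open ≡-Reasoning

div-sum-value : ∀ ts → 𝒟 (lin-value ts) ≈ lin-series ts
div-sum-value []             n = trans (div-sum-zero n) (const-0 n)
div-sum-value ((c , p) ∷ ts) n = begin
  𝒟 (λ d → p d * c + lin-value ts d) n
    ≡⟨ div-sum-cong {λ d _ → p d * c + lin-value ts d} {λ d _ → c * p d + lin-value ts d}
         (λ d _ → cong (_+ lin-value ts (suc d)) (*-comm (p (suc d)) c)) n ⟩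
  𝒟 (λ d → c * p d + lin-value ts d) n
    ≡⟨ div-sum-linear c (λ d _ → p d) (λ d _ → lin-value ts d) n ⟩
  c * 𝒟 p n + 𝒟 (lin-value ts) n
    ≡⟨ cong₂ _+_ (sym (const-⊛ c (𝒟 p) n)) (div-sum-value ts n) ⟩
  lin-series ((c , p) ∷ ts) n
    ∎
  where open ≡-Reasoning

div-sum-∂ : ∀ p → div-sum (λ d x → + d * + x * p d) ≈ ∂ (𝒟 p)
div-sum-∂ p n = begin
  Σ₁ n (λ d → Σ₁ n λ x → + d * + x * p d * (q^ (d ℕ.* x)) n)
    ≡⟨ Σ₁-cong n (λ d → trans (Σ₁-cong n λ x → term (suc d) (suc x)) (Σ₁-* n (+ n) λ x
      → p (suc d) * (q^ (suc d ℕ.* x)) n)) ⟩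
  Σ₁ n (λ d → + n * Σ₁ n λ x → p d * (q^ (d ℕ.* x)) n)
    ≡⟨ Σ₁-* n (+ n) (λ d → Σ₁ n λ x → p d * (q^ (d ℕ.* x)) n) ⟩
  + n * 𝒟 p n
    ∎
  where
  open ≡-Reasoning
  term : ∀ d x → + d * + x * p d * (q^ (d ℕ.* x)) n ≡ + n * (p d * (q^ (d ℕ.* x)) n)
  term d x with d ℕ.* x ℕ.≟ n
  ... | yes refl = trans (*-assoc (+ d * + x) (p d) _) (cong (_* (p d * (q^ (d ℕ.* x)) (d ℕ.* x))) (sym (pos-* d x)))
  ... | no dx≢n  = trans (vanish (+ d * + x * p d)) (sym (trans (cong (+ n *_) (vanish (p d))) (*-zeroʳ (+ n))))
    where
    vanish : ∀ c → c * (q^ (d ℕ.* x)) n ≡ 0ℤ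
    vanish c = trans (cong (c *_) (q^-≢ (d ℕ.* x) n dx≢n)) (*-zeroʳ c)

-- The form `vs` collects what is proportional to the cofactor x: since d x = n wherever the
-- indicator is not zero, it contributes a derivative. The factor `K` clears the denominators in the
-- closed forms of the divisor kernel.
sum-identity : ∀ K ts vs us h φ → quad-sum h ≈ div-sum φ →
  (∀ a b → h a b * K ≡ quad-value ts a b) →
  (∀ d x → .{{ℕ.NonZero d}} → φ d x * K ≡ + d * + x * lin-value vs d + lin-value us d) →
  quad-series ts ≈ ∂ (lin-series vs) ⊕ lin-series us
sum-identity K ts vs us h φ identity h-eq φ-eq n = begin
  quad-series ts n
    ≡⟨ quad-sum-value ts n ⟨
  quad-sum (quad-value ts) n
    ≡⟨ quad-sum-cong {quad-value ts} {λ a b → K * h a b + 0ℤ}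
         (λ a b → trans (sym (h-eq (suc a) (suc b))) (trans (*-comm (h (suc a) (suc b)) K) (sym (+-identityʳ _)))) n ⟩
  quad-sum (λ a b → K * h a b + 0ℤ) n
    ≡⟨ trans (quad-sum-linear K h (λ _ _ → 0ℤ) n) (cong₂ (λ y z → K * y
      + z) (identity n) (trans (quad-sum-zero n) (sym (div-sum-zero n)))) ⟩
  K * div-sum φ n + div-sum (λ _ _ → 0ℤ) n
    ≡⟨ div-sum-linear K φ (λ _ _ → 0ℤ) n ⟨
  div-sum (λ d x → K * φ d x + 0ℤ) n
    ≡⟨ div-sum-cong {λ d x → K * φ d x + 0ℤ} {λ d x → 1ℤ * (+ d * + x * lin-value vs d) + lin-value us d}
         (λ d x → trans (+-identityʳ _) (trans (*-comm K (φ (suc d) (suc x))) (trans (φ-eq (suc d) (suc x))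
           (cong (_+ lin-value us (suc d)) (sym (*-identityˡ (+ suc d * + suc x * lin-value vs (suc d)))))))) n ⟩
  div-sum (λ d x → 1ℤ * (+ d * + x * lin-value vs d) + lin-value us d) n
    ≡⟨ div-sum-linear 1ℤ (λ d x → + d * + x * lin-value vs d) (λ d _ → lin-value us d) n ⟩
  1ℤ * div-sum (λ d x → + d * + x * lin-value vs d) n + 𝒟 (lin-value us) n
    ≡⟨ cong₂ _+_ (trans (*-identityˡ _) (trans (div-sum-∂ (lin-value vs) n)
      (cong (+ n *_) (div-sum-value vs n)))) (div-sum-value us n) ⟩
  ∂ (lin-series vs) n + lin-series us n
    ∎
  where open ≡-Reasoning

-- The sum telescopes: -(-1)ᵃ (P(a + 1) + P(a)) is the difference of (-1)ᵃ P(a) between a + 1 and a.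
-- The lower end a = 1 contributes `P 1ℤ` with a plus sign.
alternating-sum-closed : ∀ c (f P : ℤ → ℤ) → (∀ x → f x * c ≡ - (P (1ℤ + x) + P x)) →
  ∀ d → alternating-sum f (suc d) * c ≡ s (suc d) * P (+ suc d) + P 1ℤ
alternating-sum-closed c f P step zero    = trans (*-zeroˡ c)
  (solve! 1 (λ p → con 0ℤ := con -1ℤ :* con 1ℤ :* p :+ p) refl (P 1ℤ))
alternating-sum-closed c f P step (suc d) = begin
  Σ₁ (suc d) (λ a → s a * f (+ a)) * c
    ≡⟨ cong (_* c) (Σ₁-last d λ a → s a * f (+ a)) ⟩
  (A + s D * f (+ D)) * c
    ≡⟨ solve! 4 (λ a t e c → (a :+ t :* e) :* c := a :* c :+ t :* (e :* c)) refl A (s D) (f (+ D)) c ⟩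
  A * c + s D * (f (+ D) * c)
    ≡⟨ cong₂ (λ y z → y + s D * z) (alternating-sum-closed c f P step d) (step (+ D)) ⟩
  s D * P (+ D) + P 1ℤ + s D * - (P (+ suc D) + P (+ D))
    ≡⟨ solve! 4 (λ t p k p′ → t :* p :+ k :+ t :* :- (p′ :+ p) := con -1ℤ :* t :* p′ :+ k)
      refl (s D) (P (+ D)) (P 1ℤ) (P (+ suc D)) ⟩
  s (suc D) * P (+ suc D) + P 1ℤ
    ∎
  where
  open ≡-Reasoning
  D = suc d
  A = Σ₁ d (λ a → s a * f (+ a))

-- The parameter `e` is independent of the upper end so that induction goes through. At e = d + 1 =
-- D the value is D - D³.
Σ-a[a-e] : ∀ e d → Σ₁ d (λ a → + a * (+ a - e)) * + 6 ≡ + d * (1ℤ + + d) * (1ℤ + + d * + 2 - e * + 3)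
Σ-a[a-e] e zero    = refl
Σ-a[a-e] e (suc d) = begin
  Σ₁ (suc d) (λ a → + a * (+ a - e)) * + 6
    ≡⟨ cong (_* + 6) (Σ₁-last d λ a → + a * (+ a - e)) ⟩
  (Σ₁ d (λ a → + a * (+ a - e)) + + suc d * (+ suc d - e)) * + 6
    ≡⟨ *-distribʳ-+ (+ 6) (Σ₁ d λ a → + a * (+ a - e)) _ ⟩
  Σ₁ d (λ a → + a * (+ a - e)) * + 6 + + suc d * (+ suc d - e) * + 6
    ≡⟨ cong (_+ + suc d * (+ suc d - e) * + 6) (Σ-a[a-e] e d) ⟩
  + d * (1ℤ + + d) * (1ℤ + + d * + 2 - e * + 3) + + suc d * (+ suc d - e) * + 6
    ≡⟨ solve! 2 (λ d e → d :* (con 1ℤ :+ d) :* (con 1ℤ :+ d :* con (+ 2) :- e :* con (+ 3)) :+ (con 1ℤ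
      :+ d) :* (con 1ℤ :+ d :- e) :* con (+ 6)
                 := (con 1ℤ :+ d) :* (con 1ℤ :+ (con 1ℤ :+ d)) :* (con 1ℤ :+ (con 1ℤ :+ d) :* con (+ 2)
                   :- e :* con (+ 3))) refl (+ d) e ⟩
  + suc d * (1ℤ + + suc d) * (1ℤ + + suc d * + 2 - e * + 3)
    ∎
  where open ≡-Reasoning

even-divisor-kernel-closed : ∀ (E : ℤ → ℤ) E-even (P : ℤ → ℤ) → (∀ x → E x * + 2 ≡ - (P (1ℤ + x) + P x)) → ∀ d x
  → .{{_ : ℕ.NonZero d}} →
  let δ = + d; t = s (d) in
  even-divisor-kernel E E-even (d) x * 1ℤ ≡ (+ x - 1ℤ) * (E 0ℤ + t * E δ * + 2) - (t * P δ + P 1ℤ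
    + (δ - 1ℤ) * (t * E δ))
even-divisor-kernel-closed E E-even P P-step (suc d) x = begin
  even-divisor-kernel E E-even (suc d) x * 1ℤ
    ≡⟨ solve! 6 (λ x e t f a δ → (((x :- con 1ℤ) :* (e :+ con (+ 2) :* (t :* f)) :- (con (+ 2) :* a :+ (δ
      :- con 1ℤ) :* (t :* f)))) :* con 1ℤ
          := (x :- con 1ℤ) :* (e :+ t :* f :* con (+ 2)) :- (a :* con (+ 2) :+ (δ :- con 1ℤ) :* (t :* f))) refl
         (+ x) (E 0ℤ) (s (suc d)) (E (+ suc d)) A (+ suc d) ⟩
  (+ x - 1ℤ) * (E 0ℤ + s (suc d) * E (+ suc d) * + 2) - (A * + 2 + (+ suc d - 1ℤ) * (s (suc d) * E (+ suc d)))
    ≡⟨ cong (λ y → (+ x - 1ℤ) * (E 0ℤ + s (suc d) * E (+ suc d) * + 2) - (y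
      + (+ suc d - 1ℤ) * (s (suc d) * E (+ suc d))))
         (alternating-sum-closed (+ 2) E P P-step d) ⟩
  (+ x - 1ℤ) * (E 0ℤ + s (suc d) * E (+ suc d) * + 2) - (s (suc d) * P (+ suc d) + P 1ℤ
    + (+ suc d - 1ℤ) * (s (suc d) * E (+ suc d)))
    ∎
  where
  open ≡-Reasoning
  A = alternating-sum E (suc d)

-- The alternating sums are known after multiplication by 2 and by 16, the plain sum after
-- multiplication by 6, and the first two occur doubled. The least common multiplier is 24. The 16
-- reflects the scaling of the odd Euler polynomials by 8, which E₇ with its constant term 17/8
-- requires.
odd-divisor-kernel-closed : ∀ (E : ℤ → ℤ) E-even (P Q : ℤ → ℤ) → (∀ x → E x * + 2 ≡ - (P (1ℤ + x) + P x)) →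
  (∀ x → x * E x * + 16 ≡ - (Q (1ℤ + x) + Q x)) → ∀ d x → .{{_ : ℕ.NonZero d}} →
  let δ = + d; t = s (d) in
  odd-divisor-kernel E E-even (d) x * + 24
    ≡ (+ x - 1ℤ) * (δ * δ * E 0ℤ) * + 24
      - (δ * δ * (t * P δ + P 1ℤ) * + 24 - δ * (t * Q δ + Q 1ℤ) * + 3 + t * E δ * (δ - δ * δ * δ) * + 4)
odd-divisor-kernel-closed E E-even P Q P-step Q-step (suc d) x = begin
  odd-divisor-kernel E E-even (suc d) x * + 24
    ≡⟨ solve! 8 (λ x δ e t f a b c → ((x :- con 1ℤ) :* (δ :* δ :* e) :- (con (+ 2) :* δ :* (δ :* a :- b)
      :+ t :* f :* c)) :* con (+ 24)
          := (x :- con 1ℤ) :* (δ :* δ :* e) :* con (+ 24)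
             :- (δ :* δ :* (a :* con (+ 2)) :* con (+ 24) :- δ :* (b :* con (+ 16)) :* con (+ 3)
               :+ t :* f :* (c :* con (+ 6)) :* con (+ 4))) refl
         (+ x) (+ suc d) (E 0ℤ) (s (suc d)) (E (+ suc d)) A B C ⟩
  result (A * + 2) (B * + 16) (C * + 6)
    ≡⟨ cong₂ (λ y z → result y z (C * + 6)) (alternating-sum-closed (+ 2) E P P-step d) (alternating-sum-closed (+ 16)
      (λ y → y * E y) Q Q-step d) ⟩
  result (s (suc d) * P (+ suc d) + P 1ℤ) (s (suc d) * Q (+ suc d) + Q 1ℤ) (C * + 6)
    ≡⟨ cong (result (s (suc d) * P (+ suc d) + P 1ℤ) (s (suc d) * Q (+ suc d) + Q 1ℤ)) (trans (Σ-a[a-e] (+ suc d) d)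
         (solve! 1 (λ d → d :* (con 1ℤ :+ d) :* (con 1ℤ :+ d :* con (+ 2) :- (con 1ℤ :+ d) :* con (+ 3))
           := (con 1ℤ :+ d) :- (con 1ℤ :+ d) :* (con 1ℤ :+ d) :* (con 1ℤ :+ d)) refl (+ d))) ⟩
  result (s (suc d) * P (+ suc d) + P 1ℤ) (s (suc d) * Q (+ suc d) + Q 1ℤ) (+ suc d - + suc d * + suc d * + suc d)
    ∎
  where
  open ≡-Reasoning
  A = alternating-sum E (suc d)
  B = alternating-sum (λ y → y * E y) (suc d)
  C = Σ₁ d (λ a → + a * (+ a - + suc d))
  result : ℤ → ℤ → ℤ → ℤ
  result a b c = (+ x - 1ℤ) * (+ suc d * + suc d * E 0ℤ) * + 24
    - (+ suc d * + suc d * a * + 24 - + suc d * b * + 3 + s (suc d) * E (+ suc d) * c * + 4)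

-- Euler polynomials

κ : ℕ → ℤ
κ d = (+ d) ^ 1

-- eulerₜ is - Eₜ for even t and - 8 Eₜ for odd t, where Eₜ is the Euler polynomial,
-- Eₜ(x + 1) + Eₜ(x) = 2 xᵗ.
euler₀ : ℤ → ℤ
euler₀ x = -[1+ 0 ]

euler₀-step : ∀ x → x ^ 0 * + 2 ≡ - (euler₀ (1ℤ + x) + euler₀ x)
euler₀-step = solve! 1 (λ x → x :^ 0 :* con (+ 2) := :- ((con (-[1+ 0 ])) :+ (con (-[1+ 0 ])))) refl

euler₁ : ℤ → ℤ
euler₁ x = x ^ 1 * -[1+ 7 ] + + 4

euler₁-step : ∀ x → x * x ^ 0 * + 16 ≡ - (euler₁ (1ℤ + x) + euler₁ x)
euler₁-step = solve! 1 (λ x → x :* x :^ 0 :* con (+ 16) := :- (((con 1ℤ :+ x) :^ 1 :* con (-[1+ 7 ]) :+ con (+ 4))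
  :+ (x :^ 1 :* con (-[1+ 7 ]) :+ con (+ 4)))) refl

euler₂ : ℤ → ℤ
euler₂ x = x ^ 2 * -[1+ 0 ] + x ^ 1 * + 1

euler₂-step : ∀ x → x ^ 2 * + 2 ≡ - (euler₂ (1ℤ + x) + euler₂ x)
euler₂-step = solve! 1 (λ x → x :^ 2 :* con (+ 2) := :- (((con 1ℤ :+ x) :^ 2 :* con (-[1+ 0 ]) :+ (con 1ℤ
  :+ x) :^ 1 :* con (+ 1)) :+ (x :^ 2 :* con (-[1+ 0 ]) :+ x :^ 1 :* con (+ 1)))) refl

euler₃ : ℤ → ℤ
euler₃ x = x ^ 3 * -[1+ 7 ] + x ^ 2 * + 12 + -[1+ 1 ]

euler₃-step : ∀ x → x * x ^ 2 * + 16 ≡ - (euler₃ (1ℤ + x) + euler₃ x)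
euler₃-step = solve! 1 (λ x → x :* x :^ 2 :* con (+ 16) := :- (((con 1ℤ :+ x) :^ 3 :* con (-[1+ 7 ]) :+ (con 1ℤ
  :+ x) :^ 2 :* con (+ 12) :+ con (-[1+ 1 ])) :+ (x :^ 3 :* con (-[1+ 7 ]) :+ x :^ 2 :* con (+ 12)
  :+ con (-[1+ 1 ])))) refl

euler₄ : ℤ → ℤ
euler₄ x = x ^ 4 * -[1+ 0 ] + x ^ 3 * + 2 + x ^ 1 * -[1+ 0 ]

euler₄-step : ∀ x → x ^ 4 * + 2 ≡ - (euler₄ (1ℤ + x) + euler₄ x)
euler₄-step = solve! 1 (λ x → x :^ 4 :* con (+ 2) := :- (((con 1ℤ :+ x) :^ 4 :* con (-[1+ 0 ]) :+ (con 1ℤ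
  :+ x) :^ 3 :* con (+ 2) :+ (con 1ℤ :+ x) :^ 1 :* con (-[1+ 0 ])) :+ (x :^ 4 :* con (-[1+ 0 ]) :+ x :^ 3 :* con (+ 2)
  :+ x :^ 1 :* con (-[1+ 0 ])))) refl

euler₅ : ℤ → ℤ
euler₅ x = x ^ 5 * -[1+ 7 ] + x ^ 4 * + 20 + x ^ 2 * -[1+ 19 ] + + 4

euler₅-step : ∀ x → x * x ^ 4 * + 16 ≡ - (euler₅ (1ℤ + x) + euler₅ x)
euler₅-step = solve! 1 (λ x → x :* x :^ 4 :* con (+ 16) := :- (((con 1ℤ :+ x) :^ 5 :* con (-[1+ 7 ]) :+ (con 1ℤ
  :+ x) :^ 4 :* con (+ 20) :+ (con 1ℤ :+ x) :^ 2 :* con (-[1+ 19 ]) :+ con (+ 4)) :+ (x :^ 5 :* con (-[1+ 7 ])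
  :+ x :^ 4 :* con (+ 20) :+ x :^ 2 :* con (-[1+ 19 ]) :+ con (+ 4)))) refl

euler₆ : ℤ → ℤ
euler₆ x = x ^ 6 * -[1+ 0 ] + x ^ 5 * + 3 + x ^ 3 * -[1+ 4 ] + x ^ 1 * + 3

euler₆-step : ∀ x → x ^ 6 * + 2 ≡ - (euler₆ (1ℤ + x) + euler₆ x)
euler₆-step = solve! 1 (λ x → x :^ 6 :* con (+ 2) := :- (((con 1ℤ :+ x) :^ 6 :* con (-[1+ 0 ]) :+ (con 1ℤ
  :+ x) :^ 5 :* con (+ 3) :+ (con 1ℤ :+ x) :^ 3 :* con (-[1+ 4 ]) :+ (con 1ℤ :+ x) :^ 1 :* con (+ 3))
  :+ (x :^ 6 :* con (-[1+ 0 ]) :+ x :^ 5 :* con (+ 3) :+ x :^ 3 :* con (-[1+ 4 ]) :+ x :^ 1 :* con (+ 3)))) refl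

euler₇ : ℤ → ℤ
euler₇ x = x ^ 7 * -[1+ 7 ] + x ^ 6 * + 28 + x ^ 4 * -[1+ 69 ] + x ^ 2 * + 84 + -[1+ 16 ]

euler₇-step : ∀ x → x * x ^ 6 * + 16 ≡ - (euler₇ (1ℤ + x) + euler₇ x)
euler₇-step = solve! 1 (λ x → x :* x :^ 6 :* con (+ 16) := :- (((con 1ℤ :+ x) :^ 7 :* con (-[1+ 7 ]) :+ (con 1ℤ
  :+ x) :^ 6 :* con (+ 28) :+ (con 1ℤ :+ x) :^ 4 :* con (-[1+ 69 ]) :+ (con 1ℤ :+ x) :^ 2 :* con (+ 84)
  :+ con (-[1+ 16 ])) :+ (x :^ 7 :* con (-[1+ 7 ]) :+ x :^ 6 :* con (+ 28) :+ x :^ 4 :* con (-[1+ 69 ])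
  :+ x :^ 2 :* con (+ 84) :+ con (-[1+ 16 ])))) refl

euler₈ : ℤ → ℤ
euler₈ x = x ^ 8 * -[1+ 0 ] + x ^ 7 * + 4 + x ^ 5 * -[1+ 13 ] + x ^ 3 * + 28 + x ^ 1 * -[1+ 16 ]

euler₈-step : ∀ x → x ^ 8 * + 2 ≡ - (euler₈ (1ℤ + x) + euler₈ x)
euler₈-step = solve! 1 (λ x → x :^ 8 :* con (+ 2) := :- (((con 1ℤ :+ x) :^ 8 :* con (-[1+ 0 ]) :+ (con 1ℤ
  :+ x) :^ 7 :* con (+ 4) :+ (con 1ℤ :+ x) :^ 5 :* con (-[1+ 13 ]) :+ (con 1ℤ :+ x) :^ 3 :* con (+ 28) :+ (con 1ℤ
  :+ x) :^ 1 :* con (-[1+ 16 ])) :+ (x :^ 8 :* con (-[1+ 0 ]) :+ x :^ 7 :* con (+ 4) :+ x :^ 5 :* con (-[1+ 13 ])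
  :+ x :^ 3 :* con (+ 28) :+ x :^ 1 :* con (-[1+ 16 ])))) refl

euler₉ : ℤ → ℤ
euler₉ x = x ^ 9 * -[1+ 7 ] + x ^ 8 * + 36 + x ^ 6 * -[1+ 167 ] + x ^ 4 * + 504 + x ^ 2 * -[1+ 611 ] + + 124

euler₉-step : ∀ x → x * x ^ 8 * + 16 ≡ - (euler₉ (1ℤ + x) + euler₉ x)
euler₉-step = solve! 1 (λ x → x :* x :^ 8 :* con (+ 16) := :- (((con 1ℤ :+ x) :^ 9 :* con (-[1+ 7 ]) :+ (con 1ℤ
  :+ x) :^ 8 :* con (+ 36) :+ (con 1ℤ :+ x) :^ 6 :* con (-[1+ 167 ]) :+ (con 1ℤ :+ x) :^ 4 :* con (+ 504) :+ (con 1ℤ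
  :+ x) :^ 2 :* con (-[1+ 611 ]) :+ con (+ 124)) :+ (x :^ 9 :* con (-[1+ 7 ]) :+ x :^ 8 :* con (+ 36)
  :+ x :^ 6 :* con (-[1+ 167 ]) :+ x :^ 4 :* con (+ 504) :+ x :^ 2 :* con (-[1+ 611 ]) :+ con (+ 124)))) refl

^₀-even : ∀ x → (- x) ^ 0 ≡ x ^ 0
^₀-even = solve! 1 (λ x → (:- x) :^ 0 := x :^ 0) refl

^₂-even : ∀ x → (- x) ^ 2 ≡ x ^ 2
^₂-even = solve! 1 (λ x → (:- x) :^ 2 := x :^ 2) refl

^₄-even : ∀ x → (- x) ^ 4 ≡ x ^ 4
^₄-even = solve! 1 (λ x → (:- x) :^ 4 := x :^ 4) refl

^₆-even : ∀ x → (- x) ^ 6 ≡ x ^ 6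
^₆-even = solve! 1 (λ x → (:- x) :^ 6 := x :^ 6) refl

^₈-even : ∀ x → (- x) ^ 8 ≡ x ^ 8
^₈-even = solve! 1 (λ x → (:- x) :^ 8 := x :^ 8) refl

-- Convolution identities in low degree

even-identity₂ : quad-series ((-[1+ 3 ] , θ 1 , θ 1) ∷ [])
  ≈ ∂ (lin-series ((+ 2 , θ 1) ∷ [])) ⊕ lin-series ((-[1+ 0 ] , θ 1) ∷ (-[1+ 0 ] , θ 3) ∷ [])
even-identity₂ = sum-identity (+ 1)
  ((-[1+ 3 ] , θ 1 , θ 1) ∷ [])
  ((+ 2 , θ 1) ∷ [])
  ((-[1+ 0 ] , θ 1) ∷ (-[1+ 0 ] , θ 3) ∷ [])
  (even-kernel (_^ 2) ^₂-even) (even-divisor-kernel (_^ 2) ^₂-even)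
  (even-identity (_^ 2) ^₂-even)
  (λ a b → solve! 4 (λ s t x y → (s :* t :* ((x :- y) :^ 2 :- (x :+ y) :^ 2)) :* con 1ℤ
    := (((s :* x :^ 1) :* (t :* y :^ 1)) :* con (-[1+ 3 ]) :+ con 0ℤ)) refl (s a) (s b) (+ a) (+ b))
  -- In the solver call below, `con 0ℤ` next to the doubled power is the value of `E 0ℤ`, and the
  -- isolated `con (+ 0)` is the value of `euler₂ 1ℤ`. The literals in the later identities arise in
  -- the same way.
  (λ d x → trans (even-divisor-kernel-closed (_^ 2) ^₂-even euler₂ euler₂-step d x)
    (solve! 3 (λ s d x → (x :- con 1ℤ) :* (con 0ℤ :+ s :* d :^ 2 :* con (+ 2)) :- (s :* (d :^ 2 :* con (-[1+ 0 ])
      :+ d :^ 1 :* con (+ 1)) :+ con (+ 0) :+ (d :- con 1ℤ) :* (s :* d :^ 2)) := d :* x :* ((s :* d :^ 1) :* con (+ 2)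
      :+ con 0ℤ) :+ ((s :* d :^ 1) :* con (-[1+ 0 ]) :+ ((s :* d :^ 3) :* con (-[1+ 0 ]) :+ con 0ℤ)))
      refl (s d) (+ d) (+ x)))

even-identity₄ : quad-series ((-[1+ 7 ] , θ 1 , θ 3) ∷ (-[1+ 7 ] , θ 3 , θ 1) ∷ [])
  ≈ ∂ (lin-series ((+ 2 , θ 3) ∷ [])) ⊕ lin-series ((-[1+ 1 ] , θ 3) ∷ (-[1+ 0 ] , θ 5) ∷ (+ 1 , θ 1) ∷ [])
even-identity₄ = sum-identity (+ 1)
  ((-[1+ 7 ] , θ 1 , θ 3) ∷ (-[1+ 7 ] , θ 3 , θ 1) ∷ [])
  ((+ 2 , θ 3) ∷ [])
  ((-[1+ 1 ] , θ 3) ∷ (-[1+ 0 ] , θ 5) ∷ (+ 1 , θ 1) ∷ [])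
  (even-kernel (_^ 4) ^₄-even) (even-divisor-kernel (_^ 4) ^₄-even)
  (even-identity (_^ 4) ^₄-even)
  (λ a b → solve! 4 (λ s t x y → (s :* t :* ((x :- y) :^ 4 :- (x :+ y) :^ 4)) :* con 1ℤ
    := (((s :* x :^ 1) :* (t :* y :^ 3)) :* con (-[1+ 7 ]) :+ (((s :* x :^ 3) :* (t :* y :^ 1)) :* con (-[1+ 7 ])
    :+ con 0ℤ))) refl (s a) (s b) (+ a) (+ b))
  (λ d x → trans (even-divisor-kernel-closed (_^ 4) ^₄-even euler₄ euler₄-step d x)
    (solve! 3 (λ s d x → (x :- con 1ℤ) :* (con 0ℤ :+ s :* d :^ 4 :* con (+ 2)) :- (s :* (d :^ 4 :* con (-[1+ 0 ])
      :+ d :^ 3 :* con (+ 2) :+ d :^ 1 :* con (-[1+ 0 ])) :+ con (+ 0) :+ (d :- con 1ℤ) :* (s :* d :^ 4))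
      := d :* x :* ((s :* d :^ 3) :* con (+ 2) :+ con 0ℤ) :+ ((s :* d :^ 3) :* con (-[1+ 1 ])
      :+ ((s :* d :^ 5) :* con (-[1+ 0 ]) :+ ((s :* d :^ 1) :* con (+ 1) :+ con 0ℤ)))) refl (s d) (+ d) (+ x)))

odd-identity₀ : quad-series ((+ 48 , θ 1 , θ 1) ∷ (-[1+ 47 ] , θ 1 , κ) ∷ (-[1+ 47 ] , κ , θ 1) ∷ [])
  ≈ ∂ (lin-series ((+ 24 , κ) ∷ [])) ⊕ lin-series ((-[1+ 11 ] , κ) ∷ (+ 8 , θ 1) ∷ (+ 4 , θ 3) ∷ [])
odd-identity₀ = sum-identity (+ 24)
  ((+ 48 , θ 1 , θ 1) ∷ (-[1+ 47 ] , θ 1 , κ) ∷ (-[1+ 47 ] , κ , θ 1) ∷ [])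
  ((+ 24 , κ) ∷ [])
  ((-[1+ 11 ] , κ) ∷ (+ 8 , θ 1) ∷ (+ 4 , θ 3) ∷ [])
  (odd-kernel (_^ 0) ^₀-even) (odd-divisor-kernel (_^ 0) ^₀-even)
  (odd-identity (_^ 0) ^₀-even)
  (λ a b → solve! 4 (λ s t x y → (s :* t :* (x :* y) :* ((x :- y) :^ 0 :+ (x :+ y) :^ 0)
    :- con (+ 2) :* (x :* y) :* (s :* x :^ 0 :+ t :* y :^ 0)) :* con (+ 24)
    := (((s :* x :^ 1) :* (t :* y :^ 1)) :* con (+ 48) :+ (((s :* x :^ 1) :* (y :^ 1)) :* con (-[1+ 47 ])
    :+ (((x :^ 1) :* (t :* y :^ 1)) :* con (-[1+ 47 ]) :+ con 0ℤ)))) refl (s a) (s b) (+ a) (+ b))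
  (λ d x → trans (odd-divisor-kernel-closed (_^ 0) ^₀-even euler₀ euler₁ euler₀-step euler₁-step d x)
    (solve! 3 (λ s d x → (x :- con 1ℤ) :* (d :* d :* con (+ 1)) :* con (+ 24) :- (d :* d :* (s :* (con (-[1+ 0 ]))
      :+ con (-[1+ 0 ])) :* con (+ 24) :- d :* (s :* (d :^ 1 :* con (-[1+ 7 ]) :+ con (+ 4))
      :+ con (-[1+ 3 ])) :* con (+ 3) :+ s :* d :^ 0 :* (d :- d :* d :* d) :* con (+ 4))
      := d :* x :* ((d :^ 1) :* con (+ 24) :+ con 0ℤ) :+ ((d :^ 1) :* con (-[1+ 11 ]) :+ ((s :* d :^ 1) :* con (+ 8)
      :+ ((s :* d :^ 3) :* con (+ 4) :+ con 0ℤ)))) refl (s d) (+ d) (+ x)))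

-- Here and in the higher degrees `κ` enters only through the difference of `κ` and `θ 1`, that is,
-- through e: the products carry 48 and -48, and the linear coefficients are plus and minus three
-- times the value at 1 of the scaled odd Euler polynomial, here 6 = 3 · 2.
odd-identity₂ : quad-series
  ((+ 48 , θ 1 , θ 3) ∷ (+ 48 , θ 3 , θ 1) ∷ (-[1+ 47 ] , θ 3 , κ) ∷ (-[1+ 47 ] , κ , θ 3) ∷ [])
  ≈ ∂ (lin-series []) ⊕ lin-series ((+ 6 , κ) ∷ (-[1+ 5 ] , θ 1) ∷ (+ 8 , θ 3) ∷ (+ 4 , θ 5) ∷ [])
odd-identity₂ = sum-identity (+ 24)
  ((+ 48 , θ 1 , θ 3) ∷ (+ 48 , θ 3 , θ 1) ∷ (-[1+ 47 ] , θ 3 , κ) ∷ (-[1+ 47 ] , κ , θ 3) ∷ [])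
  []
  ((+ 6 , κ) ∷ (-[1+ 5 ] , θ 1) ∷ (+ 8 , θ 3) ∷ (+ 4 , θ 5) ∷ [])
  (odd-kernel (_^ 2) ^₂-even) (odd-divisor-kernel (_^ 2) ^₂-even)
  (odd-identity (_^ 2) ^₂-even)
  (λ a b → solve! 4 (λ s t x y → (s :* t :* (x :* y) :* ((x :- y) :^ 2 :+ (x :+ y) :^ 2)
    :- con (+ 2) :* (x :* y) :* (s :* x :^ 2 :+ t :* y :^ 2)) :* con (+ 24)
    := (((s :* x :^ 1) :* (t :* y :^ 3)) :* con (+ 48) :+ (((s :* x :^ 3) :* (t :* y :^ 1)) :* con (+ 48)
    :+ (((s :* x :^ 3) :* (y :^ 1)) :* con (-[1+ 47 ]) :+ (((x :^ 1) :* (t :* y :^ 3)) :* con (-[1+ 47 ])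
    :+ con 0ℤ))))) refl (s a) (s b) (+ a) (+ b))
  (λ d x → trans (odd-divisor-kernel-closed (_^ 2) ^₂-even euler₂ euler₃ euler₂-step euler₃-step d x)
    (solve! 3 (λ s d x → (x :- con 1ℤ) :* (d :* d :* con (+ 0)) :* con (+ 24)
      :- (d :* d :* (s :* (d :^ 2 :* con (-[1+ 0 ]) :+ d :^ 1 :* con (+ 1)) :+ con (+ 0)) :* con (+ 24)
      :- d :* (s :* (d :^ 3 :* con (-[1+ 7 ]) :+ d :^ 2 :* con (+ 12) :+ con (-[1+ 1 ])) :+ con (+ 2)) :* con (+ 3)
      :+ s :* d :^ 2 :* (d :- d :* d :* d) :* con (+ 4)) := d :* x :* con 0ℤ :+ ((d :^ 1) :* con (+ 6)
      :+ ((s :* d :^ 1) :* con (-[1+ 5 ]) :+ ((s :* d :^ 3) :* con (+ 8) :+ ((s :* d :^ 5) :* con (+ 4) :+ con 0ℤ)))))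
      refl (s d) (+ d) (+ x)))

odd-identity₄ : quad-series
  ((+ 48 , θ 1 , θ 5) ∷ (+ 288 , θ 3 , θ 3) ∷ (+ 48 , θ 5 , θ 1) ∷ (-[1+ 47 ] , θ 5 , κ) ∷ (-[1+ 47 ] , κ , θ 5) ∷ [])
  ≈ ∂ (lin-series []) ⊕ lin-series
    ((-[1+ 11 ] , κ) ∷ (+ 12 , θ 1) ∷ (-[1+ 35 ] , θ 3) ∷ (+ 8 , θ 5) ∷ (+ 4 , θ 7) ∷ [])
odd-identity₄ = sum-identity (+ 24)
  ((+ 48 , θ 1 , θ 5) ∷ (+ 288 , θ 3 , θ 3) ∷ (+ 48 , θ 5 , θ 1) ∷ (-[1+ 47 ] , θ 5 , κ) ∷ (-[1+ 47 ] , κ , θ 5) ∷ [])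
  []
  ((-[1+ 11 ] , κ) ∷ (+ 12 , θ 1) ∷ (-[1+ 35 ] , θ 3) ∷ (+ 8 , θ 5) ∷ (+ 4 , θ 7) ∷ [])
  (odd-kernel (_^ 4) ^₄-even) (odd-divisor-kernel (_^ 4) ^₄-even)
  (odd-identity (_^ 4) ^₄-even)
  (λ a b → solve! 4 (λ s t x y → (s :* t :* (x :* y) :* ((x :- y) :^ 4 :+ (x :+ y) :^ 4)
    :- con (+ 2) :* (x :* y) :* (s :* x :^ 4 :+ t :* y :^ 4)) :* con (+ 24)
    := (((s :* x :^ 1) :* (t :* y :^ 5)) :* con (+ 48) :+ (((s :* x :^ 3) :* (t :* y :^ 3)) :* con (+ 288)
    :+ (((s :* x :^ 5) :* (t :* y :^ 1)) :* con (+ 48) :+ (((s :* x :^ 5) :* (y :^ 1)) :* con (-[1+ 47 ])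
    :+ (((x :^ 1) :* (t :* y :^ 5)) :* con (-[1+ 47 ]) :+ con 0ℤ)))))) refl (s a) (s b) (+ a) (+ b))
  (λ d x → trans (odd-divisor-kernel-closed (_^ 4) ^₄-even euler₄ euler₅ euler₄-step euler₅-step d x)
    (solve! 3 (λ s d x → (x :- con 1ℤ) :* (d :* d :* con (+ 0)) :* con (+ 24)
      :- (d :* d :* (s :* (d :^ 4 :* con (-[1+ 0 ]) :+ d :^ 3 :* con (+ 2) :+ d :^ 1 :* con (-[1+ 0 ]))
      :+ con (+ 0)) :* con (+ 24) :- d :* (s :* (d :^ 5 :* con (-[1+ 7 ]) :+ d :^ 4 :* con (+ 20)
      :+ d :^ 2 :* con (-[1+ 19 ]) :+ con (+ 4)) :+ con (-[1+ 3 ])) :* con (+ 3) :+ s :* d :^ 4 :* (d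
      :- d :* d :* d) :* con (+ 4)) := d :* x :* con 0ℤ :+ ((d :^ 1) :* con (-[1+ 11 ])
      :+ ((s :* d :^ 1) :* con (+ 12) :+ ((s :* d :^ 3) :* con (-[1+ 35 ]) :+ ((s :* d :^ 5) :* con (+ 8)
      :+ ((s :* d :^ 7) :* con (+ 4) :+ con 0ℤ)))))) refl (s d) (+ d) (+ x)))

odd-identity₆ : quad-series
  ((+ 48 , θ 1 , θ 7) ∷ (+ 720 , θ 3 , θ 5) ∷ (+ 720 , θ 5 , θ 3) ∷ (+ 48 , θ 7 , θ 1) ∷ (-[1+ 47 ] , θ 7 , κ) ∷ (-[1+ 47 ] , κ , θ 7) ∷ [])
  ≈ ∂ (lin-series []) ⊕ lin-series
    ((+ 51 , κ) ∷ (-[1+ 50 ] , θ 1) ∷ (+ 180 , θ 3) ∷ (-[1+ 89 ] , θ 5) ∷ (+ 8 , θ 7) ∷ (+ 4 , θ 9) ∷ [])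
odd-identity₆ = sum-identity (+ 24)
  ((+ 48 , θ 1 , θ 7) ∷ (+ 720 , θ 3 , θ 5) ∷ (+ 720 , θ 5 , θ 3) ∷ (+ 48 , θ 7 , θ 1) ∷ (-[1+ 47 ] , θ 7 , κ) ∷ (-[1+ 47 ] , κ , θ 7) ∷ [])
  []
  ((+ 51 , κ) ∷ (-[1+ 50 ] , θ 1) ∷ (+ 180 , θ 3) ∷ (-[1+ 89 ] , θ 5) ∷ (+ 8 , θ 7) ∷ (+ 4 , θ 9) ∷ [])
  (odd-kernel (_^ 6) ^₆-even) (odd-divisor-kernel (_^ 6) ^₆-even)
  (odd-identity (_^ 6) ^₆-even)
  (λ a b → solve! 4 (λ s t x y → (s :* t :* (x :* y) :* ((x :- y) :^ 6 :+ (x :+ y) :^ 6)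
    :- con (+ 2) :* (x :* y) :* (s :* x :^ 6 :+ t :* y :^ 6)) :* con (+ 24)
    := (((s :* x :^ 1) :* (t :* y :^ 7)) :* con (+ 48) :+ (((s :* x :^ 3) :* (t :* y :^ 5)) :* con (+ 720)
    :+ (((s :* x :^ 5) :* (t :* y :^ 3)) :* con (+ 720) :+ (((s :* x :^ 7) :* (t :* y :^ 1)) :* con (+ 48)
    :+ (((s :* x :^ 7) :* (y :^ 1)) :* con (-[1+ 47 ]) :+ (((x :^ 1) :* (t :* y :^ 7)) :* con (-[1+ 47 ])
    :+ con 0ℤ))))))) refl (s a) (s b) (+ a) (+ b))
  (λ d x → trans (odd-divisor-kernel-closed (_^ 6) ^₆-even euler₆ euler₇ euler₆-step euler₇-step d x)
    (solve! 3 (λ s d x → (x :- con 1ℤ) :* (d :* d :* con (+ 0)) :* con (+ 24)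
      :- (d :* d :* (s :* (d :^ 6 :* con (-[1+ 0 ]) :+ d :^ 5 :* con (+ 3) :+ d :^ 3 :* con (-[1+ 4 ])
      :+ d :^ 1 :* con (+ 3)) :+ con (+ 0)) :* con (+ 24) :- d :* (s :* (d :^ 7 :* con (-[1+ 7 ])
      :+ d :^ 6 :* con (+ 28) :+ d :^ 4 :* con (-[1+ 69 ]) :+ d :^ 2 :* con (+ 84) :+ con (-[1+ 16 ]))
      :+ con (+ 17)) :* con (+ 3) :+ s :* d :^ 6 :* (d :- d :* d :* d) :* con (+ 4)) := d :* x :* con 0ℤ
      :+ ((d :^ 1) :* con (+ 51) :+ ((s :* d :^ 1) :* con (-[1+ 50 ]) :+ ((s :* d :^ 3) :* con (+ 180)
      :+ ((s :* d :^ 5) :* con (-[1+ 89 ]) :+ ((s :* d :^ 7) :* con (+ 8) :+ ((s :* d :^ 9) :* con (+ 4)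
      :+ con 0ℤ))))))) refl (s d) (+ d) (+ x)))

odd-identity₈ : quad-series
  ((+ 48 , θ 1 , θ 9) ∷ (+ 1344 , θ 3 , θ 7) ∷ (+ 3360 , θ 5 , θ 5) ∷ (+ 1344 , θ 7 , θ 3) ∷ (+ 48 , θ 9 , θ 1) ∷ (-[1+ 47 ] , θ 9 , κ) ∷ (-[1+ 47 ] , κ , θ 9) ∷ [])
  ≈ ∂ (lin-series []) ⊕ lin-series
    ((-[1+ 371 ] , κ) ∷ (+ 372 , θ 1) ∷ (-[1+ 1427 ] , θ 3) ∷ (+ 840 , θ 5) ∷ (-[1+ 167 ] , θ 7) ∷ (+ 8 , θ 9) ∷ (+ 4 , θ 11) ∷ [])
odd-identity₈ = sum-identity (+ 24)
  ((+ 48 , θ 1 , θ 9) ∷ (+ 1344 , θ 3 , θ 7) ∷ (+ 3360 , θ 5 , θ 5) ∷ (+ 1344 , θ 7 , θ 3) ∷ (+ 48 , θ 9 , θ 1) ∷ (-[1+ 47 ] , θ 9 , κ) ∷ (-[1+ 47 ] , κ , θ 9) ∷ [])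
  []
  ((-[1+ 371 ] , κ) ∷ (+ 372 , θ 1) ∷ (-[1+ 1427 ] , θ 3) ∷ (+ 840 , θ 5) ∷ (-[1+ 167 ] , θ 7) ∷ (+ 8 , θ 9) ∷ (+ 4 , θ 11) ∷ [])
  (odd-kernel (_^ 8) ^₈-even) (odd-divisor-kernel (_^ 8) ^₈-even)
  (odd-identity (_^ 8) ^₈-even)
  (λ a b → solve! 4 (λ s t x y → (s :* t :* (x :* y) :* ((x :- y) :^ 8 :+ (x :+ y) :^ 8)
    :- con (+ 2) :* (x :* y) :* (s :* x :^ 8 :+ t :* y :^ 8)) :* con (+ 24)
    := (((s :* x :^ 1) :* (t :* y :^ 9)) :* con (+ 48) :+ (((s :* x :^ 3) :* (t :* y :^ 7)) :* con (+ 1344)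
    :+ (((s :* x :^ 5) :* (t :* y :^ 5)) :* con (+ 3360) :+ (((s :* x :^ 7) :* (t :* y :^ 3)) :* con (+ 1344)
    :+ (((s :* x :^ 9) :* (t :* y :^ 1)) :* con (+ 48) :+ (((s :* x :^ 9) :* (y :^ 1)) :* con (-[1+ 47 ])
    :+ (((x :^ 1) :* (t :* y :^ 9)) :* con (-[1+ 47 ]) :+ con 0ℤ)))))))) refl (s a) (s b) (+ a) (+ b))
  (λ d x → trans (odd-divisor-kernel-closed (_^ 8) ^₈-even euler₈ euler₉ euler₈-step euler₉-step d x)
    (solve! 3 (λ s d x → (x :- con 1ℤ) :* (d :* d :* con (+ 0)) :* con (+ 24)
      :- (d :* d :* (s :* (d :^ 8 :* con (-[1+ 0 ]) :+ d :^ 7 :* con (+ 4) :+ d :^ 5 :* con (-[1+ 13 ])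
      :+ d :^ 3 :* con (+ 28) :+ d :^ 1 :* con (-[1+ 16 ])) :+ con (+ 0)) :* con (+ 24)
      :- d :* (s :* (d :^ 9 :* con (-[1+ 7 ]) :+ d :^ 8 :* con (+ 36) :+ d :^ 6 :* con (-[1+ 167 ])
      :+ d :^ 4 :* con (+ 504) :+ d :^ 2 :* con (-[1+ 611 ]) :+ con (+ 124)) :+ con (-[1+ 123 ])) :* con (+ 3)
      :+ s :* d :^ 8 :* (d :- d :* d :* d) :* con (+ 4)) := d :* x :* con 0ℤ :+ ((d :^ 1) :* con (-[1+ 371 ])
      :+ ((s :* d :^ 1) :* con (+ 372) :+ ((s :* d :^ 3) :* con (-[1+ 1427 ]) :+ ((s :* d :^ 5) :* con (+ 840)
      :+ ((s :* d :^ 7) :* con (-[1+ 167 ]) :+ ((s :* d :^ 9) :* con (+ 8) :+ ((s :* d :^ 11) :* con (+ 4)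
      :+ con 0ℤ)))))))) refl (s d) (+ d) (+ x)))

-- Logarithmic derivatives

∂-cong : ∀ {f g} → f ≈ g → ∂ f ≈ ∂ g
∂-cong eq n = cong (+ n *_) (eq n)

∂-⊕ : ∀ f g → ∂ (f ⊕ g) ≈ ∂ f ⊕ ∂ g
∂-⊕ f g n = *-distribˡ-+ (+ n) (f n) (g n)

∂-const : ∀ c → ∂ (constₛ c) ≈ 0ₛ
∂-const c zero    = *-zeroˡ c
∂-const c (suc n) = *-zeroʳ (+ suc n)

∂-⊛ : ∀ f g → ∂ (f ⊛ g) ≈ ∂ f ⊛ g ⊕ f ⊛ ∂ g
∂-⊛ f g n = begin
  + n * (f ⊛ g) n
    ≡⟨ *-distribˡ-sum {suc n} (+ n) (λ i → f (toℕ i) * g (n ∸ toℕ i)) ⟩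
  ∑[ i < suc n ] (+ n * (f (toℕ i) * g (n ∸ toℕ i)))
    ≡⟨ sum-cong-≗ {suc n} (λ i → trans (cong (λ m → m * (f (toℕ i) * g (n ∸ toℕ i))) (split (toℕ i) (toℕ≤pred[n] i)))
         (solve! 4 (λ a b x y → (a :+ b) :* (x :* y) := a :* x :* y :+ x :* (b :* y))
           refl (+ toℕ i) (+ (n ∸ toℕ i)) (f (toℕ i)) (g (n ∸ toℕ i)))) ⟩
  ∑[ i < suc n ] (∂ f (toℕ i) * g (n ∸ toℕ i) + f (toℕ i) * ∂ g (n ∸ toℕ i))
    ≡⟨ ∑-distrib-+ {suc n} (λ i → ∂ f (toℕ i) * g (n ∸ toℕ i)) (λ i → f (toℕ i) * ∂ g (n ∸ toℕ i)) ⟩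
  (∂ f ⊛ g) n + (f ⊛ ∂ g) n
    ∎
  where
  open ≡-Reasoning
  split : ∀ i → i ≤ n → + n ≡ + i + + (n ∸ i)
  split i i≤n = cong +_ (sym (ℕₚ.m+[n∸m]≡n i≤n))

-- Stated without division, the relation is additive under products and, for a fixed `P`, linear in
-- `f`.
HasLogDerivative : Series → Series → Set
HasLogDerivative f P = ∂ f ≈ f ⊛ P

logDerivative-⊛ : ∀ {f g P Q} → HasLogDerivative f P → HasLogDerivative g Q → HasLogDerivative (f ⊛ g) (P ⊕ Q)
logDerivative-⊛ {f} {g} {P} {Q} p q n = begin
  ∂ (f ⊛ g) n                          ≡⟨ ∂-⊛ f g n ⟩
  (∂ f ⊛ g) n + (f ⊛ ∂ g) n            ≡⟨ cong₂ _+_ (⊛-cong {∂ f} {f ⊛ P} {g} p (λ _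
    → refl) n) (⊛-cong {f} {f} {∂ g} {g ⊛ Q} (λ _ → refl) q n) ⟩
  (f ⊛ P ⊛ g) n + (f ⊛ (g ⊛ Q)) n      ≡⟨ Series-Solver.solve! 4 (λ f g P Q
    → f ∙ P ∙ g ⊞ f ∙ (g ∙ Q) Series-Solver.:= f ∙ g ∙ (P ⊞ Q)) refl f g P Q n ⟩
  (f ⊛ g ⊛ (P ⊕ Q)) n                  ∎
  where
  open ≡-Reasoning
  open Series-Solver using () renaming (_:*_ to infixl 8 _∙_; _:+_ to infixl 7 _⊞_)

1ₛ-logDerivative : HasLogDerivative 1ₛ 0ₛ
1ₛ-logDerivative n = trans (trans (∂-cong 1ₛ≈const n) (∂-const 1ℤ n)) (sym (1ₛ-⊛ 0ₛ n))

^-logDerivative : ∀ {f P} k → HasLogDerivative f P → HasLogDerivative (f ^ₛ k) (scale (+ k) P)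
^-logDerivative {f} {P} zero    p n = trans (1ₛ-logDerivative n) (⊛-cong {1ₛ} {1ₛ} {0ₛ} (λ _ → refl) (λ m
  → sym (*-zeroˡ (P m))) n)
^-logDerivative {f} {P} (suc k) p n = trans (logDerivative-⊛ {f} {f ^ₛ k} p (^-logDerivative k p) n)
  (⊛-cong {f ^ₛ suc k} {f ^ₛ suc k} (λ _ → refl) (λ m → sym (suc-* (+ k) (P m))) n)

-- For r > 0 this is r qʳ / (1 - qʳ): exponents r x with x > n lie beyond n. Summed over r it gives
-- the series of σ₁.
geometric : ℕ → Series
geometric r n = Σ₁ n λ x → κ r * (q^ (r ℕ.* x)) n

∂-q^ : ∀ r → ∂ (q^ r) ≈ scale (+ r) (q^ r)
∂-q^ r n with r ℕ.≟ n
... | yes refl = refl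
... | no r≢n   = trans (vanish (+ n)) (sym (vanish (+ r)))
  where
  vanish : ∀ c → c * (q^ r) n ≡ 0ℤ
  vanish c = trans (cong (c *_) (q^-≢ r n r≢n)) (*-zeroʳ c)

geometric-telescopes : ∀ r N n → ((1ₛ ⊖ q^ r) ⊛ (λ m → Σ₁ N λ x → κ r * (q^ (r ℕ.* x)) m)) n
                                ≡ κ r * ((q^ r) n - (q^ (r ℕ.* suc N)) n)
geometric-telescopes r N n = begin
  ((1ₛ ⊖ q^ r) ⊛ (λ m → Σ₁ N λ x → scale (κ r) (q^ (r ℕ.* x)) m)) n
    ≡⟨ ⊛-Σ₁ N (λ x → scale (κ r) (q^ (r ℕ.* x))) (1ₛ ⊖ q^ r) n ⟩
  Σ₁ N (λ x → ((1ₛ ⊖ q^ r) ⊛ scale (κ r) (q^ (r ℕ.* x))) n)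
    ≡⟨ Σ₁-cong N (λ x → trans (⊛-scale (κ r) (q^ (r ℕ.* suc x)) (1ₛ ⊖ q^ r) n) (cong (κ r *_) (step (suc x)))) ⟩
  Σ₁ N (λ x → κ r * ((q^ (r ℕ.* x)) n - (q^ (r ℕ.* suc x)) n))
    ≡⟨ Σ₁-* N (κ r) (λ x → (q^ (r ℕ.* x)) n - (q^ (r ℕ.* suc x)) n) ⟩
  κ r * Σ₁ N (λ x → (q^ (r ℕ.* x)) n - (q^ (r ℕ.* suc x)) n)
    ≡⟨ cong (κ r *_) (telescope (λ x → (q^ (r ℕ.* x)) n) N) ⟩
  κ r * ((q^ (r ℕ.* 1)) n - (q^ (r ℕ.* suc N)) n)
    ≡⟨ cong (λ m → κ r * ((q^ m) n - (q^ (r ℕ.* suc N)) n)) (ℕₚ.*-identityʳ r) ⟩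
  κ r * ((q^ r) n - (q^ (r ℕ.* suc N)) n)
    ∎
  where
  open ≡-Reasoning
  telescope : ∀ (f : ℕ → ℤ) N → Σ₁ N (λ x → f x - f (suc x)) ≡ f 1 - f (suc N)
  telescope f zero    = sym (+-inverseʳ (f 1))
  telescope f (suc N) = trans (Σ₁-last N λ x → f x - f (suc x)) (trans (cong (_+ (f (suc N)
    - f (2 ℕ.+ N))) (telescope f N))
    (solve! 3 (λ a b c → a :- b :+ (b :- c) := a :- c) refl (f 1) (f (suc N)) (f (2 ℕ.+ N))))
  step : ∀ x → ((1ₛ ⊖ q^ r) ⊛ q^ (r ℕ.* x)) n ≡ (q^ (r ℕ.* x)) n - (q^ (r ℕ.* suc x)) n
  step x = begin
    ((1ₛ ⊖ q^ r) ⊛ q^ (r ℕ.* x)) n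
      ≡⟨ ⊛-cong {1ₛ ⊖ q^ r} {1ₛ ⊕ scale -1ℤ (q^ r)} {q^ (r ℕ.* x)} (λ m → cong (_+_ (1ₛ m)) (sym (-1*i≡-i
        ((q^ r) m)))) (λ _ → refl) n ⟩
    ((1ₛ ⊕ scale -1ℤ (q^ r)) ⊛ q^ (r ℕ.* x)) n
      ≡⟨ ⊛-distribʳ (q^ (r ℕ.* x)) 1ₛ (scale -1ℤ (q^ r)) n ⟩
    (1ₛ ⊛ q^ (r ℕ.* x)) n + (scale -1ℤ (q^ r) ⊛ q^ (r ℕ.* x)) n
      ≡⟨ cong₂ _+_ (1ₛ-⊛ (q^ (r ℕ.* x)) n) (trans (scale-⊛ -1ℤ (q^ r) (q^ (r ℕ.* x)) n) (-1*i≡-i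
        ((q^ r ⊛ q^ (r ℕ.* x)) n))) ⟩
    (q^ (r ℕ.* x)) n - (q^ r ⊛ q^ (r ℕ.* x)) n
      ≡⟨ cong (λ m → (q^ (r ℕ.* x)) n - m) (trans (q^-⊛ r (r ℕ.* x) n) (cong (λ m → (q^ m) n) (sym (ℕₚ.*-suc r x)))) ⟩
    (q^ (r ℕ.* x)) n - (q^ (r ℕ.* suc x)) n
      ∎

geometric-bound : ∀ r → .{{ℕ.NonZero r}} → ∀ {n N} → n ≤ N → geometric r n ≡ Σ₁ N λ x → κ r * (q^ (r ℕ.* x)) n
geometric-bound r {n} n≤N = sym (Σ₁-truncate (λ x → κ r * (q^ (r ℕ.* x)) n) n≤N λ x n<x →
  trans (cong (κ r *_) (q^-> (ℕₚ.<-≤-trans n<x (ℕₚ.m≤n*m x r)))) (*-zeroʳ (κ r)))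

1-q^-logDerivative : ∀ r → .{{ℕ.NonZero r}} → HasLogDerivative (1ₛ ⊖ q^ r) (scale -1ℤ (geometric r))
1-q^-logDerivative r n = sym (begin
  ((1ₛ ⊖ q^ r) ⊛ scale -1ℤ (geometric r)) n
    ≡⟨ ⊛-scale -1ℤ (geometric r) (1ₛ ⊖ q^ r) n ⟩
  -1ℤ * ((1ₛ ⊖ q^ r) ⊛ geometric r) n
    ≡⟨ cong (-1ℤ *_) (trans (⊛-cong-≤ (1ₛ ⊖ q^ r) n (λ i i≤n → geometric-bound r i≤n)) (geometric-telescopes r n n)) ⟩
  -1ℤ * (κ r * ((q^ r) n - (q^ (r ℕ.* suc n)) n))
    ≡⟨ cong (λ m → -1ℤ * (κ r * ((q^ r) n - m))) (q^-> (ℕₚ.m≤n*m (suc n) r)) ⟩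
  -1ℤ * (κ r * ((q^ r) n - 0ℤ))
    ≡⟨ solve! 2 (λ r x → con -1ℤ :* (r :* con 1ℤ :* (x :- con 0ℤ)) := con 0ℤ :- r :* x) refl (+ r) ((q^ r) n) ⟩
  0ℤ - + r * (q^ r) n
    ≡⟨ cong₂ _-_ (trans (sym (∂-const 1ℤ n)) (sym (∂-cong 1ₛ≈const n))) (sym (∂-q^ r n)) ⟩
  + n * 1ₛ n - + n * (q^ r) n
    ≡⟨ solve! 3 (λ n x y → n :* x :- n :* y := n :* (x :- y)) refl (+ n) (1ₛ n) ((q^ r) n) ⟩
  ∂ (1ₛ ⊖ q^ r) n
    ∎)
  where open ≡-Reasoning

τ-factor-logDerivative : ∀ r → .{{ℕ.NonZero r}}
  → HasLogDerivative (τ-factor r) (scale (+ 24) (scale -1ℤ (geometric r)))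
τ-factor-logDerivative r = ^-logDerivative {1ₛ ⊖ q^ r} {scale -1ℤ (geometric r)} 24 (1-q^-logDerivative r)

∏-logDerivative : ∀ N → HasLogDerivative (∏ N τ-factor) (λ n → Σ₁ N λ r → + 24 * (-1ℤ * geometric r n))
∏-logDerivative zero    = 1ₛ-logDerivative
∏-logDerivative (suc N) n = trans
  (logDerivative-⊛ {∏ N τ-factor} {τ-factor (suc N)} {E} {scale (+ 24) (scale -1ℤ (geometric (suc N)))} (∏-logDerivative N) (τ-factor-logDerivative (suc N)) n)
  (⊛-cong {∏ (suc N) τ-factor} {∏ (suc N) τ-factor} {E ⊕ scale (+ 24) (scale -1ℤ (geometric (suc N)))} (λ _ → refl)
    (λ m → sym (Σ₁-last N λ r → + 24 * (-1ℤ * geometric r m))) n)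
  where
  E : Series
  E n = Σ₁ N λ r → + 24 * (-1ℤ * geometric r n)

-- The coefficient of qⁿ in `∏∞` is by definition that of the n-th partial product. In the equation
-- for this partial product only coefficients up to n matter, and there both factors agree with
-- their limits.
∏∞-logDerivative : HasLogDerivative (∏∞ τ-factor) (constₛ (-[1+ 23 ]) ⊛ 𝒟 κ)
∏∞-logDerivative n = begin
  + n * ∏ n τ-factor n
    ≡⟨ ∏-logDerivative n n ⟩
  (∏ n τ-factor ⊛ (λ m → Σ₁ n λ r → + 24 * (-1ℤ * geometric r m))) n
    ≡⟨ ⊛-cong-≤ (∏ n τ-factor) n (λ i i≤n → coefficient i≤n) ⟩
  (∏ n τ-factor ⊛ E) n
    ≡⟨ ⊛-comm (∏ n τ-factor) E n ⟩
  (E ⊛ ∏ n τ-factor) n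
    ≡⟨ ⊛-cong-≤ E n (λ i i≤n → ∏∞-limit τ-factor τ-factor≡1 i n i≤n) ⟩
  (E ⊛ ∏∞ τ-factor) n
    ≡⟨ ⊛-comm E (∏∞ τ-factor) n ⟩
  (∏∞ τ-factor ⊛ E) n
    ∎
  where
  open ≡-Reasoning
  E = constₛ (-[1+ 23 ]) ⊛ 𝒟 κ
  coefficient : ∀ {i} → i ≤ n → Σ₁ n (λ r → + 24 * (-1ℤ * geometric r i)) ≡ E i
  coefficient {i} i≤n = begin
    Σ₁ n (λ r → + 24 * (-1ℤ * geometric r i))
      ≡⟨ Σ₁-cong n (λ r → trans (solve! 1 (λ x → con (+ 24) :* (con -1ℤ :* x) := con (-[1+ 23 ]) :* x)
        refl (geometric (suc r) i))
           (cong (-[1+ 23 ] *_) (geometric-bound (suc r) i≤n))) ⟩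
    Σ₁ n (λ r → -[1+ 23 ] * Σ₁ n λ x → κ r * (q^ (r ℕ.* x)) i)
      ≡⟨ Σ₁-* n -[1+ 23 ] (λ r → Σ₁ n λ x → κ r * (q^ (r ℕ.* x)) i) ⟩
    -[1+ 23 ] * Σ₁ n (λ r → Σ₁ n λ x → κ r * (q^ (r ℕ.* x)) i)
      ≡⟨ cong (-[1+ 23 ] *_) (sym (div-sum-bound (λ d _ → κ d) i≤n)) ⟩
    -[1+ 23 ] * 𝒟 κ i
      ≡⟨ const-⊛ -[1+ 23 ] (𝒟 κ) i ⟨
    E i
      ∎

q^1-logDerivative : HasLogDerivative (q^ 1) (constₛ 1ℤ)
q^1-logDerivative n = trans (∂-q^ 1 n) (trans (sym (const-⊛ 1ℤ (q^ 1) n)) (⊛-comm (constₛ 1ℤ) (q^ 1) n))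

τ-logDerivative : HasLogDerivative τ (constₛ 1ℤ ⊕ constₛ (-[1+ 23 ]) ⊛ 𝒟 κ)
τ-logDerivative = logDerivative-⊛ {q^ 1} {∏∞ τ-factor} {constₛ 1ℤ} {constₛ (-[1+ 23 ]) ⊛ 𝒟 κ} q^1-logDerivative ∏∞-logDerivative

-- The coefficient of qⁿ in ∂ f = f P reads (n - w) f(n) = Σ_{j>0} P(j) f(n - j), w = P(0).
logDerivative-vanishing : ∀ {f P} w (A : ℕ → Set) → HasLogDerivative f P → P 0 ≡ + w →
  (∀ i j → A (suc j ℕ.+ i) → A i ⊎ P (suc j) ≡ 0ℤ) → (A w → f w ≡ 0ℤ) → ∀ n → A n → f n ≡ 0ℤ
logDerivative-vanishing {f} {P} w A ∂f≈fP P0≡w split fw≡0 = <-rec _ step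
  where
  open ≡-Reasoning
  -- The hypothesis `split` says that `A` is closed under subtraction of the positive exponents that
  -- occur in `P`. It is applied to all exponents for the uniqueness of the discriminant and to the
  -- odd ones for Q U².
  tail-vanishes : ∀ n → A (suc n) → (∀ {i} → i < suc n → A i → f i ≡ 0ℤ) → (tail P ⊛ f) n ≡ 0ℤ
  tail-vanishes n An ih = trans
    (sum-cong-≗ {suc n} {λ i → P (suc (toℕ i)) * f (n ∸ toℕ i)} {λ _ → 0ℤ} λ i → term (toℕ i) (toℕ≤pred[n] i))
    (sum-replicate-zero (suc n))
    where
    term : ∀ i → i ≤ n → P (suc i) * f (n ∸ i) ≡ 0ℤ
    term i i≤n = [ (λ a → trans (cong (P (suc i) *_) (ih (s≤s (ℕₚ.m∸n≤m n i)) a)) (*-zeroʳ (P (suc i))))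
                 , (λ Pi≡0 → trans (cong (_* f (n ∸ i)) Pi≡0) (*-zeroˡ (f (n ∸ i)))) ]′
      (split (n ∸ i) i (subst A (cong suc (sym (ℕₚ.m+[n∸m]≡n i≤n))) An))

  leading : ∀ n → A n → (∀ {i} → i < n → A i → f i ≡ 0ℤ) → (P ⊛ f) n ≡ P 0 * f n
  leading zero    An ih = +-identityʳ _
  leading (suc n) An ih = trans (cong (_+_ (P 0 * f (suc n))) (tail-vanishes n An ih)) (+-identityʳ _)

  step : ∀ n → (∀ {i} → i < n → A i → f i ≡ 0ℤ) → A n → f n ≡ 0ℤ
  step n ih An with n ℕ.≟ w
  ... | yes refl = fw≡0 An
  ... | no n≢w   = [ (λ n-w≡0 → ⊥-elim (n≢w (+-injective (i-j≡0⇒i≡j (+ n) (+ w) n-w≡0)))) , (λ z → z) ]′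
    (i*j≡0⇒i≡0∨j≡0 (+ n - + w) (begin
      (+ n - + w) * f n
        ≡⟨ solve! 3 (λ n w x → (n :- w) :* x := n :* x :- w :* x) refl (+ n) (+ w) (f n) ⟩
      + n * f n - + w * f n
        ≡⟨ cong₂ (λ x y → x - y * f n) (trans (∂f≈fP n) (trans (⊛-comm f P n) (leading n An ih))) (sym P0≡w) ⟩
      P 0 * f n - P 0 * f n
        ≡⟨ +-inverseʳ (P 0 * f n) ⟩
      0ℤ
        ∎))

-- Eisenstein series with signs

T : ℕ → Series
T r = 𝒟 (θ r)

∂-const₀ : ∀ c → ∂ (constₛ c) ≈ constₛ 0ℤ
∂-const₀ c n = trans (∂-const c n) (const-0 n)

open EisensteinRing Series-commutativeRing const-homomorphism using (module Derivation)
open Derivation ∂ ∂-cong ∂-⊕ ∂-⊛ ∂-const₀ using (module Eisenstein)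
open Eisenstein (𝒟 κ) (T 1) (T 3) (T 5) (T 7) (T 9) (T 11)

∂e : constₛ (+ 2) ⊛ ∂ e ≈ P ⊛ e ⊕ ⊝ Q
∂e = ∂e-identity even-identity₂ odd-identity₀

Q-logDerivative : HasLogDerivative Q (P ⊕ ⊝ e)
Q-logDerivative = ∂Q-identity even-identity₄ odd-identity₂

U-logDerivative : HasLogDerivative U P
U-logDerivative = ∂U-identity ∂e Q-logDerivative

discriminant : Series
discriminant = Q ⊛ Q ⊛ U

discriminant-logDerivative : HasLogDerivative discriminant (constₛ 1ℤ ⊕ constₛ (-[1+ 23 ]) ⊛ 𝒟 κ)
discriminant-logDerivative n = trans
  (logDerivative-⊛ {Q ⊛ Q} {U} {(P ⊕ ⊝ e) ⊕ (P ⊕ ⊝ e)} {P} (logDerivative-⊛ {Q} {Q} {P ⊕ ⊝ e} {P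
    ⊕ ⊝ e} Q-logDerivative Q-logDerivative) U-logDerivative n)
  (⊛-cong {discriminant} {discriminant} {(P ⊕ ⊝ e) ⊕ (P ⊕ ⊝ e) ⊕ P} (λ _ → refl) weight-2-identity n)

logDerivative-⊕ : ∀ {f g P} c → HasLogDerivative f P → HasLogDerivative g P → HasLogDerivative (f ⊕ scale c g) P
logDerivative-⊕ {f} {g} {P} c p q n = begin
  + n * (f n + c * g n)            ≡⟨ solve! 4 (λ n f c g → n :* (f :+ c :* g) := n :* f :+ c :* (n :* g))
    refl (+ n) (f n) c (g n) ⟩
  + n * f n + c * (+ n * g n)      ≡⟨ cong₂ (λ x y → x + c * y) (p n) (q n) ⟩
  (f ⊛ P) n + c * (g ⊛ P) n        ≡⟨ cong (_+_ ((f ⊛ P) n)) (scale-⊛ c g P n) ⟨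
  (f ⊛ P) n + (scale c g ⊛ P) n    ≡⟨ ⊛-distribʳ P f (scale c g) n ⟨
  ((f ⊕ scale c g) ⊛ P) n          ∎
  where open ≡-Reasoning

-- Both sides have the logarithmic derivative E₂, with constant term 1, so their difference is
-- determined by its coefficient of q. That one is computed: e = 1 + 24 q + ... and Q = 1 - 16 q +
-- ... give U = 64 q + ..., while τ(1) = 1.
discriminant≡64τ : ∀ n → discriminant n ≡ + 64 * τ n
discriminant≡64τ n = i-j≡0⇒i≡j (discriminant n) (+ 64 * τ n) (trans
  (cong (_+_ (discriminant n)) (neg-distribˡ-* (+ 64) (τ n)))
  (logDerivative-vanishing {discriminant ⊕ scale (-[1+ 63 ]) τ} {constₛ 1ℤ ⊕ constₛ (-[1+ 23 ]) ⊛ 𝒟 κ} 1 (λ _ → ⊤)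
    (logDerivative-⊕ {discriminant} {τ} {constₛ 1ℤ
      ⊕ constₛ (-[1+ 23 ]) ⊛ 𝒟 κ} (-[1+ 63 ]) discriminant-logDerivative τ-logDerivative)
    refl (λ _ _ _ → inj₁ tt) (λ _ → refl) n tt))

-- All divisors of an odd number are odd, so every sign is -1.
θ-odd : ∀ r n → ¬ (2 ∣ n) → T r n ≡ - 𝒟 (λ d → (+ d) ^ r) n
θ-odd r n 2∤n = trans
  (Σ₁-cong n λ d → trans (Σ₁-cong n λ x → term (suc d) (suc x)) (Σ₁-* n -1ℤ λ x
    → (+ suc d) ^ r * (q^ (suc d *ℕ x)) n))
  (trans (Σ₁-* n -1ℤ λ d → Σ₁ n λ x → (+ d) ^ r * (q^ (d *ℕ x)) n) (-1*i≡-i _))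
  where
  sign : ∀ d → ¬ (2 ∣ d) → s d ≡ -1ℤ
  sign 0             2∤d = ⊥-elim (2∤d (2 ∣0))
  sign 1             2∤d = refl
  sign (suc (suc d)) 2∤d = trans (solve! 1 (λ x → con -1ℤ :* (con -1ℤ :* x) := x) refl (s d))
    (sign d λ 2∣d → 2∤d (∣m∣n⇒∣m+n ∣-refl 2∣d))
  term : ∀ d x → θ r d * (q^ (d *ℕ x)) n ≡ -1ℤ * ((+ d) ^ r * (q^ (d *ℕ x)) n)
  term d x with d *ℕ x ℕ.≟ n
  ... | yes refl = trans (cong (λ t → t * (+ d) ^ r * (q^ (d *ℕ x)) (d *ℕ x)) (sign d λ 2∣d → 2∤n (∣m⇒∣m*n x 2∣d)))
                     (*-assoc -1ℤ ((+ d) ^ r) _)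
  ... | no dx≢n  = trans (vanish (θ r d)) (sym (trans (cong (-1ℤ *_) (vanish ((+ d) ^ r))) (*-zeroʳ -1ℤ)))
    where
    vanish : ∀ c → c * (q^ (d *ℕ x)) n ≡ 0ℤ
    vanish c = trans (cong (c *_) (q^-≢ (d *ℕ x) n dx≢n)) (*-zeroʳ c)

-- Q U² is a multiple of the series of Δ(q²).
QUU-odd : ∀ n → ¬ (2 ∣ n) → (Q ⊛ U ⊛ U) n ≡ 0ℤ
QUU-odd = logDerivative-vanishing {Q ⊛ U ⊛ U} {(P ⊕ ⊝ e) ⊕ P ⊕ P} 2 (λ n → ¬ (2 ∣ n))
  (logDerivative-⊛ {Q ⊛ U} {U} {(P ⊕ ⊝ e) ⊕ P} {P} (logDerivative-⊛ {Q} {U} {P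
    ⊕ ⊝ e} {P} Q-logDerivative U-logDerivative) U-logDerivative)
  -- The recursion leaves the coefficient at exponent 2 free, but 2 is even and so outside the set
  -- considered.
  refl split (λ 2∤2 → ⊥-elim (2∤2 ∣-refl))
  where
  open ≡-Reasoning
  -- The logarithmic derivative 3 P - e is classically 2 E₂(q²). At odd exponents t₁ = -S, so -24 t₁
  -- = 24 S cancels against 12 (S - t₁) = 24 S.
  vanish : ∀ j → ¬ (2 ∣ suc j) → ((P ⊕ ⊝ e) ⊕ P ⊕ P) (suc j) ≡ 0ℤ
  vanish j 2∤j = begin
    (0ℤ + (constₛ -[1+ 7 ] ⊛ T 1) (suc j)) + - (0ℤ + (constₛ (+ 12) ⊛ (𝒟 κ ⊕ ⊝ T 1)) (suc j))
      + (0ℤ + (constₛ -[1+ 7 ] ⊛ T 1) (suc j)) + (0ℤ + (constₛ -[1+ 7 ] ⊛ T 1) (suc j))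
      ≡⟨ cong₂ (λ x y → (0ℤ + x) + - (0ℤ + y) + (0ℤ + x) + (0ℤ + x))
           (trans (const-⊛ -[1+ 7 ] (T 1) (suc j)) (cong (-[1+ 7 ] *_) (θ-odd 1 (suc j) 2∤j)))
           (trans (const-⊛ (+ 12) (𝒟 κ ⊕ ⊝ T 1) (suc j)) (cong (λ z → + 12 * (𝒟 κ (suc j)
             + - z)) (θ-odd 1 (suc j) 2∤j))) ⟩
    (0ℤ + -[1+ 7 ] * - 𝒟 κ (suc j)) + - (0ℤ + + 12 * (𝒟 κ (suc j) + - - 𝒟 κ (suc j)))
      + (0ℤ + -[1+ 7 ] * - 𝒟 κ (suc j)) + (0ℤ + -[1+ 7 ] * - 𝒟 κ (suc j))
      ≡⟨ solve! 1 (λ y → (con 0ℤ :+ con -[1+ 7 ] :* :- y) :+ :- (con 0ℤ :+ con (+ 12) :* (y :+ :- (:- y)))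
                  :+ (con 0ℤ :+ con -[1+ 7 ] :* :- y) :+ (con 0ℤ :+ con -[1+ 7 ] :* :- y) := con 0ℤ)
                    refl (𝒟 κ (suc j)) ⟩
    0ℤ
      ∎
  split : ∀ i j → ¬ (2 ∣ suc j ℕ.+ i) → ¬ (2 ∣ i) ⊎ ((P ⊕ ⊝ e) ⊕ P ⊕ P) (suc j) ≡ 0ℤ
  split i j 2∤j+i with 2 ∣? i
  ... | no 2∤i  = inj₁ 2∤i
  ... | yes 2∣i = inj₂ (vanish j λ 2∣j → 2∤j+i (∣m∣n⇒∣m+n 2∣j 2∣i))

-- Odd coefficients of the weight 12 identity

Σ₁≡∑ : ∀ N f → Σ₁ N f ≡ ∑[ i < N ] f (suc (toℕ i))
Σ₁≡∑ zero    f = refl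
Σ₁≡∑ (suc N) f = cong (_+_ (f 1)) (Σ₁≡∑ N (f ∘ suc))

⊛-interior : ∀ f g m → f 0 ≡ 0ℤ → g 0 ≡ 0ℤ → (f ⊛ g) (suc m) ≡ Σ₁ m λ i → f i * g (suc m ∸ i)
⊛-interior f g m f0≡0 g0≡0 = begin
  f 0 * g (suc m) + (tail f ⊛ g) m
    ≡⟨ cong₂ _+_ (trans (cong (_* g (suc m)) f0≡0) (*-zeroˡ (g (suc m)))) (sym (Σ₁≡∑ (suc m) λ i
      → f i * g (suc m ∸ i))) ⟩
  0ℤ + Σ₁ (suc m) (λ i → f i * g (suc m ∸ i))
    ≡⟨ trans (+-identityˡ _) (Σ₁-last m λ i → f i * g (suc m ∸ i)) ⟩
  Σ₁ m (λ i → f i * g (suc m ∸ i)) + f (suc m) * g (m ∸ m)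
    ≡⟨ cong (λ z → Σ₁ m (λ i → f i * g (suc m ∸ i)) + z)
         (trans (cong (f (suc m) *_) (trans (cong g (ℕₚ.n∸n≡0 m)) g0≡0)) (*-zeroʳ (f (suc m)))) ⟩
  Σ₁ m (λ i → f i * g (suc m ∸ i)) + 0ℤ
    ≡⟨ +-identityʳ _ ⟩
  Σ₁ m (λ i → f i * g (suc m ∸ i))
    ∎
  where open ≡-Reasoning

interior-sum : ∀ m → Σ[1≤m< suc m ] (λ i → σ† 3 i * σ† 7 (suc m ∸ i) - σ† 5 i * σ† 5 (suc m ∸ i))
  ≡ (T 3 ⊛ T 7) (suc m) - (T 5 ⊛ T 5) (suc m)
interior-sum m = begin
  ∑[ i < m ] h (suc (toℕ i))
    ≡⟨ Σ₁≡∑ m h ⟨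
  Σ₁ m h
    ≡⟨ Σ₁-cong m (λ i → cong₂ _-_ (cong₂ _*_ (σ†-T 3 (suc i)) (σ†-T 7 (m ∸ i)))
      (cong₂ _*_ (σ†-T 5 (suc i)) (σ†-T 5 (m ∸ i)))) ⟩
  Σ₁ m (λ i → T 3 i * T 7 (suc m ∸ i) - T 5 i * T 5 (suc m ∸ i))
    ≡⟨ Σ₁-cong m (λ i → cong (_+_ (T 3 (suc i) * T 7 (m ∸ i))) (sym (-1*i≡-i (T 5 (suc i) * T 5 (m ∸ i))))) ⟩
  Σ₁ m (λ i → T 3 i * T 7 (suc m ∸ i) + -1ℤ * (T 5 i * T 5 (suc m ∸ i)))
    ≡⟨ Σ₁-+ m (λ i → T 3 i * T 7 (suc m ∸ i)) (λ i → -1ℤ * (T 5 i * T 5 (suc m ∸ i))) ⟩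
  Σ₁ m (λ i → T 3 i * T 7 (suc m ∸ i)) + Σ₁ m (λ i → -1ℤ * (T 5 i * T 5 (suc m ∸ i)))
    ≡⟨ cong (_+_ (Σ₁ m λ i → T 3 i * T 7 (suc m ∸ i))) (trans (Σ₁-* m -1ℤ λ i
      → T 5 i * T 5 (suc m ∸ i)) (-1*i≡-i _)) ⟩
  Σ₁ m (λ i → T 3 i * T 7 (suc m ∸ i)) - Σ₁ m (λ i → T 5 i * T 5 (suc m ∸ i))
    ≡⟨ cong₂ _-_ (⊛-interior (T 3) (T 7) m refl refl) (⊛-interior (T 5) (T 5) m refl refl) ⟨
  (T 3 ⊛ T 7) (suc m) - (T 5 ⊛ T 5) (suc m)
    ∎
  where
  open ≡-Reasoning
  h : ℕ → ℤ
  h i = σ† 3 i * σ† 7 (suc m ∸ i) - σ† 5 i * σ† 5 (suc m ∸ i)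
  σ†-T : ∀ r → σ† r ≈ T r
  σ†-T r = sum-divisors (θ r)

discriminant≡τ*64 : ∀ n → discriminant n ≡ τ n * + 64
discriminant≡τ*64 n = trans (discriminant≡64τ n) (*-comm (+ 64) (τ n))

σ-T : ∀ r n → ¬ (2 ∣ n) → T r n ≡ - σ r n
σ-T r n 2∤n = trans (θ-odd r n 2∤n) (cong -_ (sym (sum-divisors (λ d → (+ d) ^ r) n)))

odd-coefficient : ∀ m → ¬ (2 ∣ suc m) → T 11 (suc m) * + 9 ≡
  (T 3 (suc m) * + 17 + T 5 (suc m) * + 8 + T 7 (suc m) * + 2 + ((T 3 ⊛ T 7) (suc m)
    - (T 5 ⊛ T 5) (suc m)) * + 32) * + 691 + τ (suc m) * + 18648
odd-coefficient m 2∤n = Coefficient.weight-12-coefficient (λ (f : Series) → f (suc m)) (λ eq → eq (suc m)) (λ _ _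
  → refl) (λ _ → refl)
  (λ c f → trans (const-⊛ c f (suc m)) (*-comm c (f (suc m))))
  {t = τ (suc m)} (R₆-identity odd-identity₂) (R₈-identity odd-identity₄) (R₁₀-identity odd-identity₆) (R₁₂-identity odd-identity₈)
  (discriminant≡τ*64 (suc m)) (QUU-odd (suc m) 2∤n)

-- For odd n the single coefficients change from signed to unsigned sums with a minus sign. In the
-- convolutions one of m and n - m is even, so there the signed sums stay. Here 22112 = 32 · 691 and
-- 18648 = 72 · 259.
odd-integer-identity : ∀ m → ¬ (2 ∣ suc m) → let n = suc m in
  τ n * + 18648 ≡ (σ 3 n * + 17 + σ 5 n * + 8 + σ 7 n * + 2) * + 691 - σ 11 n * + 9
    - (Σ[1≤m< n ] (λ m → σ† 3 m * σ† 7 (n ∸ m) - σ† 5 m * σ† 5 (n ∸ m))) * + 22112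
odd-integer-identity m 2∤n = begin
  τ n * + 18648
    ≡⟨ solve! 2 (λ t x → t := x :+ t :- x) refl (τ n * + 18648) ((T 3 n * + 17 + T 5 n * + 8 + T 7 n * + 2
      + B * + 32) * + 691) ⟩
  (T 3 n * + 17 + T 5 n * + 8 + T 7 n * + 2 + B * + 32) * + 691 + τ n * + 18648 - (T 3 n * + 17 + T 5 n * + 8
    + T 7 n * + 2 + B * + 32) * + 691
    ≡⟨ cong (_- (T 3 n * + 17 + T 5 n * + 8 + T 7 n * + 2 + B * + 32) * + 691) (odd-coefficient m 2∤n) ⟨
  T 11 n * + 9 - (T 3 n * + 17 + T 5 n * + 8 + T 7 n * + 2 + B * + 32) * + 691
    ≡⟨ cong₂ (λ x y → x * + 9 - (y + B * + 32) * + 691) (σ-T 11 n 2∤n)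
         (cong₂ _+_ (cong₂ (λ x y → x * + 17 + y * + 8) (σ-T 3 n 2∤n) (σ-T 5 n 2∤n)) (cong (_* + 2) (σ-T 7 n 2∤n))) ⟩
  - σ 11 n * + 9 - (- σ 3 n * + 17 + - σ 5 n * + 8 + - σ 7 n * + 2 + B * + 32) * + 691
    ≡⟨ solve! 5 (λ a b c d f → :- d :* con (+ 9) :- (:- a :* con (+ 17) :+ :- b :* con (+ 8) :+ :- c :* con (+ 2)
      :+ f :* con (+ 32)) :* con (+ 691)
         := (a :* con (+ 17) :+ b :* con (+ 8) :+ c :* con (+ 2)) :* con (+ 691) :- d :* con (+ 9)
           :- f :* con (+ 22112)) refl
         (σ 3 n) (σ 5 n) (σ 7 n) (σ 11 n) B ⟩
  (σ 3 n * + 17 + σ 5 n * + 8 + σ 7 n * + 2) * + 691 - σ 11 n * + 9 - B * + 22112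
    ≡⟨ cong (λ z → (σ 3 n * + 17 + σ 5 n * + 8 + σ 7 n * + 2) * + 691 - σ 11 n * + 9 - z * + 22112) (interior-sum m) ⟨
  (σ 3 n * + 17 + σ 5 n * + 8 + σ 7 n * + 2) * + 691 - σ 11 n * + 9
    - (Σ[1≤m< n ] (λ m → σ† 3 m * σ† 7 (n ∸ m) - σ† 5 m * σ† 5 (n ∸ m))) * + 22112
    ∎
  where
  open ≡-Reasoning
  n = suc m
  B = (T 3 ⊛ T 7) n - (T 5 ⊛ T 5) n

-- Passage to rational numbers

toℚᵘ-/ : ∀ i d → toℚᵘ (i / suc d) ≃ᵘ mkℚᵘ i d
toℚᵘ-/ i d = ℚₚ.toℚᵘ-fromℚᵘ (mkℚᵘ i d)

-- For unnormalised fractions equality is cross multiplication, here with the denominator 648 = 72 ·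
-- 9. The coefficient 2764 / 9 is 22112 / 72.
clear-denominators : ∀ t a b → t * + 72 ≡ a - b * + 22112 → ι t ≡ (+ 1 / 72) *ℚ ι a -ℚ (+ 2764 / 9) *ℚ ι b
clear-denominators t a b eq = ℚₚ.toℚᵘ-injective (begin
  toℚᵘ (ι t)
    ≈⟨ toℚᵘ-/ t 0 ⟩
  mkℚᵘ t 0
    ≈⟨ *≡* cross ⟩
  mkℚᵘ (+ 1) 71 ℚᵘ.* mkℚᵘ a 0 ℚᵘ.- mkℚᵘ (+ 2764) 8 ℚᵘ.* mkℚᵘ b 0
    ≈⟨ ℚᵘₚ.+-cong (ℚᵘₚ.*-cong (toℚᵘ-/ (+ 1) 71) (toℚᵘ-/ a 0)) (ℚᵘₚ.-‿cong (ℚᵘₚ.*-cong (toℚᵘ-/ (+ 2764) 8) (toℚᵘ-/ b 0))) ⟨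
  toℚᵘ (+ 1 / 72) ℚᵘ.* toℚᵘ (ι a) ℚᵘ.- toℚᵘ (+ 2764 / 9) ℚᵘ.* toℚᵘ (ι b)
    ≈⟨ ℚᵘₚ.+-cong (ℚₚ.toℚᵘ-homo-* (+ 1 / 72) (ι a)) (ℚᵘₚ.≃-trans (ℚₚ.toℚᵘ-homo‿- ((+ 2764 / 9) *ℚ ι b)) (ℚᵘₚ.-‿cong (ℚₚ.toℚᵘ-homo-* (+ 2764 / 9) (ι b)))) ⟨
  toℚᵘ ((+ 1 / 72) *ℚ ι a) ℚᵘ.+ toℚᵘ (-ℚ ((+ 2764 / 9) *ℚ ι b))
    ≈⟨ ℚₚ.toℚᵘ-homo-+ ((+ 1 / 72) *ℚ ι a) (-ℚ ((+ 2764 / 9) *ℚ ι b)) ⟨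
  toℚᵘ ((+ 1 / 72) *ℚ ι a -ℚ (+ 2764 / 9) *ℚ ι b)
    ∎)
  where
  open ℚᵘₚ.≃-Reasoning
  cross : t * + 648 ≡ (+ 1 * a * + 9 + - (+ 2764 * b) * + 72) * + 1
  cross = trans (solve! 1 (λ t → t :* con (+ 648) := t :* con (+ 72) :* con (+ 9)) refl t) (trans (cong (_* + 9) eq)
    (trans (solve! 2 (λ a b → (a :- b :* con (+ 22112)) :* con (+ 9) := (a :* con (+ 9)
      :+ :- (b :* con (+ 2764)) :* con (+ 72)) :* con (+ 1)) refl a b)
      (sym (cong₂ (λ x y → (x * + 9 + - y * + 72) * + 1) (*-identityˡ a) (*-comm (+ 2764) b)))))

theorem1p8 : ∀ (n : ℕ) → ¬ (2 ∣ n) →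
    ι (+ 259 * τ n)
    ≡ (+ 1 / (2 ^ℕ 3 *ℕ 3 ^ℕ 2))
        *ℚ ι (+ 17 * + 691 * σ 3 n + + 8 * + 691 * σ 5 n + + 2 * + 691 * σ 7 n - + 9 * σ 11 n)
      -ℚ (+ (691 *ℕ 2 ^ℕ 2) / (3 ^ℕ 2))
        *ℚ ι (Σ[1≤m< n ] (λ m → σ† 3 m * σ† 7 (n ∸ m) - σ† 5 m * σ† 5 (n ∸ m)))
theorem1p8 zero    2∤0 = ⊥-elim (2∤0 (2 ∣0))
-- The denominators 2³ · 3² and 3² and the numerator 691 · 2² of the statement compute to 72, 9 and
-- 2764.
theorem1p8 (suc m) 2∤n = clear-denominators (+ 259 * τ n) A B (begin
  + 259 * τ n * + 72
    ≡⟨ cong (_* + 72) (*-comm (+ 259) (τ n)) ⟩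
  τ n * + 259 * + 72
    ≡⟨ *-assoc (τ n) (+ 259) (+ 72) ⟩
  τ n * + 18648
    ≡⟨ odd-integer-identity m 2∤n ⟩
  (σ 3 n * + 17 + σ 5 n * + 8 + σ 7 n * + 2) * + 691 - σ 11 n * + 9 - B * + 22112
    ≡⟨ cong (_- B * + 22112) (arrange (σ 3 n) (σ 5 n) (σ 7 n) (σ 11 n)) ⟩
  A - B * + 22112
    ∎)
  where
  open ≡-Reasoning
  n = suc m
  A = + 17 * + 691 * σ 3 n + + 8 * + 691 * σ 5 n + + 2 * + 691 * σ 7 n - + 9 * σ 11 n
  B = Σ[1≤m< n ] (λ m → σ† 3 m * σ† 7 (n ∸ m) - σ† 5 m * σ† 5 (n ∸ m))
  arrange : ∀ a b c d → (a * + 17 + b * + 8 + c * + 2) * + 691 - d * + 9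
                        ≡ + 17 * + 691 * a + + 8 * + 691 * b + + 2 * + 691 * c - + 9 * d
  arrange a b c d = trans
    -- The literals 11747, 5528 and 1382 are 17 · 691, 8 · 691 and 2 · 691, to which the products in
    -- the statement compute.
    (solve! 4 (λ a b c d → (a :* con (+ 17) :+ b :* con (+ 8) :+ c :* con (+ 2)) :* con (+ 691) :- d :* con (+ 9)
      := a :* con (+ 11747) :+ b :* con (+ 5528) :+ c :* con (+ 1382) :- d :* con (+ 9)) refl a b c d)
    (cong₂ _-_ (cong₂ _+_ (cong₂ _+_ (*-comm a (+ 11747)) (*-comm b (+ 5528))) (*-comm c (+ 1382))) (*-comm d (+ 9)))
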